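{- There exists a kernelization mapping instances $(U,\mathcal A,k)$ of $d$-HittingSet with $|U|=n$ elements to a kernel with at most $d\cdot d!\cdot k^d$ sets (hence at most $d^2\cdot d!\cdot k^d$ elements). The data reduction chains in this kernelization have length $O(n^d/k)$, and their soundness can be witnessed by polynomial-size Frege proofs. Hence for every fixed $k,d$, unsatisfiable instances $\Phi_{(U,\mathcal A,k)}$ of $d$-HittingSet have extended Frege proofs (of unsatisfiability) of size $O(\mathrm{poly}(|\Phi_{(U,\mathcal A,k)}|))$.
   Context: $d$-HittingSet: given a universe $U$, a family $\mathcal A$ of subsets of $U$, all of cardinality at most $d$, and an integer $k$ (the parameter), decide whether there is $H\subseteq U$ with at most $k$ elements that intersects every $A\in\mathcal A$. Propositional translation $\Phi_{(U,\mathcal A,k)}$: variables $X_{i,j}$ for $i\in U$, $1\le j\le k$ ("$i$ is the $j$-th chosen element"). Clauses: $\bigvee_{i\in U}X_{i,j}$ for each $j$; $\overline{X_{i,j}}\vee\overline{X_{i',j}}$ for $i\neq i'\in U$ and each $j$; $\bigvee_{i\in A}\bigvee_{j=1}^{k}X_{i,j}$ for each $A\in\mathcal A$. Proof systems. A Frege system is a sound and complete propositional proof system with finitely many axiom schemes and rules (all are polynomially equivalent; fix one whose only rule is modus ponens); extended Frege proofs may also introduce new variables as abbreviations for formulas. The length (size) of a proof is measured by the number of clauses in it. A proof for an unsatisfiable formula means a refutation. Witnessing $\Phi_1\vdash\Phi_2$ by Frege proofs means: with disjoint variables $X,Y$ for $\Phi_1,\Phi_2$, there are substitutions $Y_i=\Xi_i[X]$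 such that the clauses of $\Phi_2[Y]$, with the substitutions expanded, have a derivation from the clauses of $\Phi_1[X]$. Kernelization. A data reduction rule for a parameterized problem $L$ is an algorithm, polynomial time in $|x|+k$, mapping $(x,k)$ to $(x',k')$ with $(x,k)\in L\iff(x',k')\in L$ and $|x'|\le|x|$. A kernelization is a polynomial-time map to an equivalent instance (the kernel) of size bounded by a computable function of $k$ (here, for fixed $d$); it is obtained by applying finitely many data reduction rules as long as possible. A data reduction chain is the sequence of instances so obtained, its length being the number of steps. The soundness of the reduction steps is witnessed by Frege proofs of polynomial size if there are an integer $R\ge 1$ and a polynomial $h$ such that for every negative instance $(x,k)$ and each step $(x_i,k_i)\to(x_{i+1},k_{i+1})$ of its chain there are a tautology $\bigvee_{t=1}^{r}\Xi_{i,t}$ with $r\le R$ and formulas $\eta_{i,t}$ isomorphic (up to renaming) to $\Phi(x_{i+1},k_{i+1})$ such that this tautology and all implications $\Phi(x_i,k_i)\wedge\Xi_{i,t}\vdash\eta_{i,t}$ have Frege proofs of total size at most $h(|\Phi(x,k)|)$. -}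

module Defs where

open import Data.Bool.Base using (Bool; true; false)
open import Data.Fin.Base using (Fin)
open import Data.Fin.Properties using () renaming (_≟_ to _≟ᶠ_)
open import Data.Fin.Subset using (Subset; _∩_; Nonempty) renaming (∣_∣ to card)
open import Data.Fin.Subset.Properties using (_∈?_)
open import Data.List.Base
  using (List; []; _∷_; _++_; map; foldr; filter; length; sum; allFin; tabulate;
         concatMap; cartesianProduct)
open import Data.List.Membership.Propositional using (_∈_)
open import Data.List.Relation.Unary.All using (All)
open import Data.List.Relation.Unary.Any using (Any)
open import Data.List.Relation.Unary.Unique.Propositional using (Unique)
open import Data.Nat.Base using (ℕ; zero; suc; _+_; _*_; _≤_)
open import Data.Product.Base using (Σ; ∃; ∃-syntax; _×_; _,_; proj₁; proj₂)
open import Data.Sum.Base using (_⊎_; inj₁; inj₂)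
open import Data.Vec.Base using (toList)
open import Function.Base using (_∘_)
open import Function.Bundles using (_⇔_; _↔_; Inverse)
open import Relation.Binary.PropositionalEquality.Core using (_≡_; _≢_)
open import Relation.Nullary.Decidable.Core using (¬?)
open import Relation.Nullary.Negation.Core using (¬_)

------------------------------------------------------------------------
-- Polynomials

-- Coefficient lists, constant term first.
Poly : Set
Poly = List ℕ

eval : Poly → ℕ → ℕ
eval []      m = 0
eval (c ∷ p) m = c + m * eval p m

------------------------------------------------------------------------
-- Polynomial time

-- The model of computation is a variable-free form of Jones's WHILE language
-- ("Computability and Complexity from a Programming Perspective"): data are
-- binary trees, and time counts the operations executed.  Up to polynomials
-- this is Turing machine time.

infixr 5 _∙_

data Tree : Set where
  nil : Tree
  _∙_ : Tree → Tree → Tree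

treeSize : Tree → ℕ
treeSize nil     = 1
treeSize (s ∙ t) = suc (treeSize s + treeSize t)

infixr 9 _⨾_

data Program : Set where
  skip  : Program
  leaf  : Program
  left  : Program
  right : Program
  cons  : Program → Program → Program
  _⨾_   : Program → Program → Program
  if    : Program → Program → Program → Program
  while : Program → Program → Program

-- p ⊢ s ⇓ t # c : on input s, p halts with output t after c operations.
-- The tree nil counts as false, every other tree as true; left and right
-- return nil on nil.
infix 4 _⊢_⇓_#_

data _⊢_⇓_#_ : Program → Tree → Tree → ℕ → Set where
  skip⇓     : ∀ {s} → skip ⊢ s ⇓ s # 1
  leaf⇓     : ∀ {s} → leaf ⊢ s ⇓ nil # 1
  left-nil  : left ⊢ nil ⇓ nil # 1
  left-∙    : ∀ {s t} → left ⊢ s ∙ t ⇓ s # 1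
  right-nil : right ⊢ nil ⇓ nil # 1
  right-∙   : ∀ {s t} → right ⊢ s ∙ t ⇓ t # 1
  cons⇓     : ∀ {p q s t u a b} → p ⊢ s ⇓ t # a → q ⊢ s ⇓ u # b →
              cons p q ⊢ s ⇓ t ∙ u # suc (a + b)
  ⨾⇓        : ∀ {p q s t u a b} → p ⊢ s ⇓ t # a → q ⊢ t ⇓ u # b →
              p ⨾ q ⊢ s ⇓ u # suc (a + b)
  if-true   : ∀ {e p q s t u v a b} → e ⊢ s ⇓ u ∙ v # a → p ⊢ s ⇓ t # b →
              if e p q ⊢ s ⇓ t # suc (a + b)
  if-false  : ∀ {e p q s t a b} → e ⊢ s ⇓ nil # a → q ⊢ s ⇓ t # b →
              if e p q ⊢ s ⇓ t # suc (a + b)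
  while-go  : ∀ {e p s t r u v a b c} → e ⊢ s ⇓ u ∙ v # a → p ⊢ s ⇓ t # b →
              while e p ⊢ t ⇓ r # c → while e p ⊢ s ⇓ r # suc (a + b + c)
  while-end : ∀ {e p s a} → e ⊢ s ⇓ nil # a → while e p ⊢ s ⇓ s # suc a

codeℕ : ℕ → Tree
codeℕ zero    = nil
codeℕ (suc m) = nil ∙ codeℕ m

codeBool : Bool → Tree
codeBool false = nil
codeBool true  = nil ∙ nil

codeList : {A : Set} → (A → Tree) → List A → Tree
codeList code = foldr (λ a t → code a ∙ t) nil

------------------------------------------------------------------------
-- Formulas in conjunctive normal form

data Literal (V : Set) : Set where
  pos neg : V → Literal V

Clause : Set → Set
Clause V = List (Literal V)

CNF : Set → Set
CNF V = List (Clause V)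

renameLiteral : {V W : Set} → (V → W) → Literal V → Literal W
renameLiteral f (pos v) = pos (f v)
renameLiteral f (neg v) = neg (f v)

Isomorphic : {V W : Set} → CNF V → CNF W → Set
Isomorphic {V} {W} φ ψ =
  Σ (V ↔ W) λ ρ → map (map (renameLiteral (Inverse.to ρ))) φ ≡ ψ

Holds : {V : Set} → (V → Bool) → Literal V → Set
Holds α (pos v) = α v ≡ true
Holds α (neg v) = α v ≡ false

Unsatisfiable : {V : Set} → CNF V → Set
Unsatisfiable {V} φ = (α : V → Bool) → ¬ All (Any (Holds α)) φ

------------------------------------------------------------------------
-- Propositional formulas

infixr 6 _`∧_
infixr 5 _`∨_
infixr 4 _⇒_

data Form (V : Set) : Set where
  var            : V → Form V
  `⊥             : Form V
  _`∧_ _`∨_ _⇒_  : Form V → Form V → Form V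

`¬_ : {V : Set} → Form V → Form V
`¬ φ = φ ⇒ `⊥

⋁ : {V : Set} → List (Form V) → Form V
⋁ = foldr _`∨_ `⊥

subst : {V W : Set} → (V → Form W) → Form V → Form W
subst σ (var v)  = σ v
subst σ `⊥       = `⊥
subst σ (φ `∧ ψ) = subst σ φ `∧ subst σ ψ
subst σ (φ `∨ ψ) = subst σ φ `∨ subst σ ψ
subst σ (φ ⇒ ψ)  = subst σ φ ⇒ subst σ ψ

data _occursIn_ {V : Set} (v : V) : Form V → Set where
  here : v occursIn var v
  ∧ˡ   : ∀ {φ ψ} → v occursIn φ → v occursIn (φ `∧ ψ)
  ∧ʳ   : ∀ {φ ψ} → v occursIn ψ → v occursIn (φ `∧ ψ)
  ∨ˡ   : ∀ {φ ψ} → v occursIn φ → v occursIn (φ `∨ ψ)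
  ∨ʳ   : ∀ {φ ψ} → v occursIn ψ → v occursIn (φ `∨ ψ)
  ⇒ˡ   : ∀ {φ ψ} → v occursIn φ → v occursIn (φ ⇒ ψ)
  ⇒ʳ   : ∀ {φ ψ} → v occursIn ψ → v occursIn (φ ⇒ ψ)

literalForm : {V : Set} → Literal V → Form V
literalForm (pos v) = var v
literalForm (neg v) = `¬ var v

clauseForms : {V : Set} → CNF V → List (Form V)
clauseForms = map (⋁ ∘ map literalForm)

------------------------------------------------------------------------
-- Frege and extended Frege proofs

data Axiom {V : Set} : Form V → Set where
  ax-K   : ∀ φ ψ → Axiom (φ ⇒ ψ ⇒ φ)
  ax-S   : ∀ φ ψ χ → Axiom ((φ ⇒ ψ ⇒ χ) ⇒ (φ ⇒ ψ) ⇒ φ ⇒ χ)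
  ax-∧ᵢ  : ∀ φ ψ → Axiom (φ ⇒ ψ ⇒ φ `∧ ψ)
  ax-∧ₑ₁ : ∀ φ ψ → Axiom (φ `∧ ψ ⇒ φ)
  ax-∧ₑ₂ : ∀ φ ψ → Axiom (φ `∧ ψ ⇒ ψ)
  ax-∨ᵢ₁ : ∀ φ ψ → Axiom (φ ⇒ φ `∨ ψ)
  ax-∨ᵢ₂ : ∀ φ ψ → Axiom (ψ ⇒ φ `∨ ψ)
  ax-∨ₑ  : ∀ φ ψ χ → Axiom ((φ ⇒ χ) ⇒ (ψ ⇒ χ) ⇒ φ `∨ ψ ⇒ χ)
  ax-⊥ₑ  : ∀ φ → Axiom (`⊥ ⇒ φ)
  ax-¬¬ₑ : ∀ φ → Axiom (`¬ `¬ φ ⇒ φ)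

-- Whether a line may follow the lines π, given the hypotheses Γ.
data FregeLine {V : Set} (Γ π : List (Form V)) : Form V → Set where
  hyp : ∀ {φ} → φ ∈ Γ → FregeLine Γ π φ
  ax  : ∀ {φ} → Axiom φ → FregeLine Γ π φ
  mp  : ∀ {φ ψ} → (φ ⇒ ψ) ∈ π → φ ∈ π → FregeLine Γ π ψ

-- Proofs are sequences of lines, here with the most recent line first.
data Frege {V : Set} (Γ : List (Form V)) : List (Form V) → Set where
  []   : Frege Γ []
  _▷_  : ∀ {π φ} → Frege Γ π → FregeLine Γ π φ → Frege Γ (φ ∷ π)

-- The size of a proof is its number of lines.
infix 3 _⊢_size_

_⊢_size_ : {V : Set} → List (Form V) → List (Form V) → ℕ → Set
Γ ⊢ Δ size s = ∃[ π ] Frege Γ π × All (_∈ π) Δ × length π ≡ s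

-- The extension variables are the inj₂ q.  Hypotheses contain only the
-- original variables inj₁ v, so a new variable needs to be fresh only for
-- the preceding lines and for the formula it abbreviates.
data ExtFrege {V : Set} (Γ : List (Form V)) : List (Form (V ⊎ ℕ)) → Set where
  []     : ExtFrege Γ []
  _▷_    : ∀ {π φ} → ExtFrege Γ π →
           FregeLine (map (subst (var ∘ inj₁)) Γ) π φ → ExtFrege Γ (φ ∷ π)
  extend : ∀ {π} → ExtFrege Γ π → (q : ℕ) (θ : Form (V ⊎ ℕ)) →
           All (λ φ → ¬ (inj₂ q occursIn φ)) π → ¬ (inj₂ q occursIn θ) →
           ExtFrege Γ (((var (inj₂ q) ⇒ θ) `∧ (θ ⇒ var (inj₂ q))) ∷ π)

ExtFregeRefutation : {V : Set} → CNF V → ℕ → Set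
ExtFregeRefutation φ s =
  ∃[ π ] ExtFrege (clauseForms φ) π × `⊥ ∈ π × length π ≡ s

-- Witnessing Γ ⊢ ψ: the variables W of ψ are replaced by formulas in the
-- variables V of Γ, and the clauses of ψ so obtained are derived from Γ.
Witnesses : {V W : Set} → List (Form V) → CNF W → ℕ → Set
Witnesses {V} {W} Γ ψ s =
  Σ (W → Form V) λ σ → Γ ⊢ map (subst σ) (clauseForms ψ) size s

------------------------------------------------------------------------
-- Parameterized problems with a propositional translation

-- An element of Instance is a pair (x , k); size is |x|.
record ParamProblem : Set₁ where
  field
    Instance : Set
    size     : Instance → ℕ
    param    : Instance → ℕ
    code     : Instance → Tree
    Yes      : Instance → Set
    Var      : Instance → Set
    Φ        : (x : Instance) → CNF (Var x)

module _ (L : ParamProblem) where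
  open ParamProblem L

  PolyTime : (Instance → Instance) → Set
  PolyTime f = ∃[ prog ] ∃[ p ] ∀ x → ∃[ c ]
    (prog ⊢ code x ⇓ code (f x) # c) × c ≤ eval p (size x + param x)

  record DataReductionRule : Set where
    field
      apply       : Instance → Instance
      polyTime    : PolyTime apply
      equivalent  : ∀ x → Yes x ⇔ Yes (apply x)
      nonIncrease : ∀ x → size (apply x) ≤ size x

  open DataReductionRule

  -- An application of a rule that leaves the instance unchanged is not a step.
  Step : List DataReductionRule → Instance → Instance → Set
  Step rules y z = ∃[ r ] r ∈ rules × apply r y ≡ z × z ≢ y

  data Chain (rules : List DataReductionRule) (x : Instance) :
             ℕ → Instance → Set where
    []  : Chain rules x 0 x
    _▷_ : ∀ {ℓ y z} → Chain rules x ℓ y → Step rules y z →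
          Chain rules x (suc ℓ) z

  record Kernelization : Set where
    field
      rules       : List DataReductionRule
      kernel      : Instance → Instance
      polyTime    : PolyTime kernel
      equivalent  : ∀ x → Yes x ⇔ Yes (kernel x)
      bound       : ℕ → ℕ
      bounded     : ∀ x → size (kernel x) + param (kernel x) ≤ bound (param x)
      reached     : ∀ x → ∃[ ℓ ] Chain rules x ℓ (kernel x)
      irreducible : ∀ x z → ¬ Step rules (kernel x) z

  -- The soundness of a step y ⟶ z is witnessed with at most R cases and total
  -- size at most s.
  record StepWitness (R s : ℕ) (y z : Instance) : Set where
    field
      r         : ℕ
      r≤R       : r ≤ R
      Ξ         : Fin r → Form (Var y)
      η         : Fin r → CNF (Var z)
      η≅Φ       : ∀ t → Isomorphic (η t) (Φ z)
      s₀        : ℕ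
      tautology : [] ⊢ ⋁ (tabulate Ξ) ∷ [] size s₀
      sₜ        : Fin r → ℕ
      implies   : ∀ t → Witnesses (Ξ t ∷ clauseForms (Φ y)) (η t) (sₜ t)
      total     : s₀ + sum (tabulate sₜ) ≤ s

  -- The size |Φ(x,k)| is its number of clauses.
  PolyFregeSound : List DataReductionRule → Set
  PolyFregeSound rules = ∃[ R ] ∃[ h ] 1 ≤ R ×
    (∀ x → ¬ Yes x → ∀ {ℓ y z} → Chain rules x ℓ y → Step rules y z →
     StepWitness R (eval h (length (Φ x))) y z)

------------------------------------------------------------------------
-- d-HittingSet

-- The universe U is Fin n; the family 𝒜 is listed without repetitions.
record HSInstance (d : ℕ) : Set where
  field
    n        : ℕ
    𝒜        : List (Subset n)
    k        : ℕ
    card≤d   : All (λ A → card A ≤ d) 𝒜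
    distinct : Unique 𝒜

module _ {d : ℕ} where
  open HSInstance

  HasHittingSet : HSInstance d → Set
  HasHittingSet x =
    Σ (Subset (n x)) λ H → card H ≤ k x × All (λ A → Nonempty (H ∩ A)) (𝒜 x)

  -- The family is coded by its incidence matrix, the numbers in unary.
  codeHypergraph : HSInstance d → Tree
  codeHypergraph x =
    codeℕ (n x) ∙ codeList (λ A → codeList codeBool (toList A)) (𝒜 x)

  HSVar : HSInstance d → Set
  HSVar x = Fin (n x) × Fin (k x)

  ΦHS : (x : HSInstance d) → CNF (HSVar x)
  ΦHS x = map someElement (allFin (k x))
       ++ concatMap (λ j → map (notBoth j) distinctPairs) (allFin (k x))
       ++ map hits (𝒜 x)
    where
    someElement : Fin (k x) → Clause (HSVar x)
    someElement j = map (λ i → pos (i , j)) (allFin (n x))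

    distinctPairs : List (Fin (n x) × Fin (n x))
    distinctPairs = filter (λ p → ¬? (proj₁ p ≟ᶠ proj₂ p))
                           (cartesianProduct (allFin (n x)) (allFin (n x)))

    notBoth : Fin (k x) → Fin (n x) × Fin (n x) → Clause (HSVar x)
    notBoth j (i , i′) = neg (i , j) ∷ neg (i′ , j) ∷ []

    hits : Subset (n x) → Clause (HSVar x)
    hits A = map pos (cartesianProduct (filter (_∈? A) (allFin (n x)))
                                       (allFin (k x)))

HittingSet : ℕ → ParamProblem
HittingSet d = record
  { Instance = HSInstance d
  ; size     = λ x → treeSize (codeHypergraph x)
  ; param    = HSInstance.k
  ; code     = λ x → codeHypergraph x ∙ codeℕ (HSInstance.k x)
  ; Yes      = HasHittingSet
  ; Var      = HSVar
  ; Φ        = ΦHS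
  }

-- A family of sets of cardinality at most d is thinned greedily: a set A is dropped if
-- some core Y ⊆ A already lies in threshold k (d - |Y|) of the kept sets.  A set of
-- at most k elements disjoint from Y meets too few of these sets, since the degree of
-- each Y ∪ {v} is capped, so it must hit Y and hence A.  Taking Y = ∅ bounds the number
-- of kept sets; for d = 1 the cap k + 1 exceeds the allowed k sets, but then the
-- instance is negative.  The elements in no kept set are deleted.  The whole reduction is
-- one rule that leaves instances within the bounds alone, so chains have length at most
-- one, and no step occurs when k > n.
--
-- Dropping sets only weakens Φ, and deleted elements are merged into a remaining one;
-- only the negative case d = 1 needs the pigeonhole principle.  For fixed k the n ^ k
-- choices can be exhausted in Frege without any extension variable.

module Submission where

open import Defs
open import Data.List.Base using (length)
open import Data.Nat.Base using (ℕ; _*_; _^_; _≤_; _!)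
open import Data.Product.Base using (Σ; ∃-syntax; _×_)
open import Relation.Binary.PropositionalEquality.Core using (_≡_)
open HSInstance using (n; 𝒜; k)
open Kernelization using (kernel; rules)

open import Data.Bool.Base using (Bool; true; false; if_then_else_; not; _∧_; _∨_)
open import Data.Bool.Properties using (∨-assoc; ∨-comm; ∨-identityʳ)
open import Data.Empty using (⊥-elim)
open import Data.Fin.Base using (Fin; zero; suc; inject≤; cast)
import Data.Fin.Properties as Fin
open import Data.Fin.Subset using (Subset; _∩_; _∪_; ⁅_⁆; Nonempty; ∁)
  renaming (∣_∣ to card; _∈_ to _∈ˢ_; _∉_ to _∉ˢ_; ⊥ to ∅)
open import Data.Fin.Subset.Properties
  using (_∈?_; x∈p∩q⁺; x∈p∩q⁻; x∈p∪q⁻; x∈⁅y⁆⇒x≡y; ∪-identityʳ; nonempty?; ∉⊥; ∣⊥∣≡0; ∣p∣≤n; x∉p⇒x∈∁p;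
         x∈∁p⇒x∉p; ∣⁅x⁆∣≡1)
open import Data.List.Base
  using (List; []; _∷_; _++_; map; foldl; filterᵇ; replicate; reverse; _ʳ++_; allFin; tabulate;
         cartesianProduct; filter; concatMap; lookup)
open import Data.List.Membership.Propositional using (_∈_; lose; find)
open import Data.List.Membership.Propositional.Properties
  using (∈-map⁺; ∈-map⁻; ∈-++⁺ˡ; ∈-++⁺ʳ; ∈-++⁻; ∈-filter⁺; ∈-filter⁻; ∈-allFin; ∈-tabulate⁺;
         ∈-tabulate⁻; ∈-cartesianProduct⁺; ∈-cartesianProduct⁻; ∈-concatMap⁺; ∈-concatMap⁻; ∈-lookup;
         ∉[])
open import Data.List.Properties
  using (reverse-involutive; length-map; map-∘; map-cong; length-++; length-tabulate; length-filter;
         map-id; filter-all; filter-++)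
open import Data.List.Relation.Unary.All as All using (All; []; _∷_)
import Data.List.Relation.Unary.All.Properties as All
open import Data.List.Relation.Unary.AllPairs using ([]; _∷_)
open import Data.List.Relation.Unary.Any as Any using (Any; here; there)
open import Data.List.Relation.Unary.Unique.Propositional using (Unique)
open import Data.Maybe.Base using (Maybe; just; nothing)
open import Data.Nat.Base using (zero; suc; pred; _+_; _∸_; z≤n; s≤s; _⊔_; _<_)
open import Data.Nat.Properties
open import Data.Nat.Tactic.RingSolver using (solve-∀)
open import Data.Product.Base using (_,_; proj₁; proj₂)
open import Data.Sum.Base using (_⊎_; inj₁; inj₂; [_,_])
open import Data.Unit.Base using (⊤; tt)
open import Data.Vec.Base using ([]; _∷_; toList; head; tail; here; there)
open import Function.Base using (_∘_; id)
open import Function.Bundles using (_⇔_; mk⇔; Equivalence)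
open import Function.Construct.Identity using (↔-id)
open import Relation.Binary.PropositionalEquality using (refl; sym; trans; cong; cong₂; _≢_)
  renaming (subst to transport)
open import Relation.Nullary using (¬_; yes; no; Dec; does)
open import Relation.Nullary.Decidable using (¬?; dec-true; dec-false; decidable-stable)
open HSInstance using (card≤d; distinct)

-- Polynomial expressions

-- Unfolding `threshold` gives 1 + k + ... + k^d. A solvable instance stays at least one set below
-- this cap, with at most k + ... + k^d ≤ d · k^d kept sets, which fits into `capacity`; a family
-- above `capacity` is therefore negative. A step forces k ≤ n: if n < k, there are at most (n +
-- 1)^d ≤ k^d distinct sets of size at most d, and the instance already lies within the bounds. So a
-- chain of length ℓ ≤ 1 satisfies ℓ · k ≤ n ≤ n^d. Proof sizes must be polynomial in the number of
-- clauses of Φ. This number dominates n only for k ≥ 1, which is why k = 0 is split off wherever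
-- sizes are compared with it; in a negative instance with k = 0 some set yields an empty clause, so
-- the formula `⊥` is itself a hypothesis. The deduction theorem multiplies the number of lines by
-- 5. Discharged hypotheses may therefore be nested only to a constant depth, or to a depth governed
-- by k where k is fixed.

infixl 6 _:+_
infixl 7 _:*_
infixr 8 _:∘_

-- All coefficients are natural numbers, so every expression is monotone, and composition is a
-- constructor. Coefficient lists appear only where `eval` is demanded.
data PolyExpr : Set where
  K              : ℕ → PolyExpr
  X              : PolyExpr
  _:+_ _:*_ _:∘_ : PolyExpr → PolyExpr → PolyExpr

⟦_⟧ : PolyExpr → ℕ → ℕ
⟦ K c ⟧    m = c
⟦ X ⟧      m = m
⟦ p :+ q ⟧ m = ⟦ p ⟧ m + ⟦ q ⟧ m
⟦ p :* q ⟧ m = ⟦ p ⟧ m * ⟦ q ⟧ m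
⟦ p :∘ q ⟧ m = ⟦ p ⟧ (⟦ q ⟧ m)

⟦⟧-mono : ∀ p {m n} → m ≤ n → ⟦ p ⟧ m ≤ ⟦ p ⟧ n
⟦⟧-mono (K c)    m≤n = ≤-refl
⟦⟧-mono X        m≤n = m≤n
⟦⟧-mono (p :+ q) m≤n = +-mono-≤ (⟦⟧-mono p m≤n) (⟦⟧-mono q m≤n)
⟦⟧-mono (p :* q) m≤n = *-mono-≤ (⟦⟧-mono p m≤n) (⟦⟧-mono q m≤n)
⟦⟧-mono (p :∘ q) m≤n = ⟦⟧-mono p (⟦⟧-mono q m≤n)

addPoly : Poly → Poly → Poly
addPoly []      q       = q
addPoly (c ∷ p) []      = c ∷ p
addPoly (c ∷ p) (e ∷ q) = c + e ∷ addPoly p q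

scalePoly : ℕ → Poly → Poly
scalePoly c = map (c *_)

mulPoly : Poly → Poly → Poly
mulPoly []      q = []
mulPoly (c ∷ p) q = addPoly (scalePoly c q) (0 ∷ mulPoly p q)

composePoly : Poly → Poly → Poly
composePoly []      q = []
composePoly (c ∷ p) q = addPoly (c ∷ []) (mulPoly q (composePoly p q))

eval-add : ∀ p q m → eval (addPoly p q) m ≡ eval p m + eval q m
eval-add []      q       m = refl
eval-add (c ∷ p) []      m = sym (+-identityʳ _)
eval-add (c ∷ p) (e ∷ q) m =
  trans (cong (λ z → c + e + m * z) (eval-add p q m)) (lemma c e m (eval p m) (eval q m))
  where
  lemma : ∀ c e m x y → c + e + m * (x + y) ≡ c + m * x + (e + m * y)
  lemma = solve-∀

eval-scale : ∀ c p m → eval (scalePoly c p) m ≡ c * eval p m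
eval-scale c []      m = sym (*-zeroʳ c)
eval-scale c (e ∷ p) m =
  trans (cong (λ z → c * e + m * z) (eval-scale c p m)) (lemma c e m (eval p m))
  where
  lemma : ∀ c e m x → c * e + m * (c * x) ≡ c * (e + m * x)
  lemma = solve-∀

eval-mul : ∀ p q m → eval (mulPoly p q) m ≡ eval p m * eval q m
eval-mul []      q m = refl
eval-mul (c ∷ p) q m =
  trans (eval-add (scalePoly c q) (0 ∷ mulPoly p q) m)
  (trans (cong₂ (λ y z → y + m * z) (eval-scale c q m) (eval-mul p q m))
         (lemma c m (eval p m) (eval q m)))
  where
  lemma : ∀ c m x y → c * y + m * (x * y) ≡ (c + m * x) * y
  lemma = solve-∀

eval-compose : ∀ p q m → eval (composePoly p q) m ≡ eval p (eval q m)
eval-compose []      q m = refl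
eval-compose (c ∷ p) q m =
  trans (eval-add (c ∷ []) (mulPoly q (composePoly p q)) m)
  (cong₂ _+_ (trans (cong (c +_) (*-zeroʳ m)) (+-identityʳ c))
             (trans (eval-mul q (composePoly p q) m)
                    (cong (eval q m *_) (eval-compose p q m))))

toPoly : PolyExpr → Poly
toPoly (K c)    = c ∷ []
toPoly X        = 0 ∷ 1 ∷ []
toPoly (p :+ q) = addPoly (toPoly p) (toPoly q)
toPoly (p :* q) = mulPoly (toPoly p) (toPoly q)
toPoly (p :∘ q) = composePoly (toPoly p) (toPoly q)

eval-toPoly : ∀ p m → eval (toPoly p) m ≡ ⟦ p ⟧ m
eval-toPoly (K c)    m = trans (cong (c +_) (*-zeroʳ m)) (+-identityʳ c)
eval-toPoly X        m = lemma m
  where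
  lemma : ∀ m → m * (1 + m * 0) ≡ m
  lemma = solve-∀
eval-toPoly (p :+ q) m = trans (eval-add (toPoly p) (toPoly q) m)
                               (cong₂ _+_ (eval-toPoly p m) (eval-toPoly q m))
eval-toPoly (p :* q) m = trans (eval-mul (toPoly p) (toPoly q) m)
                               (cong₂ _*_ (eval-toPoly p m) (eval-toPoly q m))
eval-toPoly (p :∘ q) m = trans (eval-compose (toPoly p) (toPoly q) m)
                               (trans (cong (eval (toPoly p)) (eval-toPoly q m)) (eval-toPoly p (⟦ q ⟧ m)))

-- Polynomial-time functions on coded data

infixr 2 _×ᵗ_

data Ty : Set where
  unitᵗ natᵗ boolᵗ : Ty
  listᵗ            : Ty → Ty
  _×ᵗ_             : Ty → Ty → Ty

El : Ty → Set
El unitᵗ     = ⊤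
El natᵗ      = ℕ
El boolᵗ     = Bool
El (listᵗ a) = List (El a)
El (a ×ᵗ b)  = El a × El b

codeᵗ : (a : Ty) → El a → Tree
codeᵗ unitᵗ     _       = nil
codeᵗ natᵗ      m       = codeℕ m
codeᵗ boolᵗ     b       = codeBool b
codeᵗ (listᵗ a) xs      = codeList (codeᵗ a) xs
codeᵗ (a ×ᵗ b)  (x , y) = codeᵗ a x ∙ codeᵗ b y

sizeᵗ : (a : Ty) → El a → ℕ
sizeᵗ a x = treeSize (codeᵗ a x)

-- Running time does not bound the output: `cons skip skip` doubles a tree at constant cost.
-- Composition needs the size of the intermediate value, so one polynomial bounds both time and
-- output size.
record PT (a b : Ty) (f : El a → El b) : Set where
  constructor mkPT
  field
    prog  : Program
    timeBound : PolyExpr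
    runs  : ∀ x → ∃[ c ] (prog ⊢ codeᵗ a x ⇓ codeᵗ b (f x) # c) × c ≤ ⟦ timeBound ⟧ (sizeᵗ a x)
    sizeBound : ∀ x → sizeᵗ b (f x) ≤ ⟦ timeBound ⟧ (sizeᵗ a x)

open PT

PT-ext : ∀ {a b f g} → (∀ x → f x ≡ g x) → PT a b f → PT a b g
PT-ext {a} {b} f≗g (mkPT p q r s) = mkPT p q
  (λ x → transport (λ y → ∃[ c ] (p ⊢ codeᵗ a x ⇓ codeᵗ b y # c) × c ≤ ⟦ q ⟧ (sizeᵗ a x)) (f≗g x) (r x))
  (λ x → transport (λ y → sizeᵗ b y ≤ ⟦ q ⟧ (sizeᵗ a x)) (f≗g x) (s x))

infixr 9 _∘ᴾ_

_∘ᴾ_ : ∀ {a b c f g} → PT b c g → PT a b f → PT a c (g ∘ f)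
_∘ᴾ_ {a} {b} {c} {f} {g} (mkPT p′ q′ r′ s′) (mkPT p q r s) = mkPT (p ⨾ p′) (K 1 :+ (q :+ q′ :∘ q))
  (λ x → let (m , run , m≤) = r x ; (m′ , run′ , m′≤) = r′ (f x) in
     suc (m + m′) , ⨾⇓ run run′ , s≤s (+-mono-≤ m≤ (≤-trans m′≤ (⟦⟧-mono q′ (s x)))))
  (λ x → ≤-trans (s′ (f x)) (≤-trans (⟦⟧-mono q′ (s x)) (m≤n⇒m≤1+n (m≤n+m _ _))))

⟨_,_⟩ᴾ : ∀ {a b c f g} → PT a b f → PT a c g → PT a (b ×ᵗ c) (λ x → f x , g x)
⟨ mkPT p q r s , mkPT p′ q′ r′ s′ ⟩ᴾ = mkPT (cons p p′) (K 1 :+ (q :+ q′))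
  (λ x → let (m , run , m≤) = r x ; (m′ , run′ , m′≤) = r′ x in
     suc (m + m′) , cons⇓ run run′ , s≤s (+-mono-≤ m≤ m′≤))
  (λ x → s≤s (+-mono-≤ (s x) (s′ x)))

ifᴾ : ∀ {a b h f g} → PT a boolᵗ h → PT a b f → PT a b g → PT a b (λ x → if h x then f x else g x)
ifᴾ {a} {b} {h} {f} {g} (mkPT p q r s) (mkPT p₁ q₁ r₁ s₁) (mkPT p₂ q₂ r₂ s₂) =
  mkPT (if p p₁ p₂) total run fits
  where
  total : PolyExpr
  total = K 1 :+ (q :+ (q₁ :+ q₂))
  choice : El a → El b
  choice x = if h x then f x else g x
  run : ∀ x → ∃[ c ] (if p p₁ p₂ ⊢ codeᵗ a x ⇓ codeᵗ b (choice x) # c) × c ≤ ⟦ total ⟧ (sizeᵗ a x)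
  run x with h x | r x
  ... | true  | m , go , m≤ = let (m′ , go′ , m′≤) = r₁ x in
    suc (m + m′) , if-true go go′ , s≤s (+-mono-≤ m≤ (≤-trans m′≤ (m≤m+n _ _)))
  ... | false | m , go , m≤ = let (m′ , go′ , m′≤) = r₂ x in
    suc (m + m′) , if-false go go′ , s≤s (+-mono-≤ m≤ (≤-trans m′≤ (m≤n+m _ (⟦ q₁ ⟧ (sizeᵗ a x)))))
  fits : ∀ x → sizeᵗ b (choice x) ≤ ⟦ total ⟧ (sizeᵗ a x)
  fits x with h x
  ... | true  = m≤n⇒m≤1+n (≤-trans (s₁ x) (≤-trans (m≤m+n _ _) (m≤n+m _ (⟦ q ⟧ (sizeᵗ a x)))))
  ... | false = m≤n⇒m≤1+n (≤-trans (s₂ x) (≤-trans (m≤n+m _ (⟦ q₁ ⟧ (sizeᵗ a x))) (m≤n+m _ (⟦ q ⟧ (sizeᵗ a x)))))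

idᴾ : ∀ {a} → PT a a (λ x → x)
idᴾ = mkPT skip (K 1 :+ X) (λ x → 1 , skip⇓ , s≤s z≤n) (λ x → n≤1+n _)

-- Pairs share their trees with nonempty lists and, when the first component is `nil`, with
-- successors; such conversions are just `skip`.
castᴾ : ∀ {a b} (f : El a → El b) → (∀ x → codeᵗ b (f x) ≡ codeᵗ a x) → PT a b f
castᴾ {a} {b} f same = mkPT skip (K 1 :+ X)
  (λ x → 1 , transport (skip ⊢ codeᵗ a x ⇓_# 1) (sym (same x)) skip⇓ , s≤s z≤n)
  (λ x → ≤-trans (≤-reflexive (cong treeSize (same x))) (n≤1+n _))

leafᴾ : ∀ {a b} (y : El b) → codeᵗ b y ≡ nil → PT a b (λ _ → y)
leafᴾ {a} {b} y isNil = mkPT leaf (K 1)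
  (λ x → 1 , transport (leaf ⊢ codeᵗ a x ⇓_# 1) (sym isNil) leaf⇓ , s≤s z≤n)
  (λ x → ≤-reflexive (cong treeSize isNil))

fstᴾ : ∀ {a b} → PT (a ×ᵗ b) a proj₁
fstᴾ = mkPT left (K 1 :+ X) (λ x → 1 , left-∙ , s≤s z≤n)
  (λ x → m≤n⇒m≤1+n (m≤n⇒m≤1+n (m≤m+n _ _)))

sndᴾ : ∀ {a b} → PT (a ×ᵗ b) b proj₂
sndᴾ {a} {b} = mkPT right (K 1 :+ X) (λ x → 1 , right-∙ , s≤s z≤n)
  (λ x → m≤n⇒m≤1+n (m≤n⇒m≤1+n (m≤n+m _ (sizeᵗ a (proj₁ x)))))

1≤treeSize : ∀ t → 1 ≤ treeSize t
1≤treeSize nil     = ≤-refl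
1≤treeSize (s ∙ t) = s≤s z≤n

tailL : {A : Set} → List A → List A
tailL []       = []
tailL (x ∷ xs) = xs

headB : List Bool → Bool
headB []       = false
headB (b ∷ bs) = b

tailᴾ : ∀ {a} → PT (listᵗ a) (listᵗ a) tailL
tailᴾ {a} = mkPT right (K 1 :+ X) run fits
  where
  run : ∀ x → _
  run []       = 1 , right-nil , s≤s z≤n
  run (x ∷ xs) = 1 , right-∙ , s≤s z≤n
  fits : ∀ x → _
  fits []       = s≤s z≤n
  fits (x ∷ xs) = m≤n⇒m≤1+n (m≤n⇒m≤1+n (m≤n+m _ (sizeᵗ a x)))

predᴾ : PT natᵗ natᵗ pred
predᴾ = mkPT right (K 1 :+ X) run fits
  where
  run : ∀ x → _
  run zero    = 1 , right-nil , s≤s z≤n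
  run (suc m) = 1 , right-∙ , s≤s z≤n
  fits : ∀ x → _
  fits zero    = s≤s z≤n
  fits (suc m) = m≤n⇒m≤1+n (m≤n⇒m≤1+n (m≤n+m _ 1))

headᴾ : PT (listᵗ boolᵗ) boolᵗ headB
headᴾ = mkPT left (K 1 :+ X) run fits
  where
  run : ∀ x → _
  run []       = 1 , left-nil , s≤s z≤n
  run (x ∷ xs) = 1 , left-∙ , s≤s z≤n
  fits : ∀ x → _
  fits []       = s≤s z≤n
  fits (x ∷ xs) = m≤n⇒m≤1+n (m≤n⇒m≤1+n (m≤m+n _ _))

falseᴾ : ∀ {a} → PT a boolᵗ (λ _ → false)
falseᴾ = leafᴾ false refl

nilᴾ : ∀ {a b} → PT a (listᵗ b) (λ _ → [])
nilᴾ = leafᴾ [] refl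

zeroᴾ : ∀ {a} → PT a natᵗ (λ _ → 0)
zeroᴾ = leafᴾ 0 refl

consᴾ : ∀ {a b f g} → PT a b f → PT a (listᵗ b) g → PT a (listᵗ b) (λ x → f x ∷ g x)
consᴾ p q = castᴾ (λ (x , xs) → x ∷ xs) (λ _ → refl) ∘ᴾ ⟨ p , q ⟩ᴾ

sucᴾ : ∀ {a f} → PT a natᵗ f → PT a natᵗ (λ x → suc (f x))
sucᴾ p = castᴾ {unitᵗ ×ᵗ natᵗ} (λ (_ , m) → suc m) (λ _ → refl) ∘ᴾ ⟨ leafᴾ tt refl , p ⟩ᴾ

trueᴾ : ∀ {a} → PT a boolᵗ (λ _ → true)
trueᴾ = castᴾ {unitᵗ ×ᵗ unitᵗ} (λ _ → true) (λ _ → refl) ∘ᴾ ⟨ leafᴾ tt refl , leafᴾ tt refl ⟩ᴾ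

constℕᴾ : ∀ {a} m → PT a natᵗ (λ _ → m)
constℕᴾ zero    = zeroᴾ
constℕᴾ (suc m) = sucᴾ (constℕᴾ m)

∨ᴾ : ∀ {a f g} → PT a boolᵗ f → PT a boolᵗ g → PT a boolᵗ (λ x → f x ∨ g x)
∨ᴾ {f = f} {g} p q = PT-ext eq (ifᴾ p trueᴾ q)
  where
  eq : ∀ x → (if f x then true else g x) ≡ f x ∨ g x
  eq x with f x
  ... | true  = refl
  ... | false = refl

∧ᴾ : ∀ {a f g} → PT a boolᵗ f → PT a boolᵗ g → PT a boolᵗ (λ x → f x ∧ g x)
∧ᴾ {f = f} {g} p q = PT-ext eq (ifᴾ p q falseᴾ)
  where
  eq : ∀ x → (if f x then g x else false) ≡ f x ∧ g x
  eq x with f x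
  ... | true  = refl
  ... | false = refl

length≤sizeᵗ : ∀ a (xs : List (El a)) → length xs ≤ sizeᵗ (listᵗ a) xs
length≤sizeᵗ a []       = z≤n
length≤sizeᵗ a (x ∷ xs) = s≤s (≤-trans (length≤sizeᵗ a xs) (m≤n+m _ (sizeᵗ a x)))

-- Growth must be additive and independent of the state: a step that merely doubled its state would
-- be polynomial, but its iteration exponential.
module Fold {e s a : Ty} {step : El e × El s × El a → El s} (stepᴾ : PT (e ×ᵗ s ×ᵗ a) s step)
            (r : PolyExpr)
            (growth : ∀ env st x → sizeᵗ s (step (env , st , x)) ≤ sizeᵗ s st + ⟦ r ⟧ (sizeᵗ e env + sizeᵗ a x))
            where

  fold : El e → El s → List (El a) → El s
  fold env = foldl (λ st x → step (env , st , x))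

  -- The loop acts on `env ∙ (st ∙ xs)` until `xs` is `nil`; `rearrange` prepares the argument
  -- `env ∙ (st ∙ x)` of the step.
  rearrange body loop : Program
  rearrange = cons left (cons (right ⨾ left) (right ⨾ right ⨾ left))
  body = cons left (cons (rearrange ⨾ prog stepᴾ) (right ⨾ right ⨾ right))
  loop = while (right ⨾ right) body

  states : PolyExpr
  states = X :+ X :* r

  -- 24 counts the operations of one round outside the step: the test, the rearrangement and the
  -- rebuilding of the triple.
  iteration : PolyExpr
  iteration = K 24 :+ timeBound stepᴾ :∘ (K 2 :+ (X :+ states))

  -- 8 pays for the last test and for extracting the state; the final summand makes the bound cover
  -- the output size as well.
  cost : PolyExpr
  cost = K 8 :+ X :* iteration :+ states

  -- `N` and `M` stay fixed during the loop. The invariant is a potential: the current state plus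
  -- the growth still granted to the remaining elements is at most `M`.
  module _ (N M : ℕ) (env : El e) where

    D : ℕ
    D = 24 + ⟦ timeBound stepᴾ ⟧ (2 + (N + M))

    fold-size : ∀ st xs → sizeᵗ e env + sizeᵗ (listᵗ a) xs ≤ N →
                sizeᵗ s st + length xs * ⟦ r ⟧ N ≤ M → sizeᵗ s (fold env st xs) ≤ M
    step-size : ∀ st x xs → sizeᵗ e env + sizeᵗ (listᵗ a) (x ∷ xs) ≤ N →
                sizeᵗ s st + length (x ∷ xs) * ⟦ r ⟧ N ≤ M →
                sizeᵗ s (step (env , st , x)) + length xs * ⟦ r ⟧ N ≤ M
    env+x : ∀ x xs → sizeᵗ e env + sizeᵗ (listᵗ a) (x ∷ xs) ≤ N → sizeᵗ e env + sizeᵗ a x ≤ N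
    env+xs : ∀ x xs → sizeᵗ e env + sizeᵗ (listᵗ a) (x ∷ xs) ≤ N → sizeᵗ e env + sizeᵗ (listᵗ a) xs ≤ N

    env+x x xs h = ≤-trans (+-monoʳ-≤ (sizeᵗ e env) (m≤n⇒m≤1+n (m≤m+n _ _))) h
    env+xs x xs h = ≤-trans (+-monoʳ-≤ (sizeᵗ e env) (m≤n⇒m≤1+n (m≤n+m _ (sizeᵗ a x)))) h

    step-size st x xs h h′ = begin
      sizeᵗ s (step (env , st , x)) + L * R
        ≤⟨ +-monoˡ-≤ (L * R) (growth env st x) ⟩
      sizeᵗ s st + ⟦ r ⟧ (sizeᵗ e env + sizeᵗ a x) + L * R
        ≤⟨ +-monoˡ-≤ (L * R) (+-monoʳ-≤ (sizeᵗ s st) (⟦⟧-mono r (env+x x xs h))) ⟩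
      sizeᵗ s st + R + L * R
        ≡⟨ +-assoc (sizeᵗ s st) R (L * R) ⟩
      sizeᵗ s st + (R + L * R)
        ≤⟨ h′ ⟩
      M ∎
      where
      open ≤-Reasoning
      L = length xs
      R = ⟦ r ⟧ N

    fold-size st []       h h′ = ≤-trans (m≤m+n _ _) h′
    fold-size st (x ∷ xs) h h′ =
      fold-size (step (env , st , x)) xs (env+xs x xs h) (step-size st x xs h h′)

    loop-runs : ∀ st xs → sizeᵗ e env + sizeᵗ (listᵗ a) xs ≤ N →
                sizeᵗ s st + length xs * ⟦ r ⟧ N ≤ M →
                ∃[ c ] (loop ⊢ codeᵗ (e ×ᵗ s ×ᵗ listᵗ a) (env , st , xs)
                          ⇓ codeᵗ (e ×ᵗ s ×ᵗ listᵗ a) (env , fold env st xs , []) # c)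
                       × c ≤ 4 + length xs * D
    loop-runs st []       h h′ = 4 , while-end (⨾⇓ right-∙ right-∙) , ≤-refl
    loop-runs st (x ∷ xs) h h′ =
      let (q , run , q≤) = runs stepᴾ (env , st , x)
          (c , rest , c≤) = loop-runs (step (env , st , x)) xs (env+xs x xs h) (step-size st x xs h h′)
      in _ , while-go (⨾⇓ right-∙ right-∙)
                      (cons⇓ left-∙ (cons⇓ (⨾⇓ (cons⇓ left-∙ (cons⇓ (⨾⇓ right-∙ left-∙)
                                                                    (⨾⇓ right-∙ (⨾⇓ right-∙ left-∙)))) run)
                                           (⨾⇓ right-∙ (⨾⇓ right-∙ right-∙))))
                      rest ,
         (begin
            suc (3 + suc (1 + suc (suc (11 + q) + 5)) + c)
              ≡⟨ lemma q c ⟩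
            24 + q + c
              ≤⟨ +-mono-≤ (+-monoʳ-≤ 24 (≤-trans q≤ (⟦⟧-mono (timeBound stepᴾ) input))) c≤ ⟩
            D + (4 + length xs * D)
              ≡⟨ lemma′ D (length xs * D) ⟩
            4 + (D + length xs * D) ∎)
      where
      open ≤-Reasoning
      lemma : ∀ q c → 1 + (3 + suc (1 + suc (suc (11 + q) + 5)) + c) ≡ 24 + q + c
      lemma = solve-∀
      lemma′ : ∀ d l → d + (4 + l) ≡ 4 + (d + l)
      lemma′ = solve-∀
      shuffle : ∀ p q r → 1 + (p + suc (q + r)) ≡ 2 + ((p + r) + q)
      shuffle = solve-∀
      input : sizeᵗ (e ×ᵗ s ×ᵗ a) (env , st , x) ≤ 2 + (N + M)
      input = begin
        sizeᵗ (e ×ᵗ s ×ᵗ a) (env , st , x)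
          ≡⟨ shuffle (sizeᵗ e env) (sizeᵗ s st) (sizeᵗ a x) ⟩
        2 + ((sizeᵗ e env + sizeᵗ a x) + sizeᵗ s st)
          ≤⟨ +-monoʳ-≤ 2 (+-mono-≤ (env+x x xs h) (≤-trans (m≤m+n _ _) h′)) ⟩
        2 + (N + M) ∎

  private
    size-parts : ∀ p q r → p + r ≤ suc (p + suc (q + r))
    size-parts p q r = ≤-trans (m≤n+m (p + r) (2 + q)) (≤-reflexive (lemma p q r))
      where
      lemma : ∀ p q r → 2 + q + (p + r) ≡ suc (p + suc (q + r))
      lemma = solve-∀

    N₀ : El e × El s × List (El a) → ℕ
    N₀ = sizeᵗ (e ×ᵗ s ×ᵗ listᵗ a)

    initial-env : ∀ env st xs → sizeᵗ e env + sizeᵗ (listᵗ a) xs ≤ N₀ (env , st , xs)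
    initial-env env st xs = size-parts (sizeᵗ e env) (sizeᵗ s st) _

    length≤N₀ : ∀ env st xs → length xs ≤ N₀ (env , st , xs)
    length≤N₀ env st xs = ≤-trans (length≤sizeᵗ a xs) (≤-trans (m≤n+m _ (sizeᵗ e env)) (initial-env env st xs))

    initial-state : ∀ env st xs → sizeᵗ s st + length xs * ⟦ r ⟧ (N₀ (env , st , xs)) ≤ ⟦ states ⟧ (N₀ (env , st , xs))
    initial-state env st xs = +-mono-≤
      (m≤n⇒m≤1+n (≤-trans (m≤n⇒m≤1+n (m≤m+n (sizeᵗ s st) _)) (m≤n+m _ (sizeᵗ e env))))
      (*-monoˡ-≤ (⟦ r ⟧ (N₀ (env , st , xs))) (length≤N₀ env st xs))

  foldᴾ : PT (e ×ᵗ s ×ᵗ listᵗ a) s (λ (env , st , xs) → fold env st xs)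
  foldᴾ = mkPT (loop ⨾ right ⨾ left) cost run fits
    where
    open ≤-Reasoning
    run : ∀ x → _
    run (env , st , xs) =
      let (c , go , c≤) = loop-runs N (⟦ states ⟧ N) env st xs (initial-env env st xs) (initial-state env st xs)
      in suc (c + 3) , ⨾⇓ go (⨾⇓ right-∙ left-∙) ,
         (begin
           suc (c + 3)           ≡⟨ lemma c ⟩
           4 + c                 ≤⟨ +-monoʳ-≤ 4 c≤ ⟩
           8 + length xs * D N (⟦ states ⟧ N) env
                                 ≤⟨ +-monoʳ-≤ 8 (*-monoˡ-≤ (D N (⟦ states ⟧ N) env) (length≤N₀ env st xs)) ⟩
           8 + N * D N (⟦ states ⟧ N) env
                                 ≤⟨ m≤m+n _ _ ⟩
           ⟦ cost ⟧ N            ∎)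
      where
      N = N₀ (env , st , xs)
      lemma : ∀ c → 1 + (c + 3) ≡ 4 + c
      lemma = solve-∀
    fits : ∀ x → _
    fits (env , st , xs) = ≤-trans
      (fold-size (N₀ (env , st , xs)) _ env st xs (initial-env env st xs) (initial-state env st xs))
      (m≤n+m _ (8 + N₀ (env , st , xs) * ⟦ iteration ⟧ (N₀ (env , st , xs))))


codeℕ-replicate : ∀ m → codeᵗ (listᵗ unitᵗ) (replicate m tt) ≡ codeℕ m
codeℕ-replicate zero    = refl
codeℕ-replicate (suc m) = cong (nil ∙_) (codeℕ-replicate m)

-- Unary numbers and lists of units have equal codes, so a number can serve as a loop counter.
unaryᴾ : PT natᵗ (listᵗ unitᵗ) (λ m → replicate m tt)
unaryᴾ = castᴾ _ codeℕ-replicate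

isZero : ℕ → Bool
isZero zero    = true
isZero (suc m) = false

isZeroᴾ : PT natᵗ boolᵗ isZero
isZeroᴾ = mkPT (if skip leaf (cons leaf leaf)) (K 6) run fits
  where
  run : ∀ m → ∃[ c ] (if skip leaf (cons leaf leaf) ⊢ codeℕ m ⇓ codeBool (isZero m) # c) × c ≤ 6
  run zero    = 5 , if-false skip⇓ (cons⇓ leaf⇓ leaf⇓) , n≤1+n _
  run (suc m) = 3 , if-true skip⇓ leaf⇓ , s≤s (s≤s (s≤s z≤n))
  fits : ∀ m → treeSize (codeBool (isZero m)) ≤ 6
  fits zero    = s≤s (s≤s (s≤s z≤n))
  fits (suc m) = s≤s z≤n

-- List functions by iteration

revMap-foldl : {A B : Set} (f : A → B) (ys : List B) (xs : List A) →
               foldl (λ acc x → f x ∷ acc) ys xs ≡ map f xs ʳ++ ys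
revMap-foldl f ys []       = refl
revMap-foldl f ys (x ∷ xs) = revMap-foldl f (f x ∷ ys) xs

reverseᴾ : ∀ {a} → PT (listᵗ a) (listᵗ a) reverse
reverseᴾ {a} = foldᴾ ∘ᴾ ⟨ leafᴾ tt refl , ⟨ nilᴾ , idᴾ ⟩ᴾ ⟩ᴾ
  where
  growth : ∀ (env : ⊤) (st : List (El a)) x →
           sizeᵗ (listᵗ a) (x ∷ st) ≤ sizeᵗ (listᵗ a) st + suc (suc (sizeᵗ a x))
  growth _ st x = ≤-trans (s≤s (≤-trans (≤-reflexive (+-comm (sizeᵗ a x) _)) (+-monoʳ-≤ (sizeᵗ (listᵗ a) st) (n≤1+n _))))
                          (≤-reflexive (sym (+-suc _ _)))
  open Fold {unitᵗ} {listᵗ a} {a} {λ (_ , st , x) → x ∷ st}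
            (consᴾ (sndᴾ ∘ᴾ sndᴾ) (fstᴾ ∘ᴾ sndᴾ)) (K 1 :+ X) growth

-- The fold collects the images in reverse order, hence the final `reverse`; each round adds one
-- image whose size does not depend on those collected.
mapᴾ : ∀ {e a b f} → PT (e ×ᵗ a) b f →
       PT (e ×ᵗ listᵗ a) (listᵗ b) (λ (env , xs) → map (λ x → f (env , x)) xs)
mapᴾ {e} {a} {b} {f} p =
  PT-ext (λ (env , xs) → trans (cong reverse (revMap-foldl (λ x → f (env , x)) [] xs))
                               (reverse-involutive (map (λ x → f (env , x)) xs)))
         (reverseᴾ ∘ᴾ foldᴾ ∘ᴾ ⟨ fstᴾ , ⟨ nilᴾ , sndᴾ ⟩ᴾ ⟩ᴾ)
  where
  growth : ∀ (env : El e) (st : List (El b)) x → sizeᵗ (listᵗ b) (f (env , x) ∷ st)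
           ≤ sizeᵗ (listᵗ b) st + suc (⟦ timeBound p ⟧ (suc (sizeᵗ e env + sizeᵗ a x)))
  growth env st x = begin
    suc (sizeᵗ b (f (env , x)) + sizeᵗ (listᵗ b) st)
      ≡⟨ cong suc (+-comm _ (sizeᵗ (listᵗ b) st)) ⟩
    suc (sizeᵗ (listᵗ b) st + sizeᵗ b (f (env , x)))
      ≤⟨ s≤s (+-monoʳ-≤ (sizeᵗ (listᵗ b) st) (sizeBound p (env , x))) ⟩
    suc (sizeᵗ (listᵗ b) st + ⟦ timeBound p ⟧ (suc (sizeᵗ e env + sizeᵗ a x)))
      ≡⟨ +-suc _ _ ⟨
    sizeᵗ (listᵗ b) st + suc (⟦ timeBound p ⟧ (suc (sizeᵗ e env + sizeᵗ a x))) ∎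
    where open ≤-Reasoning
  open Fold {e} {listᵗ b} {a} {λ (env , st , x) → f (env , x) ∷ st}
            (consᴾ (p ∘ᴾ ⟨ fstᴾ , sndᴾ ∘ᴾ sndᴾ ⟩ᴾ) (fstᴾ ∘ᴾ sndᴾ))
            (K 1 :+ timeBound p :∘ (K 1 :+ X)) growth

size-cons-if : ∀ {a} (b : Bool) (x : El a) xs m → sizeᵗ (listᵗ a) (if b then x ∷ xs else xs)
               ≤ sizeᵗ (listᵗ a) xs + suc (m + sizeᵗ a x)
size-cons-if {a} true  x xs m = ≤-trans (s≤s (≤-trans (≤-reflexive (+-comm (sizeᵗ a x) _))
                                                  (+-monoʳ-≤ (sizeᵗ (listᵗ a) xs) (m≤n+m _ m))))
                                    (≤-reflexive (sym (+-suc _ _)))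
size-cons-if     false x xs m = m≤m+n _ _

revFilter-foldl : {A : Set} (p : A → Bool) (ys xs : List A) →
                  foldl (λ acc x → if p x then x ∷ acc else acc) ys xs ≡ filterᵇ p xs ʳ++ ys
revFilter-foldl p ys []       = refl
revFilter-foldl p ys (x ∷ xs) with p x
... | true  = revFilter-foldl p (x ∷ ys) xs
... | false = revFilter-foldl p ys xs

filterᴾ : ∀ {a p} → PT a boolᵗ p → PT (listᵗ a) (listᵗ a) (filterᵇ p)
filterᴾ {a} {p} q =
  PT-ext (λ xs → trans (cong reverse (revFilter-foldl p [] xs)) (reverse-involutive (filterᵇ p xs)))
         (reverseᴾ ∘ᴾ foldᴾ ∘ᴾ ⟨ leafᴾ tt refl , ⟨ nilᴾ , idᴾ ⟩ᴾ ⟩ᴾ)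
  where
  open Fold {unitᵗ} {listᵗ a} {a} {λ (_ , st , x) → if p x then x ∷ st else st}
            (ifᴾ (q ∘ᴾ sndᴾ ∘ᴾ sndᴾ) (consᴾ (sndᴾ ∘ᴾ sndᴾ) (fstᴾ ∘ᴾ sndᴾ)) (fstᴾ ∘ᴾ sndᴾ))
            (K 1 :+ X) (λ _ st x → size-cons-if (p x) x st 1)

-- Unary arithmetic

length-foldl : {A : Set} (m : ℕ) (xs : List A) → foldl (λ acc _ → suc acc) m xs ≡ length xs + m
length-foldl m []       = refl
length-foldl m (x ∷ xs) = trans (length-foldl (suc m) xs) (+-suc (length xs) m)

growth-suc : ∀ m r → sizeᵗ natᵗ (suc m) ≤ sizeᵗ natᵗ m + (2 + r)
growth-suc m r = ≤-trans (≤-reflexive (+-comm 2 _)) (+-monoʳ-≤ (sizeᵗ natᵗ m) (m≤m+n 2 r))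

lengthᴾ : ∀ {a} → PT (listᵗ a) natᵗ length
lengthᴾ {a} = PT-ext (λ xs → trans (length-foldl 0 xs) (+-identityʳ _))
                     (foldᴾ ∘ᴾ ⟨ leafᴾ tt refl , ⟨ zeroᴾ , idᴾ ⟩ᴾ ⟩ᴾ)
  where
  open Fold {unitᵗ} {natᵗ} {a} {λ (_ , st , x) → suc st} (sucᴾ (fstᴾ ∘ᴾ sndᴾ)) (K 2)
            (λ _ st x → growth-suc st 0)

countTrue : List Bool → ℕ
countTrue []           = 0
countTrue (true  ∷ bs) = suc (countTrue bs)
countTrue (false ∷ bs) = countTrue bs

countTrue-foldl : ∀ m bs → foldl (λ acc b → if b then suc acc else acc) m bs ≡ countTrue bs + m
countTrue-foldl m []           = refl
countTrue-foldl m (true  ∷ bs) = trans (countTrue-foldl (suc m) bs) (+-suc (countTrue bs) m)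
countTrue-foldl m (false ∷ bs) = countTrue-foldl m bs

countTrueᴾ : PT (listᵗ boolᵗ) natᵗ countTrue
countTrueᴾ = PT-ext (λ bs → trans (countTrue-foldl 0 bs) (+-identityʳ _))
                    (foldᴾ ∘ᴾ ⟨ leafᴾ tt refl , ⟨ zeroᴾ , idᴾ ⟩ᴾ ⟩ᴾ)
  where
  growth : ∀ (env : ⊤) st b → sizeᵗ natᵗ (if b then suc st else st) ≤ sizeᵗ natᵗ st + 2
  growth _ st true  = growth-suc st 0
  growth _ st false = m≤m+n _ _
  open Fold {unitᵗ} {natᵗ} {boolᵗ} {λ (_ , st , b) → if b then suc st else st}
            (ifᴾ (sndᴾ ∘ᴾ sndᴾ) (sucᴾ (fstᴾ ∘ᴾ sndᴾ)) (fstᴾ ∘ᴾ sndᴾ)) (K 2) growth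

monus-foldl : ∀ m n → foldl (λ acc (_ : ⊤) → pred acc) m (replicate n tt) ≡ m ∸ n
monus-foldl m       zero    = refl
monus-foldl zero    (suc n) = trans (monus-foldl 0 n) (0∸n≡0 n)
monus-foldl (suc m) (suc n) = monus-foldl m n

monusᴾ : PT (natᵗ ×ᵗ natᵗ) natᵗ (λ (m , n) → m ∸ n)
monusᴾ = PT-ext (λ (m , n) → monus-foldl m n)
                (foldᴾ ∘ᴾ ⟨ leafᴾ tt refl , ⟨ fstᴾ , unaryᴾ ∘ᴾ sndᴾ ⟩ᴾ ⟩ᴾ)
  where
  growth : ∀ (env : ⊤) st (x : ⊤) → sizeᵗ natᵗ (pred st) ≤ sizeᵗ natᵗ st + 0
  growth _ zero     x = ≤-refl
  growth _ (suc st) x = m≤n⇒m≤1+n (m≤n⇒m≤1+n (m≤m+n _ 0))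
  open Fold {unitᵗ} {natᵗ} {unitᵗ} {λ (_ , st , _) → pred st} (predᴾ ∘ᴾ fstᴾ ∘ᴾ sndᴾ) (K 0) growth

infix 4 _≤ᶠ_

_≤ᶠ_ : ℕ → ℕ → Bool
m ≤ᶠ n = isZero (m ∸ n)

≤ᶠ-sound : ∀ {m n} → (m ≤ᶠ n) ≡ true → m ≤ n
≤ᶠ-sound {m} {n} h with m ∸ n in eq
... | zero = m∸n≡0⇒m≤n eq

≤ᶠ-complete : ∀ {m n} → m ≤ n → (m ≤ᶠ n) ≡ true
≤ᶠ-complete m≤n = cong isZero (m≤n⇒m∸n≡0 m≤n)

leqᴾ : ∀ {a f g} → PT a natᵗ f → PT a natᵗ g → PT a boolᵗ (λ x → f x ≤ᶠ g x)
leqᴾ p q = isZeroᴾ ∘ᴾ monusᴾ ∘ᴾ ⟨ p , q ⟩ᴾ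

plus-foldl : ∀ m n → foldl (λ acc (_ : ⊤) → suc acc) n (replicate m tt) ≡ m + n
plus-foldl zero    n = refl
plus-foldl (suc m) n = trans (plus-foldl m (suc n)) (+-suc m n)

plusᴾ : PT (natᵗ ×ᵗ natᵗ) natᵗ (λ (m , n) → m + n)
plusᴾ = PT-ext (λ (m , n) → plus-foldl m n)
               (foldᴾ ∘ᴾ ⟨ leafᴾ tt refl , ⟨ sndᴾ , unaryᴾ ∘ᴾ fstᴾ ⟩ᴾ ⟩ᴾ)
  where
  open Fold {unitᵗ} {natᵗ} {unitᵗ} {λ (_ , st , _) → suc st} (sucᴾ (fstᴾ ∘ᴾ sndᴾ)) (K 2)
            (λ _ st x → growth-suc st 0)

times-foldl : ∀ m n p → foldl (λ acc (_ : ⊤) → n + acc) p (replicate m tt) ≡ m * n + p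
times-foldl zero    n p = refl
times-foldl (suc m) n p = trans (times-foldl m n (n + p)) (lemma (m * n) n p)
  where
  lemma : ∀ x n p → x + (n + p) ≡ n + x + p
  lemma = solve-∀

size-+ : ∀ m n → sizeᵗ natᵗ (m + n) ≤ sizeᵗ natᵗ n + sizeᵗ natᵗ m
size-+ zero    n = m≤m+n _ _
size-+ (suc m) n = ≤-trans (s≤s (s≤s (size-+ m n))) (≤-reflexive (lemma (sizeᵗ natᵗ n) (sizeᵗ natᵗ m)))
  where
  lemma : ∀ x y → 2 + (x + y) ≡ x + (2 + y)
  lemma = solve-∀

timesᴾ : ∀ {a f g} → PT a natᵗ f → PT a natᵗ g → PT a natᵗ (λ x → f x * g x)
timesᴾ {f = f} {g} p q =
  PT-ext (λ x → trans (times-foldl (f x) (g x) 0) (+-identityʳ _))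
         (foldᴾ ∘ᴾ ⟨ q , ⟨ zeroᴾ , unaryᴾ ∘ᴾ p ⟩ᴾ ⟩ᴾ)
  where
  open Fold {natᵗ} {natᵗ} {unitᵗ} {λ (n , st , _) → n + st} (plusᴾ ∘ᴾ ⟨ fstᴾ , fstᴾ ∘ᴾ sndᴾ ⟩ᴾ) X
            (λ n st x → ≤-trans (size-+ n st) (+-monoʳ-≤ (sizeᵗ natᵗ st) (m≤m+n _ _)))

powᴾ : ∀ {a f} e → PT a natᵗ f → PT a natᵗ (λ x → f x ^ e)
powᴾ zero    p = constℕᴾ 1
powᴾ (suc e) p = timesᴾ p (powᴾ e p)

-- With at most threshold k e sets above each Y ∪ {v}, k elements outside Y hit fewer
-- than threshold k (suc e) sets above Y.
threshold : ℕ → ℕ → ℕ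
threshold k zero    = 1
threshold k (suc e) = suc (k * threshold k e)

thresholdᴾ : ∀ e → PT natᵗ natᵗ (λ k → threshold k e)
thresholdᴾ zero    = constℕᴾ 1
thresholdᴾ (suc e) = sucᴾ (timesᴾ idᴾ (thresholdᴾ e))

-- The lower bound 1 makes room, at k = 0, for the one set of an unsolvable instance.
capacity : ℕ → ℕ → ℕ
capacity d k = 1 ⊔ (d * d ! * k ^ d)

capacityᴾ : ∀ d → PT natᵗ natᵗ (capacity d)
capacityᴾ d = PT-ext (λ k → eq (d * d ! * k ^ d))
  (ifᴾ (isZeroᴾ ∘ᴾ product) (constℕᴾ 1) product)
  where
  product : PT natᵗ natᵗ (λ k → d * d ! * k ^ d)
  product = timesᴾ (constℕᴾ (d * d !)) (powᴾ d idᴾ)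
  eq : ∀ m → (if isZero m then 1 else m) ≡ 1 ⊔ m
  eq zero    = refl
  eq (suc m) = refl

-- The kernelization on incidence matrices, given as lists of rows

Row : Set
Row = List Bool

rowᵗ : Ty
rowᵗ = listᵗ boolᵗ

tails : List Row → List Row
tails = map tailL

ones : List Row → List Row
ones G = tails (filterᵇ headB G)

tailsᴾ : PT (listᵗ rowᵗ) (listᵗ rowᵗ) tails
tailsᴾ = mapᴾ {unitᵗ} (tailᴾ ∘ᴾ sndᴾ) ∘ᴾ ⟨ leafᴾ tt refl , idᴾ ⟩ᴾ

onesᴾ : PT (listᵗ rowᵗ) (listᵗ rowᵗ) ones
onesᴾ = tailsᴾ ∘ᴾ filterᴾ headᴾ

-- heavyR e k A G decides whether some Y ⊆ A with |Y| ≤ e lies in at least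
-- threshold k (e ∸ |Y|) rows of G.  Each column is deleted once it is decided, with
-- the rows avoiding it discarded if it is put into Y, so Y itself is never stored.
heavyR : ℕ → ℕ → Row → List Row → Bool
walkR  : ℕ → ℕ → Row → List Row → Bool
heavyR e k A G = (threshold k e ≤ᶠ length G) ∨ walkR e k A G
walkR zero    k A       G = false
walkR (suc e) k []      G = false
walkR (suc e) k (a ∷ A) G = (a ∧ heavyR e k A (ones G)) ∨ walkR (suc e) k A (tails G)

-- `walkR` is a fold over the row it walks along. The state repeats the remaining row and matrix
-- because a fold supplies only the current entry.
walk-step : ℕ → ℕ × (Row × List Row × Bool) × Bool → Row × List Row × Bool
walk-step e (k , (A , G , r) , a) = tailL A , tails G , (a ∧ heavyR e k (tailL A) (ones G)) ∨ r

walk-foldl : ∀ e k A G r →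
  proj₂ (proj₂ (foldl (λ st a → walk-step e (k , st , a)) (A , G , r) A)) ≡ walkR (suc e) k A G ∨ r
walk-foldl e k []      G r = refl
walk-foldl e k (a ∷ A) G r = trans (walk-foldl e k A (tails G) (h ∨ r))
  (trans (sym (∨-assoc w h r)) (cong (_∨ r) (∨-comm w h)))
  where
  h w : Bool
  h = a ∧ heavyR e k A (ones G)
  w = walkR (suc e) k A (tails G)

size-tailL : ∀ {a} (xs : List (El a)) → sizeᵗ (listᵗ a) (tailL xs) ≤ sizeᵗ (listᵗ a) xs
size-tailL         []       = ≤-refl
size-tailL {a} (x ∷ xs) = m≤n⇒m≤1+n (m≤n+m _ (sizeᵗ a x))

size-tails : ∀ G → sizeᵗ (listᵗ rowᵗ) (tails G) ≤ sizeᵗ (listᵗ rowᵗ) G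
size-tails []      = ≤-refl
size-tails (A ∷ G) = s≤s (+-mono-≤ (size-tailL A) (size-tails G))

size-bool : ∀ b → sizeᵗ boolᵗ b ≤ 3
size-bool true  = ≤-refl
size-bool false = s≤s z≤n

-- The recursion is on `e`, which is a constant for each `d`: the program nests one loop per level,
-- and the degree of its time bound depends on `d` alone.
heavyᴾ : ∀ e → PT (natᵗ ×ᵗ rowᵗ ×ᵗ listᵗ rowᵗ) boolᵗ (λ (k , A , G) → heavyR e k A G)
walkᴾ  : ∀ e → PT (natᵗ ×ᵗ rowᵗ ×ᵗ listᵗ rowᵗ) boolᵗ (λ (k , A , G) → walkR e k A G)
heavyᴾ e = ∨ᴾ (leqᴾ (thresholdᴾ e ∘ᴾ fstᴾ) (lengthᴾ ∘ᴾ sndᴾ ∘ᴾ sndᴾ)) (walkᴾ e)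
walkᴾ zero    = falseᴾ
walkᴾ (suc e) = PT-ext (λ (k , A , G) → trans (walk-foldl e k A G false) (∨-identityʳ _))
  (sndᴾ ∘ᴾ sndᴾ ∘ᴾ foldᴾ ∘ᴾ
   ⟨ fstᴾ , ⟨ ⟨ fstᴾ ∘ᴾ sndᴾ , ⟨ sndᴾ ∘ᴾ sndᴾ , falseᴾ ⟩ᴾ ⟩ᴾ , fstᴾ ∘ᴾ sndᴾ ⟩ᴾ ⟩ᴾ)
  where
  stateᵗ : Ty
  stateᵗ = rowᵗ ×ᵗ listᵗ rowᵗ ×ᵗ boolᵗ
  Aᴾ : PT (natᵗ ×ᵗ stateᵗ ×ᵗ boolᵗ) rowᵗ (λ (k , (A , G , r) , a) → A)
  Aᴾ = fstᴾ ∘ᴾ fstᴾ ∘ᴾ sndᴾ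
  Gᴾ : PT (natᵗ ×ᵗ stateᵗ ×ᵗ boolᵗ) (listᵗ rowᵗ) (λ (k , (A , G , r) , a) → G)
  Gᴾ = fstᴾ ∘ᴾ sndᴾ ∘ᴾ fstᴾ ∘ᴾ sndᴾ
  stepᴾ : PT (natᵗ ×ᵗ stateᵗ ×ᵗ boolᵗ) stateᵗ (walk-step e)
  stepᴾ = ⟨ tailᴾ ∘ᴾ Aᴾ , ⟨ tailsᴾ ∘ᴾ Gᴾ ,
    ∨ᴾ (∧ᴾ (sndᴾ ∘ᴾ sndᴾ) (heavyᴾ e ∘ᴾ ⟨ fstᴾ , ⟨ tailᴾ ∘ᴾ Aᴾ , onesᴾ ∘ᴾ Gᴾ ⟩ᴾ ⟩ᴾ))
       (sndᴾ ∘ᴾ sndᴾ ∘ᴾ fstᴾ ∘ᴾ sndᴾ) ⟩ᴾ ⟩ᴾ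
  -- Row and matrix only shrink, and the new Boolean has at most 3 nodes.
  growth : ∀ k st a → sizeᵗ stateᵗ (walk-step e (k , st , a)) ≤ sizeᵗ stateᵗ st + 3
  growth k (A , G , r) a = begin
    suc (sizeᵗ rowᵗ (tailL A) + suc (sizeᵗ (listᵗ rowᵗ) (tails G) + sizeᵗ boolᵗ r′))
      ≤⟨ s≤s (+-mono-≤ (size-tailL A) (s≤s (+-mono-≤ (size-tails G) (size-bool r′)))) ⟩
    suc (sizeᵗ rowᵗ A + suc (sizeᵗ (listᵗ rowᵗ) G + 3))
      ≤⟨ s≤s (+-monoʳ-≤ (sizeᵗ rowᵗ A) (s≤s (+-monoʳ-≤ (sizeᵗ (listᵗ rowᵗ) G) (m≤n+m 3 (sizeᵗ boolᵗ r))))) ⟩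
    suc (sizeᵗ rowᵗ A + suc (sizeᵗ (listᵗ rowᵗ) G + (sizeᵗ boolᵗ r + 3)))
      ≡⟨ lemma (sizeᵗ rowᵗ A) (sizeᵗ (listᵗ rowᵗ) G) (sizeᵗ boolᵗ r) ⟩
    suc (sizeᵗ rowᵗ A + suc (sizeᵗ (listᵗ rowᵗ) G + sizeᵗ boolᵗ r)) + 3 ∎
    where
    open ≤-Reasoning
    r′ : Bool
    r′ = proj₂ (proj₂ (walk-step e (k , (A , G , r) , a)))
    lemma : ∀ x y z → 1 + (x + suc (y + (z + 3))) ≡ suc (x + suc (y + z)) + 3
    lemma = solve-∀
  open Fold {natᵗ} {stateᵗ} {boolᵗ} stepᴾ (K 3) growth

greedyR : ℕ → ℕ → List Row → List Row → List Row
greedyR d k = foldl (λ F A → if heavyR d k A F then F else A ∷ F)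

greedyᴾ : ∀ d → PT (natᵗ ×ᵗ listᵗ rowᵗ) (listᵗ rowᵗ) (λ (k , 𝒜) → greedyR d k [] 𝒜)
greedyᴾ d = foldᴾ ∘ᴾ ⟨ fstᴾ , ⟨ nilᴾ , sndᴾ ⟩ᴾ ⟩ᴾ
  where
  growth : ∀ (k : ℕ) F A → sizeᵗ (listᵗ rowᵗ) (if heavyR d k A F then F else A ∷ F)
                         ≤ sizeᵗ (listᵗ rowᵗ) F + suc (sizeᵗ natᵗ k + sizeᵗ rowᵗ A)
  growth k F A with heavyR d k A F
  ... | true  = size-cons-if {rowᵗ} false A F (sizeᵗ natᵗ k)
  ... | false = size-cons-if {rowᵗ} true A F (sizeᵗ natᵗ k)
  open Fold {natᵗ} {listᵗ rowᵗ} {rowᵗ} {λ (k , F , A) → if heavyR d k A F then F else A ∷ F}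
    (ifᴾ (heavyᴾ d ∘ᴾ ⟨ fstᴾ , ⟨ sndᴾ ∘ᴾ sndᴾ , fstᴾ ∘ᴾ sndᴾ ⟩ᴾ ⟩ᴾ)
         (fstᴾ ∘ᴾ sndᴾ) (consᴾ (sndᴾ ∘ᴾ sndᴾ) (fstᴾ ∘ᴾ sndᴾ)))
    (K 1 :+ X) growth

anyHead : List Row → Bool
anyHead []      = false
anyHead (A ∷ G) = headB A ∨ anyHead G

anyHead-foldl : ∀ r G → foldl (λ acc A → headB A ∨ acc) r G ≡ anyHead G ∨ r
anyHead-foldl r []      = refl
anyHead-foldl r (A ∷ G) = trans (anyHead-foldl (headB A ∨ r) G)
  (trans (sym (∨-assoc (anyHead G) (headB A) r)) (cong (_∨ r) (∨-comm (anyHead G) (headB A))))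

anyHeadᴾ : PT (listᵗ rowᵗ) boolᵗ anyHead
anyHeadᴾ = PT-ext (λ G → trans (anyHead-foldl false G) (∨-identityʳ _))
                  (foldᴾ ∘ᴾ ⟨ leafᴾ tt refl , ⟨ falseᴾ , idᴾ ⟩ᴾ ⟩ᴾ)
  where
  open Fold {unitᵗ} {boolᵗ} {rowᵗ} {λ (_ , st , A) → headB A ∨ st}
            (∨ᴾ (headᴾ ∘ᴾ sndᴾ ∘ᴾ sndᴾ) (fstᴾ ∘ᴾ sndᴾ)) (K 3)
            (λ _ st A → ≤-trans (size-bool (headB A ∨ st)) (m≤n+m 3 _))

usedR : ℕ → List Row → Row
usedR zero    G = []
usedR (suc n) G = anyHead G ∷ usedR n (tails G)

used-foldl : ∀ n G acc → proj₂ (foldl (λ (G , acc) (_ : ⊤) → tails G , anyHead G ∷ acc) (G , acc) (replicate n tt))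
             ≡ usedR n G ʳ++ acc
used-foldl zero    G acc = refl
used-foldl (suc n) G acc = used-foldl n (tails G) (anyHead G ∷ acc)

usedᴾ : PT (natᵗ ×ᵗ listᵗ rowᵗ) rowᵗ (λ (n , G) → usedR n G)
usedᴾ = PT-ext (λ (n , G) → trans (cong reverse (used-foldl n G [])) (reverse-involutive (usedR n G)))
  (reverseᴾ ∘ᴾ sndᴾ ∘ᴾ foldᴾ ∘ᴾ ⟨ leafᴾ tt refl , ⟨ ⟨ sndᴾ , nilᴾ ⟩ᴾ , unaryᴾ ∘ᴾ fstᴾ ⟩ᴾ ⟩ᴾ)
  where
  step : ⊤ × (List Row × Row) × ⊤ → List Row × Row
  step (_ , (G , acc) , _) = tails G , anyHead G ∷ acc
  growth : ∀ (env : ⊤) st (x : ⊤) → sizeᵗ (listᵗ rowᵗ ×ᵗ rowᵗ) (step (env , st , x))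
                                  ≤ sizeᵗ (listᵗ rowᵗ ×ᵗ rowᵗ) st + 4
  growth _ (G , acc) _ = begin
    suc (sizeᵗ (listᵗ rowᵗ) (tails G) + suc (sizeᵗ boolᵗ (anyHead G) + sizeᵗ rowᵗ acc))
      ≤⟨ s≤s (+-mono-≤ (size-tails G) (s≤s (+-monoˡ-≤ _ (size-bool (anyHead G))))) ⟩
    suc (sizeᵗ (listᵗ rowᵗ) G + suc (3 + sizeᵗ rowᵗ acc))
      ≡⟨ lemma (sizeᵗ (listᵗ rowᵗ) G) (sizeᵗ rowᵗ acc) ⟩
    suc (sizeᵗ (listᵗ rowᵗ) G + sizeᵗ rowᵗ acc) + 4 ∎
    where
    open ≤-Reasoning
    lemma : ∀ x y → 1 + (x + (4 + y)) ≡ suc (x + y) + 4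
    lemma = solve-∀
  open Fold {unitᵗ} {listᵗ rowᵗ ×ᵗ rowᵗ} {unitᵗ} {step}
    ⟨ tailsᴾ ∘ᴾ fstᴾ ∘ᴾ fstᴾ ∘ᴾ sndᴾ , consᴾ (anyHeadᴾ ∘ᴾ fstᴾ ∘ᴾ fstᴾ ∘ᴾ sndᴾ) (sndᴾ ∘ᴾ fstᴾ ∘ᴾ sndᴾ) ⟩ᴾ
    (K 4) growth

restrictR : Row → Row → Row
restrictR []          A = []
restrictR (true  ∷ M) A = headB A ∷ restrictR M (tailL A)
restrictR (false ∷ M) A = restrictR M (tailL A)

restrict-step : Row × Row → Bool → Row × Row
restrict-step (A , acc) m = tailL A , (if m then headB A ∷ acc else acc)

restrict-foldl : ∀ M A acc → proj₂ (foldl restrict-step (A , acc) M) ≡ restrictR M A ʳ++ acc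
restrict-foldl []          A acc = refl
restrict-foldl (true  ∷ M) A acc = restrict-foldl M (tailL A) (headB A ∷ acc)
restrict-foldl (false ∷ M) A acc = restrict-foldl M (tailL A) acc

restrictᴾ : PT (rowᵗ ×ᵗ rowᵗ) rowᵗ (λ (M , A) → restrictR M A)
restrictᴾ = PT-ext (λ (M , A) → trans (cong reverse (restrict-foldl M A [])) (reverse-involutive (restrictR M A)))
  (reverseᴾ ∘ᴾ sndᴾ ∘ᴾ foldᴾ ∘ᴾ ⟨ leafᴾ tt refl , ⟨ ⟨ sndᴾ , nilᴾ ⟩ᴾ , fstᴾ ⟩ᴾ ⟩ᴾ)
  where
  growth : ∀ (env : ⊤) st m → sizeᵗ (rowᵗ ×ᵗ rowᵗ) (restrict-step st m) ≤ sizeᵗ (rowᵗ ×ᵗ rowᵗ) st + 4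
  growth _ (A , acc) m = begin
    suc (sizeᵗ rowᵗ (tailL A) + sizeᵗ rowᵗ (if m then headB A ∷ acc else acc))
      ≤⟨ s≤s (+-mono-≤ (size-tailL A) (≤-trans (size-cons-if {boolᵗ} m (headB A) acc 0)
                                               (+-monoʳ-≤ (sizeᵗ rowᵗ acc) (s≤s (size-bool (headB A)))))) ⟩
    suc (sizeᵗ rowᵗ A + (sizeᵗ rowᵗ acc + 4))
      ≡⟨ cong suc (+-assoc (sizeᵗ rowᵗ A) (sizeᵗ rowᵗ acc) 4) ⟨
    suc (sizeᵗ rowᵗ A + sizeᵗ rowᵗ acc) + 4 ∎
    where open ≤-Reasoning
  open Fold {unitᵗ} {rowᵗ ×ᵗ rowᵗ} {boolᵗ} {λ (_ , st , m) → restrict-step st m}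
    ⟨ tailᴾ ∘ᴾ fstᴾ ∘ᴾ fstᴾ ∘ᴾ sndᴾ ,
      ifᴾ (sndᴾ ∘ᴾ sndᴾ) (consᴾ (headᴾ ∘ᴾ fstᴾ ∘ᴾ fstᴾ ∘ᴾ sndᴾ) (sndᴾ ∘ᴾ fstᴾ ∘ᴾ sndᴾ))
                         (sndᴾ ∘ᴾ fstᴾ ∘ᴾ sndᴾ) ⟩ᴾ
    (K 4) growth

matrixᵗ : Ty
matrixᵗ = (natᵗ ×ᵗ listᵗ rowᵗ) ×ᵗ natᵗ

Matrix : Set
Matrix = (ℕ × List Row) × ℕ

trimR : ℕ × List Row → ℕ × List Row
trimR (n , F) = countTrue (usedR n F) , map (restrictR (usedR n F)) F

trimᴾ : PT (natᵗ ×ᵗ listᵗ rowᵗ) (natᵗ ×ᵗ listᵗ rowᵗ) trimR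
trimᴾ = ⟨ countTrueᴾ ∘ᴾ usedᴾ , mapᴾ restrictᴾ ∘ᴾ ⟨ usedᴾ , sndᴾ ⟩ᴾ ⟩ᴾ

withinBounds : ℕ → Matrix → Bool
withinBounds d ((n , 𝒜) , k) = (length 𝒜 ≤ᶠ capacity d k) ∧ (n ≤ᶠ d * capacity d k)

reduceR : ℕ → Matrix → Matrix
reduceR d ((n , 𝒜) , k) =
  if length (greedyR d k [] 𝒜) ≤ᶠ capacity d k
  then (trimR (n , greedyR d k [] 𝒜) , k)
  else ((0 , [] ∷ []) , k)

kernelR : ℕ → Matrix → Matrix
kernelR d x = if withinBounds d x then x else reduceR d x

kernelᴾ : ∀ d → PT matrixᵗ matrixᵗ (kernelR d)
kernelᴾ d = ifᴾ
  (∧ᴾ (leqᴾ (lengthᴾ ∘ᴾ sndᴾ ∘ᴾ fstᴾ) cap) (leqᴾ (fstᴾ ∘ᴾ fstᴾ) (timesᴾ (constℕᴾ d) cap)))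
  idᴾ
  (ifᴾ (leqᴾ (lengthᴾ ∘ᴾ greedy) cap)
       ⟨ trimᴾ ∘ᴾ ⟨ fstᴾ ∘ᴾ fstᴾ , greedy ⟩ᴾ , sndᴾ ⟩ᴾ
       ⟨ ⟨ zeroᴾ , consᴾ nilᴾ nilᴾ ⟩ᴾ , sndᴾ ⟩ᴾ)
  where
  cap : PT matrixᵗ natᵗ (λ ((n , 𝒜) , k) → capacity d k)
  cap = capacityᴾ d ∘ᴾ sndᴾ
  greedy : PT matrixᵗ (listᵗ rowᵗ) (λ ((n , 𝒜) , k) → greedyR d k [] 𝒜)
  greedy = greedyᴾ d ∘ᴾ ⟨ sndᴾ , sndᴾ ∘ᴾ fstᴾ ⟩ᴾ

-- Counting the sets above a core

count : {A : Set} → (A → Bool) → List A → ℕ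
count p []       = 0
count p (x ∷ xs) = if p x then suc (count p xs) else count p xs

count-∷-≤ : {A : Set} (p : A → Bool) (x : A) (xs : List A) → count p xs ≤ count p (x ∷ xs)
count-∷-≤ p x xs with p x
... | true  = n≤1+n _
... | false = ≤-refl

count-∷-hit : {A : Set} (p : A → Bool) {x : A} (xs : List A) → p x ≡ true → count p (x ∷ xs) ≡ suc (count p xs)
count-∷-hit p xs eq rewrite eq = refl

count-∷-miss : {A : Set} (p : A → Bool) {x : A} (xs : List A) → p x ≡ false → count p (x ∷ xs) ≡ count p xs
count-∷-miss p xs eq rewrite eq = refl

count-none : {A : Set} (p : A → Bool) (xs : List A) → (∀ {x} → x ∈ xs → p x ≡ false) → count p xs ≡ 0
count-none p []       h = refl
count-none p (x ∷ xs) h = trans (count-∷-miss p xs (h (here refl))) (count-none p xs (h ∘ there))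

count-pos : {A : Set} (p : A → Bool) (xs : List A) → 1 ≤ count p xs → ∃[ x ] x ∈ xs × p x ≡ true
count-pos p (x ∷ xs) h with p x in eq
... | true  = x , here refl , eq
... | false = let (y , y∈ , py) = count-pos p xs h in y , there y∈ , py

count-all : {A : Set} (p : A → Bool) (xs : List A) → (∀ {x} → x ∈ xs → p x ≡ true) → count p xs ≡ length xs
count-all p []       h = refl
count-all p (x ∷ xs) h = trans (count-∷-hit p xs (h (here refl))) (cong suc (count-all p xs (h ∘ there)))

count-split : {A : Set} (p q : A → Bool) (xs : List A) →
              count p xs ≤ count q xs + count (λ x → p x ∧ not (q x)) xs
count-split p q []       = z≤n
count-split p q (x ∷ xs) with p x | q x
... | true  | true  = s≤s (count-split p q xs)
... | true  | false = ≤-trans (s≤s (count-split p q xs)) (≤-reflexive (sym (+-suc _ _)))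
... | false | true  = m≤n⇒m≤1+n (count-split p q xs)
... | false | false = count-split p q xs

-- Union bound: the elements satisfying the first property are split off, and the remaining
-- properties cover what is left.
count-⋃ : {A V : Set} (m : ℕ) (q : V → A → Bool) (vs : List V) (p : A → Bool) (xs : List A) →
          (∀ {x} → x ∈ xs → p x ≡ true → Any (λ v → q v x ≡ true) vs) →
          (∀ {v} → v ∈ vs → count (q v) xs ≤ m) → count p xs ≤ length vs * m
count-⋃ m q []       p xs cover bound = ≤-reflexive (count-none p xs none)
  where
  none : ∀ {x} → x ∈ xs → p x ≡ false
  none {x} x∈ with p x in eq
  ... | false = refl
  ... | true  with cover x∈ eq
  ... | ()
count-⋃ m q (v ∷ vs) p xs cover bound = ≤-trans (count-split p (q v) xs)
  (+-mono-≤ (bound (here refl)) (count-⋃ m q vs _ xs cover′ (bound ∘ there)))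
  where
  cover′ : ∀ {x} → x ∈ xs → (p x ∧ not (q v x)) ≡ true → Any (λ v → q v x ≡ true) vs
  cover′ {x} x∈ h with p x in eq | q v x in eq′
  ... | true | false with cover x∈ eq
  ... | there a = a
  ... | here eq″ with trans (sym eq″) eq′
  ... | ()

count≤1 : {A : Set} (p : A → Bool) (y : A) (xs : List A) → Unique xs →
          (∀ {x} → x ∈ xs → p x ≡ true → x ≡ y) → count p xs ≤ 1
count≤1 p y []       u h = z≤n
count≤1 p y (x ∷ xs) (x∉ ∷ u) h with p x in eq
... | false = count≤1 p y xs u (h ∘ there)
... | true  = s≤s (≤-reflexive (count-none p xs none))
  where
  none : ∀ {z} → z ∈ xs → p z ≡ false
  none {z} z∈ with p z in eq′
  ... | false = refl
  ... | true  = ⊥-elim (All.lookup x∉ z∈ (trans (h (here refl) eq) (sym (h (there z∈) eq′))))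

_⊆ᵇ_ : ∀ {n} → Subset n → Subset n → Bool
[]          ⊆ᵇ []      = true
(true  ∷ Y) ⊆ᵇ (b ∷ B) = b ∧ (Y ⊆ᵇ B)
(false ∷ Y) ⊆ᵇ (b ∷ B) = Y ⊆ᵇ B

⊆ᵇ-sound : ∀ {n} (Y B : Subset n) → (Y ⊆ᵇ B) ≡ true → ∀ {x} → x ∈ˢ Y → x ∈ˢ B
⊆ᵇ-sound (true  ∷ Y) (true ∷ B) h here       = here
⊆ᵇ-sound (true  ∷ Y) (true ∷ B) h (there x∈) = there (⊆ᵇ-sound Y B h x∈)
⊆ᵇ-sound (false ∷ Y) (b    ∷ B) h (there x∈) = there (⊆ᵇ-sound Y B h x∈)

⊆ᵇ-complete : ∀ {n} (Y B : Subset n) → (∀ {x} → x ∈ˢ Y → x ∈ˢ B) → (Y ⊆ᵇ B) ≡ true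
⊆ᵇ-complete []          []          h = refl
⊆ᵇ-complete (true  ∷ Y) (b     ∷ B) h with h here
... | here = ⊆ᵇ-complete Y B (λ x∈ → drop (h (there x∈)))
  where
  drop : ∀ {x b} → suc x ∈ˢ (b ∷ B) → x ∈ˢ B
  drop (there x∈) = x∈
⊆ᵇ-complete (false ∷ Y) (b ∷ B) h = ⊆ᵇ-complete Y B (λ x∈ → drop (h (there x∈)))
  where
  drop : ∀ {x b} → suc x ∈ˢ (b ∷ B) → x ∈ˢ B
  drop (there x∈) = x∈

⊈ᵇ-witness : ∀ {n} (B Y : Subset n) → (B ⊆ᵇ Y) ≡ false → ∃[ v ] v ∈ˢ B × v ∉ˢ Y
⊈ᵇ-witness []          []          ()
⊈ᵇ-witness (true  ∷ B) (true  ∷ Y) h =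
  let (v , v∈ , v∉) = ⊈ᵇ-witness B Y h in suc v , there v∈ , λ { (there v∈Y) → v∉ v∈Y }
⊈ᵇ-witness (true  ∷ B) (false ∷ Y) h = zero , here , λ ()
⊈ᵇ-witness (false ∷ B) (y     ∷ Y) h =
  let (v , v∈ , v∉) = ⊈ᵇ-witness B Y h in suc v , there v∈ , λ { (there v∈Y) → v∉ v∈Y }

⊆ᵇ-card : ∀ {n} (Y B : Subset n) → (Y ⊆ᵇ B) ≡ true → card Y ≤ card B
⊆ᵇ-card []          []          h = z≤n
⊆ᵇ-card (true  ∷ Y) (true  ∷ B) h = s≤s (⊆ᵇ-card Y B h)
⊆ᵇ-card (false ∷ Y) (true  ∷ B) h = m≤n⇒m≤1+n (⊆ᵇ-card Y B h)
⊆ᵇ-card (false ∷ Y) (false ∷ B) h = ⊆ᵇ-card Y B h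

⊆ᵇ-card-≡ : ∀ {n} (Y B : Subset n) → (Y ⊆ᵇ B) ≡ true → card B ≤ card Y → B ≡ Y
⊆ᵇ-card-≡ []          []          h c       = refl
⊆ᵇ-card-≡ (true  ∷ Y) (true  ∷ B) h (s≤s c) = cong (true ∷_) (⊆ᵇ-card-≡ Y B h c)
⊆ᵇ-card-≡ (false ∷ Y) (true  ∷ B) h c       = ⊥-elim (<⇒≱ c (⊆ᵇ-card Y B h))
⊆ᵇ-card-≡ (false ∷ Y) (false ∷ B) h c       = cong (false ∷_) (⊆ᵇ-card-≡ Y B h c)

insert : ∀ {n} → Fin n → Subset n → Subset n
insert v Y = Y ∪ ⁅ v ⁆

card-insert : ∀ {n} (v : Fin n) (Y : Subset n) → v ∉ˢ Y → card (insert v Y) ≡ suc (card Y)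
card-insert zero    (true  ∷ Y) v∉ = ⊥-elim (v∉ here)
card-insert zero    (false ∷ Y) v∉ = cong (suc ∘ card) (∪-identityʳ Y)
card-insert (suc v) (true  ∷ Y) v∉ = cong suc (card-insert v Y (v∉ ∘ there))
card-insert (suc v) (false ∷ Y) v∉ = card-insert v Y (v∉ ∘ there)

insert-⊆ᵇ : ∀ {n} (v : Fin n) (Y B : Subset n) → (Y ⊆ᵇ B) ≡ true → v ∈ˢ B → (insert v Y ⊆ᵇ B) ≡ true
insert-⊆ᵇ v Y B Y⊆B v∈B = ⊆ᵇ-complete (insert v Y) B λ x∈ →
  [ ⊆ᵇ-sound Y B Y⊆B , (λ x∈v → transport (_∈ˢ B) (sym (x∈⁅y⁆⇒x≡y v x∈v)) v∈B) ] (x∈p∪q⁻ Y ⁅ v ⁆ x∈)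

elements : ∀ {n} → Subset n → List (Fin n)
elements []          = []
elements (true  ∷ p) = zero ∷ map suc (elements p)
elements (false ∷ p) = map suc (elements p)

length-elements : ∀ {n} (p : Subset n) → length (elements p) ≡ card p
length-elements []          = refl
length-elements (true  ∷ p) = cong suc (trans (length-map suc (elements p)) (length-elements p))
length-elements (false ∷ p) = trans (length-map suc (elements p)) (length-elements p)

∈-elements : ∀ {n} {p : Subset n} {x} → x ∈ˢ p → x ∈ elements p
∈-elements {p = true  ∷ p} here       = here refl
∈-elements {p = true  ∷ p} (there x∈) = there (∈-map⁺ suc (∈-elements x∈))
∈-elements {p = false ∷ p} (there x∈) = ∈-map⁺ suc (∈-elements x∈)

elements-∈ : ∀ {n} (p : Subset n) {x} → x ∈ elements p → x ∈ˢ p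
elements-∈ (true  ∷ p) (here refl) = here
elements-∈ (true  ∷ p) (there x∈)  with ∈-map⁻ suc x∈
... | y , y∈ , refl = there (elements-∈ p y∈)
elements-∈ (false ∷ p) x∈ with ∈-map⁻ suc x∈
... | y , y∈ , refl = there (elements-∈ p y∈)

degree : ∀ {n} → Subset n → List (Subset n) → ℕ
degree Y = count (Y ⊆ᵇ_)

degree-∅ : ∀ {n} (G : List (Subset n)) → degree ∅ G ≡ length G
degree-∅ G = count-all (∅ ⊆ᵇ_) G (λ {B} _ → ⊆ᵇ-complete ∅ B (λ x∈ → ⊥-elim (∉⊥ x∈)))

-- A set above `Y` either equals `Y`, which is recorded as `nothing`, or contains one of the at most
-- n elements outside `Y`. These n + 1 classes give one factor, and `e` bounds how often `Y` can
-- grow.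
distinct-degree : ∀ {n} d (G : List (Subset n)) → Unique G → All (λ B → card B ≤ d) G →
                  ∀ e (Y : Subset n) → d ≤ e + card Y → degree Y G ≤ suc n ^ e
distinct-degree d G uniq small zero Y d≤ = count≤1 (Y ⊆ᵇ_) Y G uniq
  (λ B∈ Y⊆B → ⊆ᵇ-card-≡ Y _ Y⊆B (≤-trans (All.lookup small B∈) d≤))
distinct-degree {n} d G uniq small (suc e) Y d≤ = ≤-trans
  (count-⋃ (suc n ^ e) above (nothing ∷ map just (elements (∁ Y))) (Y ⊆ᵇ_) G cover bound)
  (*-monoˡ-≤ (suc n ^ e) (s≤s (≤-trans (≤-reflexive (trans (length-map just (elements (∁ Y))) (length-elements (∁ Y)))) (∣p∣≤n (∁ Y)))))
  where
  above : Maybe (Fin n) → Subset n → Bool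
  above nothing  B = (B ⊆ᵇ Y) ∧ (Y ⊆ᵇ B)
  above (just v) B = insert v Y ⊆ᵇ B
  cover : ∀ {B} → B ∈ G → (Y ⊆ᵇ B) ≡ true → Any (λ v → above v B ≡ true) (nothing ∷ map just (elements (∁ Y)))
  cover {B} B∈ Y⊆B with B ⊆ᵇ Y in eq
  ... | true  = here (trans (cong (_∧ (Y ⊆ᵇ B)) eq) Y⊆B)
  ... | false = let (v , v∈B , v∉Y) = ⊈ᵇ-witness B Y eq in
    there (lose (∈-map⁺ just (∈-elements (x∉p⇒x∈∁p v∉Y))) (insert-⊆ᵇ v Y B Y⊆B v∈B))
  bound : ∀ {v} → v ∈ (nothing ∷ map just (elements (∁ Y))) → count (above v) G ≤ suc n ^ e
  bound (here refl) = ≤-trans (count≤1 (above nothing) Y G uniq same) (m^n>0 (suc n) e)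
    where
    same : ∀ {B} → B ∈ G → above nothing B ≡ true → B ≡ Y
    same {B} B∈ h with B ⊆ᵇ Y in eq
    ... | true = ⊆ᵇ-card-≡ Y B h (⊆ᵇ-card B Y eq)
  bound (there v∈) with ∈-map⁻ just v∈
  ... | v , v∈∁ , refl = distinct-degree d G uniq small e (insert v Y)
    (≤-trans d≤ (≤-reflexive (trans (sym (+-suc e (card Y)))
                                    (cong (e +_) (sym (card-insert v Y (x∈∁p⇒x∉p (elements-∈ (∁ Y) v∈∁))))))))

length≤suc-n^d : ∀ {n} d (G : List (Subset n)) → Unique G → All (λ B → card B ≤ d) G → length G ≤ suc n ^ d
length≤suc-n^d {n} d G uniq small = ≤-trans (≤-reflexive (sym (degree-∅ G)))
  (distinct-degree d G uniq small d ∅ (m≤m+n d _))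

-- Cores of large degree must be hit

Capped : ∀ {n} → ℕ → ℕ → List (Subset n) → Set
Capped {n} d k F = ∀ (Y : Subset n) → card Y ≤ d → degree Y F ≤ threshold k (d ∸ card Y)

Hits : ∀ {n} → Subset n → List (Subset n) → Set
Hits H F = ∀ {B} → B ∈ F → Nonempty (H ∩ B)

-- Each set above `Y` is hit at some v outside `Y`, hence lies above `insert v Y`. There are at most
-- k such v, and since v is new, the cap for `insert v Y` is one level lower.
degree-hit : ∀ {n d k F} (H Y : Subset n) → Capped d k F → All (λ B → card B ≤ d) F →
             Hits H F → card H ≤ k → ¬ Nonempty (H ∩ Y) → ∀ e → d ∸ card Y ≡ suc e →
             degree Y F ≤ k * threshold k e
degree-hit {n} {d} {k} {F} H Y capped small hits H≤k disjoint e d-Y = ≤-trans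
  (count-⋃ (threshold k e) (λ v → insert v Y ⊆ᵇ_) (elements H) (Y ⊆ᵇ_) F cover bound)
  (*-monoˡ-≤ (threshold k e) (≤-trans (≤-reflexive (length-elements H)) H≤k))
  where
  outside : ∀ {v} → v ∈ˢ H → v ∉ˢ Y
  outside v∈H v∈Y = disjoint (_ , x∈p∩q⁺ (v∈H , v∈Y))
  cover : ∀ {B} → B ∈ F → (Y ⊆ᵇ B) ≡ true → Any (λ v → (insert v Y ⊆ᵇ B) ≡ true) (elements H)
  cover {B} B∈ Y⊆B = let (v , v∈) = hits B∈ ; (v∈H , v∈B) = x∈p∩q⁻ H B v∈ in
    lose (∈-elements v∈H) (insert-⊆ᵇ v Y B Y⊆B v∈B)
  Y<d : card Y < d
  Y<d = m∸n≢0⇒n<m (λ d-Y≡0 → 0≢1+n (trans (sym d-Y≡0) d-Y))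
  bound : ∀ {v} → v ∈ elements H → degree (insert v Y) F ≤ threshold k e
  bound {v} v∈ = transport (λ m → degree (insert v Y) F ≤ threshold k m) d-insert
    (capped (insert v Y) (≤-trans (≤-reflexive (card-insert v Y v∉Y)) Y<d))
    where
    v∉Y : v ∉ˢ Y
    v∉Y = outside (elements-∈ H v∈)
    d-insert : d ∸ card (insert v Y) ≡ e
    d-insert = trans (cong (d ∸_) (card-insert v Y v∉Y))
      (trans (sym (pred[m∸n]≡m∸[1+n] d (card Y))) (cong pred d-Y))

core-hit : ∀ {n d k F} (H Y : Subset n) → Capped d k F → All (λ B → card B ≤ d) F →
           Hits H F → card H ≤ k → card Y ≤ d → threshold k (d ∸ card Y) ≤ degree Y F → Nonempty (H ∩ Y)
core-hit {n} {d} {k} {F} H Y capped small hits H≤k Y≤d heavy with nonempty? (H ∩ Y)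
... | yes hit = hit
... | no disjoint with d ∸ card Y in d-Y
...   | suc e = ⊥-elim (<⇒≱ heavy (degree-hit H Y capped small hits H≤k disjoint e d-Y))
-- Here |Y| has reached d, so a kept set above `Y` equals `Y`, and the element hitting it hits `Y`.
...   | zero  =
  let (B , B∈ , Y⊆B) = count-pos (Y ⊆ᵇ_) F heavy
      (v , v∈)       = hits B∈
      (v∈H , v∈B)    = x∈p∩q⁻ H B v∈
      B≡Y            = ⊆ᵇ-card-≡ Y B Y⊆B (≤-trans (All.lookup small B∈) (m∸n≡0⇒m≤n d-Y))
  in ⊥-elim (disjoint (v , x∈p∩q⁺ (v∈H , transport (v ∈ˢ_) B≡Y v∈B)))

-- The heaviness test

rows : ∀ {n} → List (Subset n) → List Row
rows = map toList

ones′ : ∀ {n} → List (Subset (suc n)) → List (Subset n)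
ones′ G = map tail (filterᵇ head G)

rows-tails : ∀ {n} (G : List (Subset (suc n))) → tails (rows G) ≡ rows (map tail G)
rows-tails []            = refl
rows-tails ((b ∷ B) ∷ G) = cong (toList B ∷_) (rows-tails G)

rows-ones : ∀ {n} (G : List (Subset (suc n))) → ones (rows G) ≡ rows (ones′ G)
rows-ones []                = refl
rows-ones ((true  ∷ B) ∷ G) = cong (toList B ∷_) (rows-ones G)
rows-ones ((false ∷ B) ∷ G) = rows-ones G

-- The two branches of `walkR` in terms of degrees: deleting a column serves the cores avoiding it,
-- and passing to the rows that contain it serves the cores using it.
degree-outside : ∀ {n} (Y : Subset n) G → degree (false ∷ Y) G ≡ degree Y (map tail G)
degree-outside Y []            = refl
degree-outside Y ((b ∷ B) ∷ G) with Y ⊆ᵇ B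
... | true  = cong suc (degree-outside Y G)
... | false = degree-outside Y G

degree-inside : ∀ {n} (Y : Subset n) G → degree (true ∷ Y) G ≡ degree Y (ones′ G)
degree-inside Y []                = refl
degree-inside Y ((false ∷ B) ∷ G) = degree-inside Y G
degree-inside Y ((true  ∷ B) ∷ G) with Y ⊆ᵇ B
... | true  = cong suc (degree-inside Y G)
... | false = degree-inside Y G

Heavy : ∀ {n} → ℕ → ℕ → Subset n → List (Subset n) → Set
Heavy {n} e k A G = ∃[ Y ] (Y ⊆ᵇ A) ≡ true × card Y ≤ e × threshold k (e ∸ card Y) ≤ degree {n} Y G

∨-true : ∀ {a b} → a ∨ b ≡ true → (a ≡ true) ⊎ (b ≡ true)
∨-true {true}  h = inj₁ refl
∨-true {false} h = inj₂ h

∨-trueʳ : ∀ a {b} → b ≡ true → a ∨ b ≡ true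
∨-trueʳ true  h = refl
∨-trueʳ false h = h

∨-trueˡ : ∀ {a b} → a ≡ true → a ∨ b ≡ true
∨-trueˡ refl = refl

heavy-sound : ∀ e k {n} (A : Subset n) G → heavyR e k (toList A) (rows G) ≡ true → Heavy e k A G
walk-sound  : ∀ e k {n} (A : Subset n) G → walkR e k (toList A) (rows G) ≡ true → Heavy e k A G
heavy-sound e k {n} A G h with ∨-true {threshold k e ≤ᶠ length (rows G)} h
... | inj₁ big = ∅ , ⊆ᵇ-complete ∅ A (λ x∈ → ⊥-elim (∉⊥ x∈)) ,
  ≤-trans (≤-reflexive (∣⊥∣≡0 n)) z≤n ,
  transport (λ m → threshold k (e ∸ m) ≤ degree ∅ G) (sym (∣⊥∣≡0 n))
    (≤-trans (≤ᶠ-sound big) (≤-reflexive (trans (length-map toList G) (sym (degree-∅ G)))))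
... | inj₂ w = walk-sound e k A G w
walk-sound (suc e) k (true ∷ A) G h with ∨-true {heavyR e k (toList A) (ones (rows G))} h
... | inj₁ h′ =
  let (Y , Y⊆A , Y≤e , deg) = heavy-sound e k A (ones′ G) (transport (λ R → heavyR e k (toList A) R ≡ true) (rows-ones G) h′)
  in true ∷ Y , Y⊆A , s≤s Y≤e , ≤-trans deg (≤-reflexive (sym (degree-inside Y G)))
... | inj₂ h′ =
  let (Y , Y⊆A , Y≤e , deg) = walk-sound (suc e) k A (map tail G) (transport (λ R → walkR (suc e) k (toList A) R ≡ true) (rows-tails G) h′)
  in false ∷ Y , Y⊆A , Y≤e , ≤-trans deg (≤-reflexive (sym (degree-outside Y G)))
walk-sound (suc e) k (false ∷ A) G h′ =
  let (Y , Y⊆A , Y≤e , deg) = walk-sound (suc e) k A (map tail G) (transport (λ R → walkR (suc e) k (toList A) R ≡ true) (rows-tails G) h′)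
  in false ∷ Y , Y⊆A , Y≤e , ≤-trans deg (≤-reflexive (sym (degree-outside Y G)))

degree≤length : ∀ {n} (Y : Subset n) G → degree Y G ≤ length G
degree≤length Y []      = z≤n
degree≤length Y (B ∷ G) with Y ⊆ᵇ B
... | true  = s≤s (degree≤length Y G)
... | false = m≤n⇒m≤1+n (degree≤length Y G)

heavy-complete : ∀ e k {n} (A Y : Subset n) G → (Y ⊆ᵇ A) ≡ true → card Y ≤ e →
                 threshold k (e ∸ card Y) ≤ degree Y G → heavyR e k (toList A) (rows G) ≡ true
-- The walk always adds an element to the core. The empty core is caught by the length test of
-- `heavyR`, hence the hypothesis `1 ≤ card Y`.
walk-complete  : ∀ e k {n} (A Y : Subset n) G → (Y ⊆ᵇ A) ≡ true → card Y ≤ suc e → 1 ≤ card Y →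
                 threshold k (suc e ∸ card Y) ≤ degree Y G → walkR (suc e) k (toList A) (rows G) ≡ true
heavy-complete e k A Y G Y⊆A Y≤e deg with card Y in eq
... | zero = ∨-trueˡ (≤ᶠ-complete (≤-trans deg (≤-trans (degree≤length Y G) (≤-reflexive (sym (length-map toList G))))))
heavy-complete (suc e) k A Y G Y⊆A Y≤e deg | suc c =
  ∨-trueʳ (threshold k (suc e) ≤ᶠ length (rows G))
    (walk-complete e k A Y G Y⊆A (≤-trans (≤-reflexive eq) Y≤e) (≤-trans (s≤s z≤n) (≤-reflexive (sym eq)))
      (transport (λ m → threshold k (suc e ∸ m) ≤ degree Y G) (sym eq) deg))
walk-complete e k (true ∷ A) (true ∷ Y) G Y⊆A (s≤s Y≤e) _ deg = ∨-trueˡ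
  (transport (λ R → heavyR e k (toList A) R ≡ true) (sym (rows-ones G))
    (heavy-complete e k A Y (ones′ G) Y⊆A Y≤e (≤-trans deg (≤-reflexive (degree-inside Y G)))))
walk-complete e k (a ∷ A) (false ∷ Y) G Y⊆A Y≤e 1≤Y deg = ∨-trueʳ (a ∧ heavyR e k (toList A) (ones (rows G)))
  (transport (λ R → walkR (suc e) k (toList A) R ≡ true) (sym (rows-tails G))
    (walk-complete e k A Y (map tail G) Y⊆A Y≤e 1≤Y (≤-trans deg (≤-reflexive (degree-outside Y G)))))

-- The greedy subfamily

isHeavy : ∀ {n} → ℕ → ℕ → List (Subset n) → Subset n → Bool
isHeavy d k F A = heavyR d k (toList A) (rows F)

greedy : ∀ {n} → ℕ → ℕ → List (Subset n) → List (Subset n) → List (Subset n)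
greedy d k F []      = F
greedy d k F (A ∷ 𝒜) = greedy d k (if isHeavy d k F A then F else A ∷ F) 𝒜

rows-greedy : ∀ {n} d k (F 𝒜 : List (Subset n)) → rows (greedy d k F 𝒜) ≡ greedyR d k (rows F) (rows 𝒜)
rows-greedy d k F []      = refl
rows-greedy d k F (A ∷ 𝒜) with isHeavy d k F A
... | true  = rows-greedy d k F 𝒜
... | false = rows-greedy d k (A ∷ F) 𝒜

module Greedy {n : ℕ} (d k : ℕ) where

  -- Keeping `A` raises only the degrees of cores `Y ⊆ A`. Had such a core been at its threshold
  -- already, `heavy-complete` would have made the test reject `A`.
  greedy-capped : (F 𝒜 : List (Subset n)) → Capped d k F → Capped d k (greedy d k F 𝒜)
  greedy-capped F []      capped = capped
  greedy-capped F (A ∷ 𝒜) capped with isHeavy d k F A in eq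
  ... | true  = greedy-capped F 𝒜 capped
  ... | false = greedy-capped (A ∷ F) 𝒜 capped′
    where
    capped′ : Capped d k (A ∷ F)
    capped′ Y Y≤d with Y ⊆ᵇ A in Y⊆A
    ... | false = capped Y Y≤d
    ... | true  = ≰⇒> (λ deg → true≢false (trans (sym (heavy-complete d k A Y F Y⊆A Y≤d deg)) eq))
      where
      true≢false : true ≢ false
      true≢false ()

  greedy-⊇ : ∀ (F 𝒜 : List (Subset n)) {B} → B ∈ F → B ∈ greedy d k F 𝒜
  greedy-⊇ F []      B∈ = B∈
  greedy-⊇ F (A ∷ 𝒜) B∈ with isHeavy d k F A
  ... | true  = greedy-⊇ F 𝒜 B∈
  ... | false = greedy-⊇ (A ∷ F) 𝒜 (there B∈)

  greedy-⊆ : ∀ (F 𝒜 : List (Subset n)) {B} → B ∈ greedy d k F 𝒜 → B ∈ F ⊎ B ∈ 𝒜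
  greedy-⊆ F []      B∈ = inj₁ B∈
  greedy-⊆ F (A ∷ 𝒜) B∈ with isHeavy d k F A
  ... | true  with greedy-⊆ F 𝒜 B∈
  ...   | inj₁ B∈F = inj₁ B∈F
  ...   | inj₂ B∈𝒜 = inj₂ (there B∈𝒜)
  greedy-⊆ F (A ∷ 𝒜) B∈ | false with greedy-⊆ (A ∷ F) 𝒜 B∈
  ...   | inj₁ (here refl) = inj₂ (here refl)
  ...   | inj₁ (there B∈F) = inj₁ B∈F
  ...   | inj₂ B∈𝒜 = inj₂ (there B∈𝒜)

  greedy-degree : ∀ (F 𝒜 : List (Subset n)) Y → degree Y F ≤ degree Y (greedy d k F 𝒜)
  greedy-degree F []      Y = ≤-refl
  greedy-degree F (A ∷ 𝒜) Y with isHeavy d k F A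
  ... | true  = greedy-degree F 𝒜 Y
  ... | false = ≤-trans (count-∷-≤ (Y ⊆ᵇ_) A F) (greedy-degree (A ∷ F) 𝒜 Y)

  -- The core found when `A` is dropped stays heavy, because later steps only add sets and so only
  -- increase degrees.
  greedy-covers : ∀ (F 𝒜 : List (Subset n)) {A} → A ∈ 𝒜 →
                  A ∈ greedy d k F 𝒜 ⊎ Heavy d k A (greedy d k F 𝒜)
  greedy-covers F (A ∷ 𝒜) (here refl) with isHeavy d k F A in eq
  ... | false = inj₁ (greedy-⊇ (A ∷ F) 𝒜 (here refl))
  ... | true  = let (Y , Y⊆A , Y≤d , deg) = heavy-sound d k A F eq in
    inj₂ (Y , Y⊆A , Y≤d , ≤-trans deg (greedy-degree F 𝒜 Y))
  greedy-covers F (A ∷ 𝒜) (there A∈) = greedy-covers _ 𝒜 A∈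

  -- `B ≢ B` is absurd, so the last hypothesis says that kept and pending sets are disjoint; this is
  -- the invariant of the induction.
  greedy-unique : ∀ (F 𝒜 : List (Subset n)) → Unique F → Unique 𝒜 →
                  (∀ {B} → B ∈ F → B ∈ 𝒜 → B ≢ B) → Unique (greedy d k F 𝒜)
  greedy-unique F []      uF u𝒜 apart = uF
  greedy-unique F (A ∷ 𝒜) uF (A∉ ∷ u𝒜) apart with isHeavy d k F A
  ... | true  = greedy-unique F 𝒜 uF u𝒜 (λ B∈F B∈𝒜 → apart B∈F (there B∈𝒜))
  ... | false = greedy-unique (A ∷ F) 𝒜
    (All.tabulate (λ { B∈F refl → apart B∈F (here refl) refl }) ∷ uF) u𝒜
    (λ { (here refl) B∈𝒜 _ → All.lookup A∉ B∈𝒜 refl ; (there B∈F) B∈𝒜 → apart B∈F (there B∈𝒜) })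

  greedy-length : ∀ (F 𝒜 : List (Subset n)) → length (greedy d k F 𝒜) ≤ length F + length 𝒜
  greedy-length F []      = m≤m+n _ _
  greedy-length F (A ∷ 𝒜) with isHeavy d k F A
  ... | true  = ≤-trans (greedy-length F 𝒜) (+-monoʳ-≤ (length F) (n≤1+n _))
  ... | false = ≤-trans (greedy-length (A ∷ F) 𝒜) (≤-reflexive (sym (+-suc _ _)))

  -- Two lists end in two copies of `nil`, their merger in one; this is the `suc` on the left. For
  -- empty `F`, whose code is a single node, it cancels.
  greedy-size : ∀ (F 𝒜 : List (Subset n)) →
                suc (sizeᵗ (listᵗ rowᵗ) (rows (greedy d k F 𝒜)))
                ≤ sizeᵗ (listᵗ rowᵗ) (rows F) + sizeᵗ (listᵗ rowᵗ) (rows 𝒜)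
  greedy-size F []      = ≤-reflexive (+-comm 1 _)
  greedy-size F (A ∷ 𝒜) with isHeavy d k F A
  ... | true  = ≤-trans (greedy-size F 𝒜) (+-monoʳ-≤ _ (m≤n⇒m≤1+n (m≤n+m _ (sizeᵗ rowᵗ (toList A)))))
  ... | false = ≤-trans (greedy-size (A ∷ F) 𝒜) (≤-reflexive (lemma (sizeᵗ rowᵗ (toList A)) (sizeᵗ (listᵗ rowᵗ) (rows F)) _))
    where
    lemma : ∀ x y z → (1 + (x + y)) + z ≡ y + suc (x + z)
    lemma = solve-∀

-- A geometric sum of e + 1 terms, each at most k^e for positive k.
threshold≤ : ∀ k e → 1 ≤ k → threshold k e ≤ suc e * k ^ e
threshold≤ k zero    1≤k = ≤-refl
threshold≤ k (suc e) 1≤k = begin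
  1 + k * threshold k e           ≤⟨ +-mono-≤ (m^n>0′ (suc e)) (*-monoʳ-≤ k (threshold≤ k e 1≤k)) ⟩
  k ^ suc e + k * (suc e * k ^ e) ≡⟨ lemma k (suc e) (k ^ e) ⟩
  suc (suc e) * k ^ suc e         ∎
  where
  open ≤-Reasoning
  m^n>0′ : ∀ e → 1 ≤ k ^ e
  m^n>0′ zero    = ≤-refl
  m^n>0′ (suc e) = *-mono-≤ 1≤k (m^n>0′ e)
  lemma : ∀ k s p → k * p + k * (s * p) ≡ suc s * (k * p)
  lemma = solve-∀

-- The left side is k + ... + k^(d + 1), the most that a solvable family can contain;
-- `family-hittable` combines the two facts.
k*threshold≤capacity : ∀ d k → k * threshold k d ≤ capacity (suc d) k
k*threshold≤capacity d zero    = z≤n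
k*threshold≤capacity d k@(suc _) = begin
  k * threshold k d          ≤⟨ *-monoʳ-≤ k (threshold≤ k d (s≤s z≤n)) ⟩
  k * (suc d * k ^ d)        ≡⟨ lemma k (suc d) (k ^ d) ⟩
  suc d * 1 * (k * k ^ d)    ≤⟨ *-monoˡ-≤ (k * k ^ d) (*-monoʳ-≤ (suc d) (1≤n! (suc d))) ⟩
  suc d * (suc d) ! * k ^ suc d ≤⟨ m≤n⊔m 1 _ ⟩
  capacity (suc d) k         ∎
  where
  open ≤-Reasoning
  lemma : ∀ k s p → k * (s * p) ≡ s * 1 * (k * p)
  lemma = solve-∀

-- With D = 2 + d, this is D + 1 ≤ 2 · D together with 2 ≤ D!. The shift by two matters: for D = 1
-- and positive k the sides would be k + 1 and k.
threshold≤capacity : ∀ d k → threshold k (2 + d) ≤ capacity (2 + d) k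
threshold≤capacity d zero      = m≤m⊔n 1 ((2 + d) * (2 + d) ! * 0)
threshold≤capacity d k@(suc _) = begin
  threshold k D       ≤⟨ threshold≤ k D (s≤s z≤n) ⟩
  suc D * k ^ D       ≤⟨ *-monoˡ-≤ (k ^ D) (s≤s (m≤m+n D (suc d))) ⟩
  suc (D + suc d) * k ^ D
                      ≡⟨ cong (_* k ^ D) (lemma d) ⟩
  D * 2 * k ^ D       ≤⟨ *-monoˡ-≤ (k ^ D) (*-monoʳ-≤ D (*-mono-≤ (s≤s (s≤s (z≤n {d}))) (1≤n! (suc d)))) ⟩
  D * D ! * k ^ D     ≤⟨ m≤n⊔m 1 _ ⟩
  capacity D k        ∎
  where
  open ≤-Reasoning
  D : ℕ
  D = 2 + d
  lemma : ∀ d → 1 + (2 + d + suc d) ≡ (2 + d) * 2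
  lemma = solve-∀

-- Deleting the unused elements

used : ∀ {n} → List (Subset n) → Subset n
used {zero}  G = []
used {suc n} G = anyHead (rows G) ∷ used (map tail G)

rows-used : ∀ {n} (G : List (Subset n)) → toList (used G) ≡ usedR n (rows G)
rows-used {zero}  G = refl
rows-used {suc n} G = cong (anyHead (rows G) ∷_)
  (trans (rows-used (map tail G)) (cong (usedR n) (sym (rows-tails G))))

card-countTrue : ∀ {n} (p : Subset n) → card p ≡ countTrue (toList p)
card-countTrue []          = refl
card-countTrue (true  ∷ p) = cong suc (card-countTrue p)
card-countTrue (false ∷ p) = card-countTrue p

∈-used : ∀ {n} {G : List (Subset n)} {B x} → B ∈ G → x ∈ˢ B → x ∈ˢ used G
∈-used {G = G} {b ∷ B} B∈ (there x∈) = there (∈-used (∈-map⁺ tail B∈) x∈)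
∈-used {G = G} {true ∷ B} B∈ here = transport (λ b → zero ∈ˢ (b ∷ used (map tail G))) (sym (any B∈)) here
  where
  any : ∀ {G} → (true ∷ B) ∈ G → anyHead (rows G) ≡ true
  any (here refl)              = refl
  any {(_ ∷ _) ∷ _} (there B∈) = ∨-trueʳ _ (any B∈)

total : ∀ {n} → List (Subset n) → ℕ
total []      = 0
total (A ∷ G) = card A + total G

total-tails : ∀ {n} (G : List (Subset (suc n))) → total (map tail G) ≤ total G
total-tails []                = z≤n
total-tails ((true  ∷ A) ∷ G) = m≤n⇒m≤1+n (+-monoʳ-≤ (card A) (total-tails G))
total-tails ((false ∷ A) ∷ G) = +-monoʳ-≤ (card A) (total-tails G)

total-anyHead : ∀ {n} (G : List (Subset (suc n))) → anyHead (rows G) ≡ true → suc (total (map tail G)) ≤ total G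
total-anyHead ((true  ∷ A) ∷ G) h = s≤s (+-monoʳ-≤ (card A) (total-tails G))
total-anyHead ((false ∷ A) ∷ G) h = ≤-trans (≤-reflexive (sym (+-suc (card A) _))) (+-monoʳ-≤ (card A) (total-anyHead G h))

-- Each used element is charged to one incidence in its column.
card-used : ∀ {n} (G : List (Subset n)) → card (used G) ≤ total G
card-used {zero}  G = z≤n
card-used {suc n} G with anyHead (rows G) in eq
... | true  = ≤-trans (s≤s (card-used (map tail G))) (total-anyHead G eq)
... | false = ≤-trans (card-used (map tail G)) (total-tails G)

total≤ : ∀ {n d} (G : List (Subset n)) → All (λ A → card A ≤ d) G → total G ≤ length G * d
total≤ []      []       = z≤n
total≤ (A ∷ G) (A≤ ∷ s) = +-mono-≤ A≤ (total≤ G s)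

restrict : ∀ {n} (M A : Subset n) → Subset (card M)
restrict []          []      = []
restrict (true  ∷ M) (a ∷ A) = a ∷ restrict M A
restrict (false ∷ M) (a ∷ A) = restrict M A

rank : ∀ {n} {M : Subset n} {x} → x ∈ˢ M → Fin (card M)
rank {M = true  ∷ M} here       = zero
rank {M = true  ∷ M} (there x∈) = suc (rank x∈)
rank {M = false ∷ M} (there x∈) = rank x∈

rank-∈ : ∀ {n} {M : Subset n} {A x} (x∈ : x ∈ˢ M) → x ∈ˢ A → rank x∈ ∈ˢ restrict M A
rank-∈ {M = true  ∷ M} here       here       = here
rank-∈ {M = true  ∷ M} (there x∈) (there x∈A) = there (rank-∈ x∈ x∈A)
rank-∈ {M = false ∷ M} (there x∈) (there x∈A) = rank-∈ x∈ x∈A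

extendBy : ∀ {n} (M : Subset n) → Subset (card M) → Subset n
extendBy []          H       = []
extendBy (true  ∷ M) (h ∷ H) = h ∷ extendBy M H
extendBy (false ∷ M) H       = false ∷ extendBy M H

card-extendBy : ∀ {n} (M : Subset n) H → card (extendBy M H) ≡ card H
card-extendBy []          []          = refl
card-extendBy (true  ∷ M) (true  ∷ H) = cong suc (card-extendBy M H)
card-extendBy (true  ∷ M) (false ∷ H) = card-extendBy M H
card-extendBy (false ∷ M) H           = card-extendBy M H

extendBy-hits : ∀ {n} (M : Subset n) H B → Nonempty (H ∩ restrict M B) → Nonempty (extendBy M H ∩ B)
extendBy-hits []          []          []          h = h
extendBy-hits (true  ∷ M) (true  ∷ H) (true  ∷ B) h = zero , here
extendBy-hits (true  ∷ M) (true  ∷ H) (false ∷ B) (suc x , there x∈) = let (y , y∈) = extendBy-hits M H B (x , x∈) in suc y , there y∈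
extendBy-hits (true  ∷ M) (false ∷ H) (b ∷ B) (suc x , there x∈) = let (y , y∈) = extendBy-hits M H B (x , x∈) in suc y , there y∈
extendBy-hits (false ∷ M) H           (b ∷ B) h = let (y , y∈) = extendBy-hits M H B h in suc y , there y∈

card-restrict : ∀ {n} (M A : Subset n) → card (restrict M A) ≤ card A
card-restrict []          []          = z≤n
card-restrict (true  ∷ M) (true  ∷ A) = s≤s (card-restrict M A)
card-restrict (true  ∷ M) (false ∷ A) = card-restrict M A
card-restrict (false ∷ M) (true  ∷ A) = m≤n⇒m≤1+n (card-restrict M A)
card-restrict (false ∷ M) (false ∷ A) = card-restrict M A

-- Positions outside `M` are empty in both sets, so deleting them loses nothing. This keeps the
-- trimmed family free of repetitions.
restrict-injective : ∀ {n} (M A B : Subset n) → (∀ {x} → x ∈ˢ A → x ∈ˢ M) → (∀ {x} → x ∈ˢ B → x ∈ˢ M) →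
                     restrict M A ≡ restrict M B → A ≡ B
restrict-injective []          []          []          A⊆ B⊆ eq = refl
restrict-injective (true  ∷ M) (a     ∷ A) (b     ∷ B) A⊆ B⊆ eq = cong₂ _∷_
  (cong Data.Vec.Base.head eq) (restrict-injective M A B (λ x∈ → drop (A⊆ (there x∈))) (λ x∈ → drop (B⊆ (there x∈))) (cong tail eq))
  where
  drop : ∀ {x} → suc x ∈ˢ (true ∷ M) → x ∈ˢ M
  drop (there x∈) = x∈
restrict-injective (false ∷ M) (true  ∷ A) (b     ∷ B) A⊆ B⊆ eq with A⊆ here
... | ()
restrict-injective (false ∷ M) (false ∷ A) (true  ∷ B) A⊆ B⊆ eq with B⊆ here
... | ()
restrict-injective (false ∷ M) (false ∷ A) (false ∷ B) A⊆ B⊆ eq = cong (false ∷_)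
  (restrict-injective M A B (λ x∈ → drop (A⊆ (there x∈))) (λ x∈ → drop (B⊆ (there x∈))) eq)
  where
  drop : ∀ {x} → suc x ∈ˢ (false ∷ M) → x ∈ˢ M
  drop (there x∈) = x∈

restrict-unique : ∀ {n} (M : Subset n) (G : List (Subset n)) → (∀ {A x} → A ∈ G → x ∈ˢ A → x ∈ˢ M) →
                  Unique G → Unique (map (restrict M) G)
restrict-unique M []      G⊆ []       = []
restrict-unique M (A ∷ G) G⊆ (A∉ ∷ u) =
  All.map⁺ (All.tabulate (λ {B} B∈ eq →
    All.lookup A∉ B∈ (restrict-injective M A B (G⊆ (here refl)) (G⊆ (there B∈)) eq)))
  ∷ restrict-unique M G (G⊆ ∘ there) u

toList-restrict : ∀ {n} (M A : Subset n) → toList (restrict M A) ≡ restrictR (toList M) (toList A)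
toList-restrict []          []      = refl
toList-restrict (true  ∷ M) (a ∷ A) = cong (a ∷_) (toList-restrict M A)
toList-restrict (false ∷ M) (a ∷ A) = toList-restrict M A

size-restrict : ∀ {n} (M A : Subset n) → sizeᵗ rowᵗ (toList (restrict M A)) ≤ sizeᵗ rowᵗ (toList A)
size-restrict []          []      = ≤-refl
size-restrict (true  ∷ M) (a ∷ A) = s≤s (+-monoʳ-≤ (sizeᵗ boolᵗ a) (size-restrict M A))
size-restrict (false ∷ M) (a ∷ A) = m≤n⇒m≤1+n (≤-trans (size-restrict M A) (m≤n+m _ (sizeᵗ boolᵗ a)))

size-rows-restrict : ∀ {n} (M : Subset n) G → sizeᵗ (listᵗ rowᵗ) (rows (map (restrict M) G)) ≤ sizeᵗ (listᵗ rowᵗ) (rows G)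
size-rows-restrict M []      = ≤-refl
size-rows-restrict M (A ∷ G) = s≤s (+-mono-≤ (size-restrict M A) (size-rows-restrict M G))

rows-restrict : ∀ {n} (G F : List (Subset n)) →
                rows (map (restrict (used G)) F) ≡ map (restrictR (usedR n (rows G))) (rows F)
rows-restrict G []      = refl
rows-restrict G (A ∷ F) = cong₂ _∷_
  (trans (toList-restrict (used G) A) (cong (λ M → restrictR M (toList A)) (rows-used G))) (rows-restrict G F)

-- Sizes of coded instances

sizeℕ : ∀ m → sizeᵗ natᵗ m ≡ suc (2 * m)
sizeℕ zero    = refl
sizeℕ (suc m) = trans (cong (2 +_) (sizeℕ m)) (lemma m)
  where
  lemma : ∀ m → 3 + 2 * m ≡ suc (2 * suc m)
  lemma = solve-∀

size-row : ∀ {n} (A : Subset n) → sizeᵗ rowᵗ (toList A) ≤ suc (4 * n)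
size-row {zero}  []      = ≤-refl
size-row {suc n} (a ∷ A) = ≤-trans (s≤s (+-mono-≤ (size-bool a) (size-row A))) (≤-reflexive (cong suc (sym (*-suc 4 n))))

size-rows : ∀ {n} (G : List (Subset n)) → sizeᵗ (listᵗ rowᵗ) (rows G) ≤ suc (length G * (2 + 4 * n))
size-rows     []      = ≤-refl
size-rows {n} (A ∷ G) = ≤-trans (s≤s (+-mono-≤ (size-row A) (size-rows G))) (≤-reflexive (cong (2 +_) (+-suc (4 * n) _)))

sizeℕ-mono : ∀ {m n} → m ≤ n → sizeᵗ natᵗ m ≤ sizeᵗ natᵗ n
sizeℕ-mono z≤n       = 1≤treeSize _
sizeℕ-mono (s≤s m≤n) = s≤s (s≤s (sizeℕ-mono m≤n))

codeList-map : {A : Set} (a : Ty) (f : A → El a) (xs : List A) →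
               codeᵗ (listᵗ a) (map f xs) ≡ codeList (codeᵗ a ∘ f) xs
codeList-map a f []       = refl
codeList-map a f (x ∷ xs) = cong (codeᵗ a (f x) ∙_) (codeList-map a f xs)

-- The kernelization

capacity≥1 : ∀ d m → 1 ≤ capacity d m
capacity≥1 d m = m≤m⊔n 1 (d * d ! * m ^ d)

module _ {d : ℕ} where

  matrix : HSInstance d → Matrix
  matrix x = (n x , rows (𝒜 x)) , k x

  hypergraphᵗ : Ty
  hypergraphᵗ = natᵗ ×ᵗ listᵗ rowᵗ

  code-hypergraph : ∀ (x : HSInstance d) → codeᵗ hypergraphᵗ (n x , rows (𝒜 x)) ≡ codeHypergraph x
  code-hypergraph x = cong (codeℕ (n x) ∙_) (codeList-map rowᵗ toList (𝒜 x))

  code-matrix : ∀ (x : HSInstance d) → codeᵗ matrixᵗ (matrix x) ≡ ParamProblem.code (HittingSet d) x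
  code-matrix x = cong (_∙ codeℕ (k x)) (code-hypergraph x)

  size-hypergraph : ∀ (x : HSInstance d) → ParamProblem.size (HittingSet d) x ≡ suc (sizeᵗ natᵗ (n x) + sizeᵗ (listᵗ rowᵗ) (rows (𝒜 x)))
  size-hypergraph x = cong treeSize (sym (code-hypergraph x))

  -- The code holds k in unary, as a tree of 2 · k + 1 nodes, while `PolyTime` measures |x| + k. The
  -- inner polynomial 2 + 2 · X converts between the two.
  polyTime : (f : HSInstance d → HSInstance d) (g : Matrix → Matrix) → PT matrixᵗ matrixᵗ g →
             (∀ x → matrix (f x) ≡ g (matrix x)) → PolyTime (HittingSet d) f
  polyTime f g p f≡g = prog p , toPoly (timeBound p :∘ (K 2 :+ K 2 :* X)) , λ x →
    let (c , run , c≤) = runs p (matrix x) in c ,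
    transport (λ s → prog p ⊢ s ⇓ code (f x) # c) (code-matrix x)
      (transport (λ t → prog p ⊢ codeᵗ matrixᵗ (matrix x) ⇓ t # c)
                 (trans (cong (codeᵗ matrixᵗ) (sym (f≡g x))) (code-matrix (f x))) run) ,
    ≤-trans c≤ (≤-trans (⟦⟧-mono (timeBound p) (size≤ x)) (≤-reflexive (sym (eval-toPoly (timeBound p :∘ (K 2 :+ K 2 :* X)) (size x + k x)))))
    where
    open ParamProblem (HittingSet d) using (size; code)
    open ≤-Reasoning
    size≤ : ∀ x → sizeᵗ matrixᵗ (matrix x) ≤ 2 + 2 * (size x + k x)
    size≤ x = begin
      suc (sizeᵗ hypergraphᵗ (n x , rows (𝒜 x)) + sizeᵗ natᵗ (k x))
        ≡⟨ cong₂ (λ t m → suc (t + m)) (cong treeSize (code-hypergraph x)) (sizeℕ (k x)) ⟩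
      suc (size x + suc (2 * k x))
        ≤⟨ m≤m+n _ (size x) ⟩
      suc (size x + suc (2 * k x)) + size x
        ≡⟨ lemma (size x) (k x) ⟩
      2 + 2 * (size x + k x) ∎
      where
      lemma : ∀ s p → (1 + (s + suc (2 * p))) + s ≡ 2 + 2 * (s + p)
      lemma = solve-∀

module HittingSetKernel (d′ : ℕ) where

  d : ℕ
  d = suc d′

  L : ParamProblem
  L = HittingSet d

  open ParamProblem L using (size; Yes)

  family : (x : HSInstance d) → List (Subset (n x))
  family x = greedy d (k x) [] (𝒜 x)

  module _ (x : HSInstance d) where
    open Greedy {n x} d (k x)

    family-⊆ : ∀ {B} → B ∈ family x → B ∈ 𝒜 x
    family-⊆ B∈ with greedy-⊆ [] (𝒜 x) B∈
    ... | inj₂ B∈𝒜 = B∈𝒜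

    family-small : All (λ B → card B ≤ d) (family x)
    family-small = All.tabulate (λ B∈ → All.lookup (card≤d x) (family-⊆ B∈))

    family-unique : Unique (family x)
    family-unique = greedy-unique [] (𝒜 x) [] (distinct x) (λ ())

    family-capped : Capped d (k x) (family x)
    family-capped = greedy-capped [] (𝒜 x) (λ Y Y≤d → z≤n)

    family-length : length (family x) ≤ length (𝒜 x)
    family-length = greedy-length [] (𝒜 x)

    family-hits : ∀ H → card H ≤ k x → Hits H (family x) → Hits H (𝒜 x)
    family-hits H H≤k hits {A} A∈ with greedy-covers [] (𝒜 x) A∈
    ... | inj₁ A∈F = hits A∈F
    ... | inj₂ (Y , Y⊆A , Y≤d , deg) =
      let (v , v∈) = core-hit H Y family-capped family-small hits H≤k Y≤d deg
          (v∈H , v∈Y) = x∈p∩q⁻ H Y v∈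
      in v , x∈p∩q⁺ (v∈H , ⊆ᵇ-sound Y A Y⊆A v∈Y)

    family-size : sizeᵗ (listᵗ rowᵗ) (rows (family x)) ≤ sizeᵗ (listᵗ rowᵗ) (rows (𝒜 x))
    family-size with greedy-size [] (𝒜 x)
    ... | s≤s h = h

    -- The empty core is disjoint from every `H` and lies below every set, so `degree-hit` bounds
    -- the whole family by k · `threshold` k d′, one less than the cap.
    family-hittable : Yes x → length (family x) ≤ capacity d (k x)
    family-hittable (H , H≤k , hits) = begin
      length (family x)         ≡⟨ degree-∅ (family x) ⟨
      degree ∅ (family x)       ≤⟨ degree-hit H ∅ family-capped family-small (λ B∈ → All.lookup hits (family-⊆ B∈)) H≤k
                                     (λ (v , v∈) → ∉⊥ (proj₂ (x∈p∩q⁻ H ∅ v∈))) d′ (cong (d ∸_) (∣⊥∣≡0 (n x))) ⟩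
      k x * threshold (k x) d′  ≤⟨ k*threshold≤capacity d′ (k x) ⟩
      capacity d (k x)          ∎
      where open ≤-Reasoning

  trim : HSInstance d → HSInstance d
  trim x = record
    { n        = card (used (family x))
    ; 𝒜        = map (restrict (used (family x))) (family x)
    ; k        = k x
    ; card≤d   = All.map⁺ (All.map (λ {A} A≤d → ≤-trans (card-restrict (used (family x)) A) A≤d) (family-small x))
    ; distinct = restrict-unique (used (family x)) (family x) ∈-used (family-unique x)
    }

  -- The empty set as sole member cannot be hit, whatever the parameter. The parameter is kept
  -- because the size bound refers to it.
  unsolvable : ℕ → HSInstance d
  unsolvable m = record { n = 0 ; 𝒜 = [] ∷ [] ; k = m ; card≤d = z≤n ∷ [] ; distinct = [] ∷ [] }

  -- Stated on rows so that it is literally the test run by `reduceR`: one case distinction then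
  -- settles both sides of `matrix-kernel`.
  fewSets : HSInstance d → Bool
  fewSets x = length (greedyR d (k x) [] (rows (𝒜 x))) ≤ᶠ capacity d (k x)

  reduce : HSInstance d → HSInstance d
  reduce x = if fewSets x then trim x else unsolvable (k x)

  kernelHS : HSInstance d → HSInstance d
  kernelHS x = if withinBounds d (matrix x) then x else reduce x

  length-rows-family : ∀ x → length (greedyR d (k x) [] (rows (𝒜 x))) ≡ length (family x)
  length-rows-family x = trans (cong length (sym (rows-greedy d (k x) [] (𝒜 x)))) (length-map toList (family x))

  fewSets-sound : ∀ x → fewSets x ≡ true → length (family x) ≤ capacity d (k x)
  fewSets-sound x h = ≤-trans (≤-reflexive (sym (length-rows-family x))) (≤ᶠ-sound h)

  fewSets-complete : ∀ x → length (family x) ≤ capacity d (k x) → fewSets x ≡ true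
  fewSets-complete x h = ≤ᶠ-complete (≤-trans (≤-reflexive (length-rows-family x)) h)

  matrix-trim : ∀ x → matrix (trim x) ≡ (trimR (n x , greedyR d (k x) [] (rows (𝒜 x))) , k x)
  matrix-trim x = cong (_, k x) (cong₂ _,_
    (trans (card-countTrue (used F)) (cong countTrue (trans (rows-used F) (cong (usedR (n x)) F≡))))
    (trans (rows-restrict F F) (cong (λ G → map (restrictR (usedR (n x) G)) G) F≡)))
    where
    F : List (Subset (n x))
    F = family x
    F≡ : rows F ≡ greedyR d (k x) [] (rows (𝒜 x))
    F≡ = rows-greedy d (k x) [] (𝒜 x)

  matrix-kernel : ∀ x → matrix (kernelHS x) ≡ kernelR d (matrix x)
  matrix-kernel x with withinBounds d (matrix x)
  ... | true  = refl
  ... | false with fewSets x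
  ...   | true  = matrix-trim x
  ...   | false = refl

  k-kernel : ∀ x → k (kernelHS x) ≡ k x
  k-kernel x with withinBounds d (matrix x)
  ... | true  = refl
  ... | false with fewSets x
  ...   | true  = refl
  ...   | false = refl

  Within : HSInstance d → Set
  Within x = length (𝒜 x) ≤ capacity d (k x) × n x ≤ d * capacity d (k x)

  within-sound : ∀ x → withinBounds d (matrix x) ≡ true → Within x
  within-sound x h with length (rows (𝒜 x)) ≤ᶠ capacity d (k x) in eq
  ... | true = ≤-trans (≤-reflexive (sym (length-map toList (𝒜 x)))) (≤ᶠ-sound eq) , ≤ᶠ-sound h

  within-complete : ∀ x → Within x → withinBounds d (matrix x) ≡ true
  within-complete x (few , narrow) =
    trans (cong (_∧ (n x ≤ᶠ d * capacity d (k x)))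
                (≤ᶠ-complete (≤-trans (≤-reflexive (length-map toList (𝒜 x))) few)))
          (≤ᶠ-complete narrow)

  kernel-within : ∀ x → Within (kernelHS x)
  kernel-within x with withinBounds d (matrix x) in eq
  ... | true  = within-sound x eq
  ... | false with fewSets x in eq′
  ...   | false = capacity≥1 d (k x) , z≤n
  ...   | true  = ≤-trans (≤-reflexive (length-map _ (family x))) few ,
    (begin
      card (used (family x))      ≤⟨ card-used (family x) ⟩
      total (family x)            ≤⟨ total≤ (family x) (family-small x) ⟩
      length (family x) * d       ≡⟨ *-comm _ d ⟩
      d * length (family x)       ≤⟨ *-monoʳ-≤ d few ⟩
      d * capacity d (k x)        ∎)
    where
    open ≤-Reasoning
    few : length (family x) ≤ capacity d (k x)
    few = fewSets-sound x eq′

  kernel-fixes : ∀ x → withinBounds d (matrix x) ≡ true → kernelHS x ≡ x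
  kernel-fixes x eq rewrite eq = refl

  -- The result lies within the bounds, where the rule is the identity. This limits chains to one
  -- step and makes the kernel irreducible.
  kernel-idem : ∀ x → kernelHS (kernelHS x) ≡ kernelHS x
  kernel-idem x = kernel-fixes (kernelHS x) (within-complete (kernelHS x) (kernel-within x))

  kernel-moves : ∀ x → withinBounds d (matrix x) ≡ false → kernelHS x ≢ x
  kernel-moves x eq fixed with trans (sym eq) (within-complete x (transport Within fixed (kernel-within x)))
  ... | ()

  trim-equivalent : ∀ x → Yes x ⇔ Yes (trim x)
  trim-equivalent x = mk⇔
    (λ (H , H≤k , hits) → restrict M H , ≤-trans (card-restrict M H) H≤k ,
      All.map⁺ (All.tabulate (λ {B} B∈ →
        let (v , v∈) = All.lookup hits (family-⊆ x B∈)
            (v∈H , v∈B) = x∈p∩q⁻ H B v∈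
            v∈M = ∈-used B∈ v∈B
        in rank v∈M , x∈p∩q⁺ (rank-∈ v∈M v∈H , rank-∈ v∈M v∈B))))
    (λ (H , H≤k , hits) →
      let H≤k′ = ≤-trans (≤-reflexive (card-extendBy M H)) H≤k in
      extendBy M H , H≤k′ ,
      All.tabulate (family-hits x (extendBy M H) H≤k′
        (λ {B} B∈ → extendBy-hits M H B (All.lookup (All.map⁻ hits) B∈))))
    where
    M : Subset (n x)
    M = used (family x)

  unsolvable-no : ∀ m → ¬ Yes (unsolvable m)
  unsolvable-no m ([] , _ , ((() , _) ∷ _))

  kernel-equivalent : ∀ x → Yes x ⇔ Yes (kernelHS x)
  kernel-equivalent x with withinBounds d (matrix x)
  ... | true  = mk⇔ id id
  ... | false with fewSets x in eq
  ...   | true  = trim-equivalent x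
  ...   | false = mk⇔ (λ yes → ⊥-elim (true≢false (trans (sym (fewSets-complete x (family-hittable x yes))) eq)))
                      (λ yes → ⊥-elim (unsolvable-no (k x) yes))
    where
    true≢false : true ≢ false
    true≢false ()

  kernel-nonIncrease : ∀ x → size (kernelHS x) ≤ size x
  kernel-nonIncrease x with withinBounds d (matrix x)
  ... | true  = ≤-refl
  ... | false with fewSets x in eq
  ...   | true  = begin
    size (trim x)
      ≡⟨ size-hypergraph (trim x) ⟩
    suc (sizeᵗ natᵗ (card (used (family x))) + sizeᵗ (listᵗ rowᵗ) (rows (𝒜 (trim x))))
      ≤⟨ s≤s (+-mono-≤ (sizeℕ-mono (∣p∣≤n (used (family x))))
                       (≤-trans (size-rows-restrict (used (family x)) (family x)) (family-size x))) ⟩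
    suc (sizeᵗ natᵗ (n x) + sizeᵗ (listᵗ rowᵗ) (rows (𝒜 x)))
      ≡⟨ size-hypergraph x ⟨
    size x ∎
    where open ≤-Reasoning
  -- The family of `unsolvable` is coded with 3 nodes. The original family needs at least as many
  -- because it is nonempty: an empty one would have passed `fewSets`.
  ...   | false = ≤-trans (s≤s (+-mono-≤ (1≤treeSize (codeℕ (n x))) (nonempty (𝒜 x) refl)))
                          (≤-reflexive (sym (size-hypergraph x)))
    where
    nonempty : ∀ G → 𝒜 x ≡ G → 3 ≤ sizeᵗ (listᵗ rowᵗ) (rows G)
    nonempty (A ∷ G) _ = s≤s (+-mono-≤ (1≤treeSize (codeᵗ rowᵗ (toList A))) (1≤treeSize (codeᵗ (listᵗ rowᵗ) (rows G))))
    nonempty []      empty with trans (sym (fewSets-complete x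
      (≤-trans (family-length x) (≤-trans (≤-reflexive (cong length empty)) z≤n)))) eq
    ... | ()

  kernelPolyTime : PolyTime L kernelHS
  kernelPolyTime = polyTime kernelHS (kernelR d) (kernelᴾ d) matrix-kernel

  rule : DataReductionRule L
  rule = record
    { apply = kernelHS ; polyTime = kernelPolyTime
    ; equivalent = kernel-equivalent ; nonIncrease = kernel-nonIncrease }

  kernel-bound : ℕ → ℕ
  kernel-bound m = suc (suc (2 * (d * c)) + suc (c * (2 + 4 * (d * c)))) + m
    where
    c : ℕ
    c = capacity d m

  kernel-bounded : ∀ x → size (kernelHS x) + k (kernelHS x) ≤ kernel-bound (k x)
  kernel-bounded x = transport (λ m → size y + k y ≤ kernel-bound m) (k-kernel x)
    (+-monoˡ-≤ (k y) (begin
      size y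
        ≡⟨ size-hypergraph y ⟩
      suc (sizeᵗ natᵗ (n y) + sizeᵗ (listᵗ rowᵗ) (rows (𝒜 y)))
        ≤⟨ s≤s (+-mono-≤ (≤-reflexive (sizeℕ (n y))) (size-rows (𝒜 y))) ⟩
      suc (suc (2 * n y) + suc (length (𝒜 y) * (2 + 4 * n y)))
        ≤⟨ s≤s (+-mono-≤ (s≤s (*-monoʳ-≤ 2 narrow)) (s≤s (*-mono-≤ few (+-monoʳ-≤ 2 (*-monoʳ-≤ 4 narrow))))) ⟩
      suc (suc (2 * (d * c)) + suc (c * (2 + 4 * (d * c)))) ∎))
    where
    open ≤-Reasoning
    y : HSInstance d
    y = kernelHS x
    c : ℕ
    c = capacity d (k y)
    few : length (𝒜 y) ≤ c
    few = proj₁ (kernel-within x)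
    narrow : n y ≤ d * c
    narrow = proj₂ (kernel-within x)

  kernel-reached : ∀ x → ∃[ ℓ ] Chain L (rule ∷ []) x ℓ (kernelHS x)
  kernel-reached x with withinBounds d (matrix x) in eq
  ... | true  = 0 , []
  ... | false = 1 , [] ▷ (rule , here refl , kernel≡ , λ fixed → kernel-moves x eq (trans kernel≡ fixed))
    where
    kernel≡ : kernelHS x ≡ reduce x
    kernel≡ rewrite eq = refl

  kernel-irreducible : ∀ x z → ¬ Step L (rule ∷ []) (kernelHS x) z
  kernel-irreducible x z (r , here refl , refl , moves) = moves (kernel-idem x)

  kernelization : Kernelization L
  kernelization = record
    { rules = rule ∷ [] ; kernel = kernelHS ; polyTime = kernelPolyTime
    ; equivalent = kernel-equivalent ; bound = kernel-bound ; bounded = kernel-bounded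
    ; reached = kernel-reached ; irreducible = kernel-irreducible }

  chain-shape : ∀ {x ℓ y} → Chain L (rule ∷ []) x ℓ y →
                (ℓ ≡ 0 × y ≡ x) ⊎ (ℓ ≡ 1 × y ≡ kernelHS x × kernelHS x ≢ x)
  chain-shape [] = inj₁ (refl , refl)
  chain-shape (c ▷ (r , here refl , refl , moves)) with chain-shape c
  ... | inj₁ (refl , refl)     = inj₂ (refl , refl , moves)
  ... | inj₂ (refl , refl , _) = ⊥-elim (moves (kernel-idem _))

  m^1+e≥m : ∀ m e → m ≤ m ^ suc e
  m^1+e≥m zero      e = z≤n
  m^1+e≥m m@(suc _) e = ≤-trans (≤-reflexive (sym (*-identityʳ m))) (*-monoʳ-≤ m (m^n>0 m e))

  m^d≤capacity : ∀ m → m ^ d ≤ capacity d m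
  m^d≤capacity m = ≤-trans (≤-trans (≤-reflexive (sym (*-identityˡ (m ^ d)))) (*-monoˡ-≤ (m ^ d) (1≤d*d!))) (m≤n⊔m 1 (d * d ! * m ^ d))
    where
    1≤d*d! : 1 ≤ d * d !
    1≤d*d! = *-mono-≤ {1} {d} (s≤s z≤n) (1≤n! d)

  moves⇒k≤n : ∀ x → kernelHS x ≢ x → k x ≤ n x
  moves⇒k≤n x moves = ≮⇒≥ λ n<k → moves (kernel-fixes x (within-complete x
    ( ≤-trans (length≤suc-n^d d (𝒜 x) (distinct x) (card≤d x))
              (≤-trans (^-monoˡ-≤ d n<k) (m^d≤capacity (k x)))
    , ≤-trans (<⇒≤ n<k) (≤-trans (m^1+e≥m (k x) d′) (≤-trans (m^d≤capacity (k x)) (m≤n*m (capacity d (k x)) d))))))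

  -- At most one step is made, and it forces k ≤ n ≤ n^d; hence the constant 1.
  chain-length : ∀ x {ℓ y} → Chain L (rule ∷ []) x ℓ y → ℓ * k x ≤ 1 * n x ^ d
  chain-length x c with chain-shape c
  ... | inj₁ (refl , _)         = z≤n
  ... | inj₂ (refl , _ , moves) = *-monoʳ-≤ 1 (≤-trans (moves⇒k≤n x moves) (m^1+e≥m (n x) d′))

  -- For a positive parameter the product is positive and absorbs the maximum with 1; the bounds for
  -- positive k in the theorem rest on this.
  capacity≡ : ∀ m → 1 ≤ m → capacity d m ≡ d * d ! * m ^ d
  capacity≡ m 1≤m = m≤n⇒m⊔n≡n (*-mono-≤ {1} {d * d !} (*-mono-≤ {1} {d} (s≤s z≤n) (1≤n! d)) (≤-trans 1≤m (m^1+e≥m m d′)))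

  kernel-sets : ∀ x → 1 ≤ k x → length (𝒜 (kernelHS x)) ≤ d * d ! * k x ^ d
  kernel-sets x 1≤k = ≤-trans (proj₁ (kernel-within x))
    (≤-reflexive (trans (cong (capacity d) (k-kernel x)) (capacity≡ (k x) 1≤k)))

  kernel-elements : ∀ x → 1 ≤ k x → n (kernelHS x) ≤ d ^ 2 * d ! * k x ^ d
  kernel-elements x 1≤k = ≤-trans (proj₂ (kernel-within x))
    (≤-reflexive (trans (cong (λ m → d * capacity d m) (k-kernel x))
                 (trans (cong (d *_) (capacity≡ (k x) 1≤k)) (lemma d (d !) (k x ^ d)))))
    where
    lemma : ∀ e f p → e * (e * f * p) ≡ e * (e * 1) * f * p
    lemma = solve-∀

length-cartesianProduct : {A B : Set} (xs : List A) (ys : List B) →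
                          length (cartesianProduct xs ys) ≡ length xs * length ys
length-cartesianProduct []       ys = refl
length-cartesianProduct (x ∷ xs) ys = trans (length-++ (map (x ,_) ys))
  (cong₂ _+_ (length-map (x ,_) ys) (length-cartesianProduct xs ys))

-- Proofs with bounded numbers of lines

record Proves {V : Set} (Γ Δ : List (Form V)) (s : ℕ) : Set where
  constructor mkProves
  field
    {lines}  : List (Form V)
    proof    : Frege Γ lines
    complete : ∀ {φ} → φ ∈ Δ → φ ∈ lines
    short    : length lines ≤ s

module _ {V : Set} where

  private
    variable
      Γ Γ′ Δ Θ : List (Form V)
      φ ψ χ : Form V
      s t u : ℕ

  weaken : s ≤ t → Proves Γ Δ s → Proves Γ Δ t
  weaken s≤t (mkProves p c h) = mkProves p c (≤-trans h s≤t)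

  infixl 1 _within_

  _within_ : Proves Γ Δ s → s ≤ t → Proves Γ Δ t
  p within s≤t = weaken s≤t p

  noConclusions : Proves Γ [] 0
  noConclusions = mkProves [] (λ ()) z≤n

  -- A hypothesis of the second proof may be a line of the first, as in `cut`, or a hypothesis of
  -- it, as in `both`. Lines already present are reused, so lengths are bounded rather than equal.
  merge : ∀ {π₁ π₂} → Frege Γ π₁ → (∀ {φ} → φ ∈ Γ′ → φ ∈ π₁ ⊎ φ ∈ Γ) → Frege Γ′ π₂ →
          ∃[ π ] Frege Γ π × (∀ {φ} → φ ∈ π₁ → φ ∈ π) × (∀ {φ} → φ ∈ π₂ → φ ∈ π)
                 × length π ≤ length π₁ + length π₂
  merge p known [] = _ , p , id , (λ ()) , m≤m+n _ _
  merge {π₁ = π₁} p known (_▷_ {π₂} q line) with merge p known q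
  ... | π , r , inc₁ , inc₂ , h with line
  ...   | ax a = _ , r ▷ ax a , there ∘ inc₁ , (λ { (here refl) → here refl ; (there φ∈) → there (inc₂ φ∈) }) ,
                 ≤-trans (s≤s h) (≤-reflexive (sym (+-suc _ _)))
  ...   | mp a b = _ , r ▷ mp (inc₂ a) (inc₂ b) , there ∘ inc₁ , (λ { (here refl) → here refl ; (there φ∈) → there (inc₂ φ∈) }) ,
                 ≤-trans (s≤s h) (≤-reflexive (sym (+-suc _ _)))
  ...   | hyp φ∈Γ′ with known φ∈Γ′
  ...     | inj₁ φ∈π₁ = π , r , inc₁ , (λ { (here refl) → inc₁ φ∈π₁ ; (there φ∈) → inc₂ φ∈ }) ,
                        ≤-trans h (+-monoʳ-≤ (length π₁) (n≤1+n _))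
  ...     | inj₂ φ∈Γ  = _ , r ▷ hyp φ∈Γ , there ∘ inc₁ , (λ { (here refl) → here refl ; (there φ∈) → there (inc₂ φ∈) }) ,
                        ≤-trans (s≤s h) (≤-reflexive (sym (+-suc _ _)))

  cut : Proves Γ Δ s → Proves Δ Θ t → Proves Γ Θ (s + t)
  cut (mkProves p c h) (mkProves p′ c′ h′) =
    let (_ , q , inc₁ , inc₂ , h″) = merge p (inj₁ ∘ c) p′ in
    mkProves q (inc₂ ∘ c′) (≤-trans h″ (+-mono-≤ h h′))

  both : Proves Γ Δ s → Proves Γ Θ t → Proves Γ (Δ ++ Θ) (s + t)
  both {Δ = Δ} (mkProves p c h) (mkProves p′ c′ h′) =
    let (_ , q , inc₁ , inc₂ , h″) = merge p inj₂ p′ in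
    mkProves q (λ φ∈ → Data.Sum.Base.[ inc₁ ∘ c , inc₂ ∘ c′ ] (∈-++⁻ Δ φ∈)) (≤-trans h″ (+-mono-≤ h h′))

  each : (∀ {φ} → φ ∈ Δ → Proves Γ (φ ∷ []) s) → Proves Γ Δ (length Δ * s)
  each {Δ = []}    h = noConclusions
  each {Δ = _ ∷ _} h = both (h (here refl)) (each (h ∘ there))

  frege-mono : ∀ {π} → (∀ {φ} → φ ∈ Γ → φ ∈ Γ′) → Frege Γ π → Frege Γ′ π
  frege-mono inc []            = []
  frege-mono inc (p ▷ hyp φ∈)  = frege-mono inc p ▷ hyp (inc φ∈)
  frege-mono inc (p ▷ ax a)    = frege-mono inc p ▷ ax a
  frege-mono inc (p ▷ mp a b)  = frege-mono inc p ▷ mp a b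

  mono : (∀ {φ} → φ ∈ Γ → φ ∈ Γ′) → Proves Γ Δ s → Proves Γ′ Δ s
  mono inc (mkProves p c h) = mkProves (frege-mono inc p) c h

  assume : φ ∈ Γ → Proves Γ (φ ∷ []) 1
  assume φ∈ = mkProves ([] ▷ hyp φ∈) id ≤-refl

  axiom : Axiom φ → Proves Γ (φ ∷ []) 1
  axiom a = mkProves ([] ▷ ax a) id ≤-refl

  infixl 5 _·_

  _·_ : Proves Γ ((φ ⇒ ψ) ∷ []) s → Proves Γ (φ ∷ []) t → Proves Γ (ψ ∷ []) (suc (s + t))
  p · q with both p q
  ... | mkProves r c h = mkProves (r ▷ mp (c (here refl)) (c (there (here refl)))) (λ { (here refl) → here refl }) (s≤s h)

  infixl 5 _▸_

  _▸_ : ∀ {π} → Frege Γ π → FregeLine Γ π φ → Frege Γ (φ ∷ π)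
  _▸_ = _▷_

  -- The deduction theorem, line by line: the discharged hypothesis turns into the five-line proof
  -- of φ ⇒ φ, every other line into three lines.
  deduce-lines : ∀ {π} → Frege (φ ∷ Γ) π →
                 ∃[ π′ ] Frege Γ π′ × (∀ {ψ} → ψ ∈ π → (φ ⇒ ψ) ∈ π′) × length π′ ≤ 5 * length π
  deduce-lines [] = [] , [] , (λ ()) , z≤n
  deduce-lines {φ} (_▷_ {π} {ψ} p line) with deduce-lines p
  ... | π′ , q , c , h = add line
    where
    open ≤-Reasoning
    longer : ∀ i → i ≤ 5 → i + length π′ ≤ 5 * suc (length π)
    longer i i≤5 = ≤-trans (+-mono-≤ i≤5 h) (≤-reflexive (sym (*-suc 5 (length π))))
    3≤5 : 3 ≤ 5
    3≤5 = s≤s (s≤s (s≤s z≤n))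
    add : FregeLine (φ ∷ _) π ψ →
          ∃[ π″ ] Frege _ π″ × (∀ {χ} → χ ∈ (ψ ∷ π) → (φ ⇒ χ) ∈ π″) × length π″ ≤ 5 * suc (length π)
    add (hyp (here refl)) = _ ,
      q ▸ ax (ax-K φ φ) ▸ ax (ax-K φ (φ ⇒ φ)) ▸ ax (ax-S φ (φ ⇒ φ) φ)
        ▸ mp (here refl) (there (here refl)) ▸ mp (here refl) (there (there (there (here refl)))) ,
      (λ { (here refl) → here refl ; (there χ∈) → there (there (there (there (there (c χ∈))))) }) , longer 5 ≤-refl
    add (hyp (there ψ∈)) = _ ,
      q ▸ hyp ψ∈ ▸ ax (ax-K ψ φ) ▸ mp (here refl) (there (here refl)) ,
      (λ { (here refl) → here refl ; (there χ∈) → there (there (there (c χ∈))) }) , longer 3 3≤5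
    add (ax a) = _ ,
      q ▸ ax a ▸ ax (ax-K ψ φ) ▸ mp (here refl) (there (here refl)) ,
      (λ { (here refl) → here refl ; (there χ∈) → there (there (there (c χ∈))) }) , longer 3 3≤5
    add (mp {χ} a b) = _ ,
      q ▸ ax (ax-S φ χ ψ) ▸ mp (here refl) (there (c a)) ▸ mp (here refl) (there (there (c b))) ,
      (λ { (here refl) → here refl ; (there χ∈) → there (there (there (c χ∈))) }) , longer 3 3≤5

  deduce : Proves (φ ∷ Γ) (ψ ∷ []) s → Proves Γ ((φ ⇒ ψ) ∷ []) (5 * s)
  deduce (mkProves p c h) = let (_ , q , c′ , h′) = deduce-lines p in
    mkProves q (λ { (here refl) → c′ (c (here refl)) }) (≤-trans h′ (*-monoʳ-≤ 5 h))

  explode : Proves Γ (`⊥ ∷ []) s → Proves Γ (φ ∷ []) (2 + s)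
  explode p = axiom (ax-⊥ₑ _) · p

  ∨-introˡ : Proves Γ (φ ∷ []) s → Proves Γ ((φ `∨ ψ) ∷ []) (2 + s)
  ∨-introˡ p = axiom (ax-∨ᵢ₁ _ _) · p

  ∨-introʳ : Proves Γ (ψ ∷ []) s → Proves Γ ((φ `∨ ψ) ∷ []) (2 + s)
  ∨-introʳ p = axiom (ax-∨ᵢ₂ _ _) · p

  ∨-elim : Proves Γ ((φ `∨ ψ) ∷ []) s → Proves (φ ∷ Γ) (χ ∷ []) t → Proves (ψ ∷ Γ) (χ ∷ []) u →
           Proves Γ (χ ∷ []) (4 + (5 * t + 5 * u + s))
  ∨-elim {t = t} {u = u} p q r = axiom (ax-∨ₑ _ _ _) · deduce q · deduce r · p

  ∧-intro : Proves Γ (φ ∷ []) s → Proves Γ (ψ ∷ []) t → Proves Γ ((φ `∧ ψ) ∷ []) (3 + (s + t))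
  ∧-intro p q = axiom (ax-∧ᵢ _ _) · p · q

  ∧-elimˡ : Proves Γ ((φ `∧ ψ) ∷ []) s → Proves Γ (φ ∷ []) (2 + s)
  ∧-elimˡ p = axiom (ax-∧ₑ₁ _ _) · p

  ∧-elimʳ : Proves Γ ((φ `∧ ψ) ∷ []) s → Proves Γ (ψ ∷ []) (2 + s)
  ∧-elimʳ p = axiom (ax-∧ₑ₂ _ _) · p

  ⋁-intro : ∀ {φs m} → length φs ≤ m → φ ∈ φs → Proves Γ (φ ∷ []) s → Proves Γ (⋁ φs ∷ []) (m * 2 + s)
  ⋁-intro {s = s} (s≤s {n = m} h) (here refl) p = weaken (s≤s (s≤s (m≤n+m s (m * 2)))) (∨-introˡ p)
  ⋁-intro (s≤s h) (there φ∈)  p = ∨-introʳ (⋁-intro h φ∈ p)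

  -- The tail is proved as an implication over the unchanged `Γ`, so the costs of the disjuncts add
  -- up. Iterating `∨-elim` would put the tail under one more deduction per disjunct and multiply
  -- its cost by 5 each time.
  ⋁-elim⇒ : ∀ φs → (∀ {φ} → φ ∈ φs → Proves (φ ∷ Γ) (χ ∷ []) t) → Proves Γ ((⋁ φs ⇒ χ) ∷ []) (1 + length φs * (3 + 5 * t))
  ⋁-elim⇒ []       h = axiom (ax-⊥ₑ _)
  ⋁-elim⇒ {t = t} (φ ∷ φs) h = weaken (≤-reflexive (lemma (5 * t) (length φs * (3 + 5 * t))))
    (axiom (ax-∨ₑ _ _ _) · deduce (h (here refl)) · ⋁-elim⇒ φs (h ∘ there))
    where
    lemma : ∀ x y → suc (suc (1 + x) + (1 + y)) ≡ 1 + (3 + x + y)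
    lemma x y = cong (3 +_) (+-suc x y)

  ⋁-elim : ∀ {φs m} → length φs ≤ m → Proves Γ (⋁ φs ∷ []) s →
           (∀ {φ} → φ ∈ φs → Proves (φ ∷ Γ) (χ ∷ []) t) → Proves Γ (χ ∷ []) (2 + (m * (3 + 5 * t) + s))
  ⋁-elim {s = s} {t = t} {φs = φs} h p q = weaken (s≤s (s≤s (+-monoˡ-≤ s (*-monoˡ-≤ (3 + 5 * t) h)))) (⋁-elim⇒ φs q · p)

  -- Argued classically from the negated clause: given φ, the refutation of ψ proves the clause, a
  -- contradiction; so φ fails, which proves the clause again. The trailing `⊥` is the end of the
  -- disjunction `⋁`.
  nor-intro : Proves (ψ ∷ φ ∷ (`¬ φ `∨ `¬ ψ `∨ `⊥ ⇒ `⊥) ∷ Γ) (`⊥ ∷ []) s →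
              Proves Γ ((`¬ φ `∨ `¬ ψ `∨ `⊥) ∷ []) (2 + 5 * suc (1 + (2 + 5 * suc (1 + (2 + (2 + 5 * s))))))
  nor-intro p = axiom (ax-¬¬ₑ _) ·
    deduce (assume (here refl) · ∨-introˡ (deduce
      (assume (there (here refl)) · ∨-introʳ (∨-introˡ (deduce p)))))

  nor-elim : Proves Γ ((`¬ φ `∨ `¬ ψ `∨ `⊥) ∷ []) s → Proves Γ (φ ∷ []) t → Proves Γ (ψ ∷ []) u →
             Proves Γ (`⊥ ∷ []) (4 + (5 * (2 + t) + 5 * (4 + (5 * (2 + u) + 5 * 1 + 1)) + s))
  nor-elim p q r = ∨-elim p (assume (here refl) · mono there q)
    (∨-elim (assume (here refl)) (assume (here refl) · mono (λ φ∈ → there (there φ∈)) r) (assume (here refl)))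

-- Cook's extended Frege proof of the pigeonhole principle: hole zero is
-- eliminated by sending whoever sits in it to the hole of pigeon zero.  Lines are
-- counted, not symbols, so the abbreviations may be substituted.

rehousedCost : PolyExpr
rehousedCost = K 4 :+ (K 5 :* (K 4 :+ (K 35 :+ K 5 :* (K 2 :+ (X :* (K 3 :+ K 5 :* (X :* K 2 :+ K 7)) :+ K 1)) :+ K 1))
                       :+ K 5 :* (K 2 :+ (X :* (K 3 :+ K 5 :* (X :* K 2 :+ K 3)) :+ K 1)) :+ K 1)

-- The cost expressions copy the nesting of the combinators, each 5 marking a deduction, so that the
-- derivations meet them by computation alone.
separatedCost : ℕ
separatedCost = 5 * (5 * (4 + (5 * (4 + (5 * 5 + 5 * 7 + 1)) + 5 * (4 + (5 * 7 + 5 * 9 + 1)) + 1)))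

countHypotheses : PolyExpr
countHypotheses = K 1 :+ X :+ (K 1 :+ X) :* (K 1 :+ X) :* X

roundCost : PolyExpr
roundCost = countHypotheses :* (rehousedCost :+ K separatedCost)

pigeonholeCost : PolyExpr
pigeonholeCost = X :* roundCost :+ K 1

module _ {V : Set} where

  module Pigeons {N : ℕ} (P : Fin (suc N) → Fin N → Form V) where

    collisions : List (Fin (suc N) × Fin (suc N))
    collisions = filter (λ p → ¬? (proj₁ p Fin.≟ proj₂ p)) (cartesianProduct (allFin (suc N)) (allFin (suc N)))

    housed : Fin (suc N) → Form V
    housed a = ⋁ (tabulate (P a))

    separate : (Fin (suc N) × Fin (suc N)) × Fin N → Form V
    separate ((a , a′) , b) = P a b ⇒ P a′ b ⇒ `⊥

    hypotheses : List (Form V)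
    hypotheses = map housed (allFin (suc N)) ++ map separate (cartesianProduct collisions (allFin N))

    housed∈ : ∀ a → housed a ∈ hypotheses
    housed∈ a = ∈-++⁺ˡ (∈-map⁺ housed (∈-allFin a))

    separate∈ : ∀ {a a′} b → a ≢ a′ → (P a b ⇒ P a′ b ⇒ `⊥) ∈ hypotheses
    separate∈ {a} {a′} b a≢a′ = ∈-++⁺ʳ (map housed (allFin (suc N)))
      (∈-map⁺ separate (∈-cartesianProduct⁺ (∈-filter⁺ (λ p → ¬? (proj₁ p Fin.≟ proj₂ p))
        (∈-cartesianProduct⁺ (∈-allFin a) (∈-allFin a′)) a≢a′) (∈-allFin b)))

    length-collisions : length collisions ≤ suc N * suc N
    length-collisions = ≤-trans
      (length-filter (λ p → ¬? (proj₁ p Fin.≟ proj₂ p)) (cartesianProduct (allFin (suc N)) (allFin (suc N))))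
      (≤-reflexive (trans (length-cartesianProduct (allFin (suc N)) (allFin (suc N)))
                          (cong₂ _*_ (length-tabulate {n = suc N} id) (length-tabulate {n = suc N} id))))

    length-hypotheses : length hypotheses ≤ suc N + suc N * suc N * N
    length-hypotheses = ≤-trans (≤-reflexive (length-++ (map housed (allFin (suc N)))))
      (+-mono-≤ (≤-reflexive (trans (length-map housed (allFin (suc N))) (length-tabulate {n = suc N} id)))
        (≤-trans (≤-reflexive (trans (length-map separate (cartesianProduct collisions (allFin N)))
                                     (length-cartesianProduct collisions (allFin N))))
                 (*-mono-≤ length-collisions (≤-reflexive (length-tabulate {n = N} id)))))

    derive : ∀ {Γ s} → (∀ a → Proves Γ (housed a ∷ []) s) →
             (∀ {a a′} b → a ≢ a′ → Proves Γ ((P a b ⇒ P a′ b ⇒ `⊥) ∷ []) s) →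
             Proves Γ hypotheses ((suc N + suc N * suc N * N) * s)
    derive {Γ} {s} house sep = weaken (*-monoˡ-≤ s length-hypotheses) (each prove)
      where
      prove : ∀ {φ} → φ ∈ hypotheses → Proves Γ (φ ∷ []) s
      prove φ∈ with ∈-++⁻ (map housed (allFin (suc N))) φ∈
      ... | inj₁ φ∈₁ with ∈-map⁻ housed φ∈₁
      ...   | a , _ , refl = house a
      prove φ∈ | inj₂ φ∈₂ with ∈-map⁻ separate φ∈₂
      ...   | ((a , a′) , b) , t∈ , refl = sep b (proj₂ (∈-filter⁻ (λ p → ¬? (proj₁ p Fin.≟ proj₂ p))
                {xs = cartesianProduct (allFin (suc N)) (allFin (suc N))}
                (proj₁ (∈-cartesianProduct⁻ collisions (allFin N) t∈))))

  open Pigeons using (hypotheses; housed∈; separate∈; derive)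

  module _ {N : ℕ} (P : Fin (suc (suc N)) → Fin (suc N) → Form V) where

    rehouse : Fin (suc N) → Fin N → Form V
    rehouse a b = P (suc a) (suc b) `∨ (P (suc a) zero `∧ P zero (suc b))

    clash : ∀ {Γ s t a a′} b → a ≢ a′ → (∀ {φ} → φ ∈ hypotheses P → φ ∈ Γ) →
            Proves Γ (P a b ∷ []) s → Proves Γ (P a′ b ∷ []) t → Proves Γ (`⊥ ∷ []) (3 + (s + t))
    clash b a≢a′ inc p q = assume (inc (separate∈ P b a≢a′)) · p · q

    -- Pigeon `suc a` keeps a hole `suc b`, or it sits in hole zero. In the latter case pigeon zero
    -- cannot also be there, so its own hole `suc b` becomes the new place.
    rehoused : ∀ a → Proves (hypotheses P) (⋁ (tabulate (rehouse a)) ∷ []) (⟦ rehousedCost ⟧ N)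
    rehoused a = ∨-elim (assume (housed∈ P (suc a)))
      (∨-elim (assume (there (housed∈ P zero)))
        (explode (clash zero (λ ()) (λ φ∈ → there (there φ∈)) (assume (here refl)) (assume (there (here refl)))))
        (⋁-elim N≥ (assume (here refl)) λ φ∈ → sit φ∈))
      (⋁-elim N≥ (assume (here refl)) λ φ∈ → stay φ∈)
      within ≤-refl
      where
      N≥ : ∀ {f : Fin N → Form V} → length (tabulate f) ≤ N
      N≥ {f} = ≤-reflexive (length-tabulate f)
      sit : ∀ {φ Γ} → φ ∈ tabulate (λ b → P zero (suc b)) → Proves (φ ∷ Γ ∷ P (suc a) zero ∷ hypotheses P)
            (⋁ (tabulate (rehouse a)) ∷ []) (N * 2 + 7)
      sit φ∈ with ∈-tabulate⁻ φ∈
      ... | b , refl = ⋁-intro N≥ (∈-tabulate⁺ b) (∨-introʳ (∧-intro (assume (there (there (here refl)))) (assume (here refl))))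
      stay : ∀ {φ Γ} → φ ∈ tabulate (λ b → P (suc a) (suc b)) → Proves (φ ∷ Γ) (⋁ (tabulate (rehouse a)) ∷ []) (N * 2 + 3)
      stay φ∈ with ∈-tabulate⁻ φ∈
      ... | b , refl = ⋁-intro N≥ (∈-tabulate⁺ b) (∨-introˡ (assume (here refl)))

    -- A pigeon moved to b certifies that pigeon zero occupies `suc b`: there one that stayed and
    -- one that moved clash through pigeon zero. Two moved pigeons clash in hole zero.
    separated : ∀ {a a′} b → a ≢ a′ → Proves (hypotheses P) ((rehouse a b ⇒ rehouse a′ b ⇒ `⊥) ∷ []) separatedCost
    separated {a} {a′} b a≢a′ = (deduce (deduce (∨-elim (assume (there (here refl)))
      (∨-elim (assume (there (here refl)))
        (clash (suc b) (a≢a′ ∘ Fin.suc-injective) (λ φ∈ → there (there (there (there φ∈)))) (assume (there (here refl))) (assume (here refl)))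
        (clash {a = suc a} {zero} (suc b) (λ ()) (λ φ∈ → there (there (there (there φ∈)))) (assume (there (here refl))) (∧-elimʳ (assume (here refl)))))
      (∨-elim (assume (there (here refl)))
        (clash {a = zero} {suc a′} (suc b) (λ ()) (λ φ∈ → there (there (there (there φ∈)))) (∧-elimʳ (assume (there (here refl)))) (assume (here refl)))
        (clash zero (a≢a′ ∘ Fin.suc-injective) (λ φ∈ → there (there (there (there φ∈))))
          (∧-elimˡ (assume (there (here refl)))) (∧-elimˡ (assume (here refl)))))))) within ≤-refl

  -- Each round derives the hypotheses for one hole less, and `cut` adds the rounds up; all N of
  -- them are charged at the price of the largest.
  pigeonhole : ∀ N (P : Fin (suc N) → Fin N → Form V) → Proves (hypotheses P) (`⊥ ∷ []) (⟦ pigeonholeCost ⟧ N)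
  -- Without holes `housed` is the empty disjunction, that is, `⊥`.
  pigeonhole zero    P = assume (housed∈ P zero)
  pigeonhole (suc N) P =
    cut (derive (rehouse P) {s = ⟦ rehousedCost ⟧ N + separatedCost}
          (λ a → weaken (m≤m+n (⟦ rehousedCost ⟧ N) separatedCost) (rehoused P a))
          (λ b a≢a′ → weaken (m≤n+m separatedCost (⟦ rehousedCost ⟧ N)) (separated P b a≢a′)))
        (pigeonhole N (rehouse P))
    within (begin
      ⟦ roundCost ⟧ N + (N * ⟦ roundCost ⟧ N + 1)
        ≤⟨ +-mono-≤ r≤ (+-monoˡ-≤ 1 (*-monoʳ-≤ N r≤)) ⟩
      ⟦ roundCost ⟧ (suc N) + (N * ⟦ roundCost ⟧ (suc N) + 1)
        ≡⟨ +-assoc (⟦ roundCost ⟧ (suc N)) (N * ⟦ roundCost ⟧ (suc N)) 1 ⟨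
      ⟦ pigeonholeCost ⟧ (suc N) ∎)
    where
    open ≤-Reasoning
    r≤ : ⟦ roundCost ⟧ N ≤ ⟦ roundCost ⟧ (suc N)
    r≤ = ⟦⟧-mono roundCost (n≤1+n N)

-- Auxiliary facts on lists and ordered pairs

no-members : {A : Set} (xs : List A) → (∀ {x} → ¬ x ∈ xs) → xs ≡ []
no-members []       h = refl
no-members (x ∷ xs) h = ⊥-elim (h (here refl))

subst-positive : {A V W : Set} (σ : V → Form W) (f : A → V) (xs : List A) →
                 subst σ (⋁ (map literalForm (map (λ a → pos (f a)) xs))) ≡ ⋁ (map (λ a → σ (f a)) xs)
subst-positive σ f []       = refl
subst-positive σ f (x ∷ xs) = cong (σ (f x) `∨_) (subst-positive σ f xs)

length-concatMap : {A B : Set} {m : ℕ} (f : A → List B) (xs : List A) → (∀ x → length (f x) ≡ m) →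
                   length (concatMap f xs) ≡ length xs * m
length-concatMap f []       h = refl
length-concatMap f (x ∷ xs) h = trans (length-++ (f x)) (cong₂ _+_ (h x) (length-concatMap f xs h))

offDiagonal : ∀ n → List (Fin n × Fin n)
offDiagonal n = filter (λ p → ¬? (proj₁ p Fin.≟ proj₂ p)) (cartesianProduct (allFin n) (allFin n))

length-offDiagonal-≤ : ∀ n → length (offDiagonal n) ≤ n * n
length-offDiagonal-≤ n = ≤-trans (length-filter (λ p → ¬? (proj₁ p Fin.≟ proj₂ p)) (cartesianProduct (allFin n) (allFin n)))
  (≤-reflexive (trans (length-cartesianProduct (allFin n) (allFin n))
                      (cong₂ _*_ (length-tabulate {n = n} id) (length-tabulate {n = n} id))))

-- The pairs (0, i) with i > 0 suffice. Through them the number of clauses controls the number of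
-- elements.
length-offDiagonal-≥ : ∀ m → m ≤ length (offDiagonal (suc m))
length-offDiagonal-≥ m = begin
  m                                             ≡⟨ length-tabulate later ⟨
  length (tabulate later)                       ≡⟨ length-map first (tabulate later) ⟨
  length row                                    ≡⟨ cong length (filter-all off (All.map⁺ {f = first} (All.tabulate⁺ {f = later} apart))) ⟨
  length (filter off row)                       ≤⟨ m≤m+n _ _ ⟩
  length (filter off row) + length (filter off rest)
                                                ≡⟨ length-++ (filter off row) ⟨
  length (filter off row ++ filter off rest)    ≡⟨ cong length (filter-++ off row rest) ⟨
  length (offDiagonal (suc m))                  ∎
  where
  open ≤-Reasoning
  off : (p : Fin (suc m) × Fin (suc m)) → Dec (¬ proj₁ p ≡ proj₂ p)
  off p = ¬? (proj₁ p Fin.≟ proj₂ p)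
  later : Fin m → Fin (suc m)
  later = suc
  first : Fin (suc m) → Fin (suc m) × Fin (suc m)
  first = zero ,_
  apart : ∀ i → ¬ zero ≡ later i
  apart i ()
  row rest : List (Fin (suc m) × Fin (suc m))
  row = map first (tabulate later)
  rest = cartesianProduct (tabulate later) (allFin (suc m))

-- The clauses of Φ

module Clauses {d : ℕ} (x : HSInstance d) where

  pairs : Subset (n x) → List (HSVar x)
  pairs A = cartesianProduct (filter (_∈? A) (allFin (n x))) (allFin (k x))

  some : Fin (k x) → Clause (HSVar x)
  some j = map (λ i → pos (i , j)) (allFin (n x))

  both′ : Fin (k x) → Fin (n x) × Fin (n x) → Clause (HSVar x)
  both′ j (i , i′) = neg (i , j) ∷ neg (i′ , j) ∷ []

  hits : Subset (n x) → Clause (HSVar x)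
  hits A = map pos (pairs A)

  somes boths hitss : CNF (HSVar x)
  somes = map some (allFin (k x))
  boths = concatMap (λ j → map (both′ j) (offDiagonal (n x))) (allFin (k x))
  hitss = map hits (𝒜 x)

  data View : Clause (HSVar x) → Set where
    is-some : ∀ j → View (some j)
    is-both : ∀ j {i i′} → i ≢ i′ → View (both′ j (i , i′))
    is-hits : ∀ {A} → A ∈ 𝒜 x → View (hits A)

  view : ∀ {C} → C ∈ ΦHS x → View C
  view C∈ with ∈-++⁻ somes C∈
  ... | inj₁ C∈₁ with ∈-map⁻ some C∈₁
  ...   | j , _ , refl = is-some j
  view C∈ | inj₂ C∈₂ with ∈-++⁻ boths C∈₂
  ... | inj₂ C∈₃ with ∈-map⁻ hits C∈₃
  ...   | A , A∈ , refl = is-hits A∈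
  view C∈ | inj₂ C∈₂ | inj₁ C∈₃ with find (∈-concatMap⁻ (λ j → map (both′ j) (offDiagonal (n x))) {xs = allFin (k x)} C∈₃)
  ... | j , _ , C∈₄ with ∈-map⁻ (both′ j) C∈₄
  ...   | (i , i′) , p∈ , refl = is-both j (proj₂ (∈-filter⁻ (λ p → ¬? (proj₁ p Fin.≟ proj₂ p))
                                                       {xs = cartesianProduct (allFin (n x)) (allFin (n x))} p∈))

  form : Clause (HSVar x) → Form (HSVar x)
  form = ⋁ ∘ map literalForm

  some∈ : ∀ j → ⋁ (map (λ i → var (i , j)) (allFin (n x))) ∈ clauseForms (ΦHS x)
  some∈ j = transport (λ φs → ⋁ φs ∈ clauseForms (ΦHS x)) (sym (map-∘ (allFin (n x))))
    (∈-map⁺ form (∈-++⁺ˡ (∈-map⁺ some (∈-allFin j))))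

  both∈ : ∀ j {i i′} → i ≢ i′ → (`¬ var (i , j) `∨ `¬ var (i′ , j) `∨ `⊥) ∈ clauseForms (ΦHS x)
  both∈ j {i} {i′} i≢i′ = ∈-map⁺ form (∈-++⁺ʳ somes (∈-++⁺ˡ
    (∈-concatMap⁺ (λ j → map (both′ j) (offDiagonal (n x)))
      (lose (∈-allFin j) (∈-map⁺ (both′ j) (∈-filter⁺ (λ p → ¬? (proj₁ p Fin.≟ proj₂ p))
        (∈-cartesianProduct⁺ (∈-allFin i) (∈-allFin i′)) i≢i′))))))

  hits∈ : ∀ {A} → A ∈ 𝒜 x → ⋁ (map var (pairs A)) ∈ clauseForms (ΦHS x)
  hits∈ {A} A∈ = transport (λ φs → ⋁ φs ∈ clauseForms (ΦHS x)) (sym (map-∘ (pairs A)))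
    (∈-map⁺ form (∈-++⁺ʳ somes (∈-++⁺ʳ boths (∈-map⁺ hits A∈))))

  ∈-pairs⁺ : ∀ {A i} j → i ∈ˢ A → (i , j) ∈ pairs A
  ∈-pairs⁺ {A} {i} j i∈ = ∈-cartesianProduct⁺ (∈-filter⁺ (_∈? A) (∈-allFin i) i∈) (∈-allFin j)

  ∈-pairs⁻ : ∀ {A i j} → (i , j) ∈ pairs A → i ∈ˢ A
  ∈-pairs⁻ {A} p∈ = proj₂ (∈-filter⁻ (_∈? A) {xs = allFin (n x)}
    (proj₁ (∈-cartesianProduct⁻ (filter (_∈? A) (allFin (n x))) (allFin (k x)) p∈)))

  length-pairs : ∀ A → length (pairs A) ≤ n x * k x
  length-pairs A = ≤-trans (≤-reflexive (length-cartesianProduct (filter (_∈? A) (allFin (n x))) (allFin (k x))))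
    (*-mono-≤ (≤-trans (length-filter (_∈? A) (allFin (n x))) (≤-reflexive (length-tabulate {n = n x} id)))
              (≤-reflexive (length-tabulate {n = k x} id)))

  length-Φ : length (ΦHS x) ≡ k x + (k x * length (offDiagonal (n x)) + length (𝒜 x))
  length-Φ = trans (length-++ somes) (cong₂ _+_
    (trans (length-map some (allFin (k x))) (length-tabulate {n = k x} id))
    (trans (length-++ boths) (cong₂ _+_
      (trans (length-concatMap (λ j → map (both′ j) (offDiagonal (n x))) (allFin (k x)) (λ j → length-map (both′ j) (offDiagonal (n x))))
             (cong (_* length (offDiagonal (n x))) (length-tabulate {n = k x} id)))
      (length-map hits (𝒜 x)))))

  k≤length-Φ : k x ≤ length (ΦHS x)
  k≤length-Φ = ≤-trans (m≤m+n (k x) _) (≤-reflexive (sym length-Φ))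

  length-𝒜≤length-Φ : length (𝒜 x) ≤ length (ΦHS x)
  length-𝒜≤length-Φ = ≤-trans (≤-trans (m≤n+m _ (k x * length (offDiagonal (n x)))) (m≤n+m _ (k x))) (≤-reflexive (sym length-Φ))

  -- A single position contributes one clause of the first kind and at least n - 1 of the second.
  -- For k = 0 only the clauses of the sets exist, and n is unbounded in terms of them.
  n≤length-Φ : 1 ≤ k x → n x ≤ length (ΦHS x)
  n≤length-Φ 1≤k = ≤-trans (n≤ (n x)) (≤-reflexive (sym length-Φ))
    where
    n≤ : ∀ m → m ≤ k x + (k x * length (offDiagonal m) + length (𝒜 x))
    n≤ zero    = z≤n
    n≤ (suc m) = +-mono-≤ 1≤k (≤-trans (≤-trans (≤-reflexive (sym (*-identityˡ m)))
      (*-mono-≤ 1≤k (length-offDiagonal-≥ m))) (m≤m+n _ _))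

  -- 145 is the size nor-elim gives for three one-line premises.
  contradictory : ∀ {Γ j i i′} → (∀ {φ} → φ ∈ clauseForms (ΦHS x) → φ ∈ Γ) → i ≢ i′ →
                  var (i , j) ∈ Γ → var (i′ , j) ∈ Γ → Proves Γ (`⊥ ∷ []) 145
  contradictory {j = j} inc i≢i′ p q = nor-elim (assume (inc (both∈ j i≢i′))) (assume p) (assume q)

  no-pairs : ∀ {A} → A ∈ 𝒜 x → (∀ {p} → ¬ p ∈ pairs A) → `⊥ ∈ clauseForms (ΦHS x)
  no-pairs A∈ none = transport (λ ps → ⋁ (map var ps) ∈ clauseForms (ΦHS x)) (no-members (pairs _) none) (hits∈ A∈)

-- Refutations by exhausting the choices of k elements

-- `κ` enters as a coefficient and the number of open positions as recursion depth, so for fixed k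
-- this is a polynomial in n of degree at most k + 1.
bruteForceCost : ℕ → ℕ → PolyExpr
bruteForceCost κ zero    = K 2 :+ (X :* K κ :* (K 3 :+ K 5 :* K 145) :+ K 1)
bruteForceCost κ (suc m) = K 2 :+ (X :* (K 3 :+ K 5 :* bruteForceCost κ m) :+ K 1)

module BruteForce {d : ℕ} (x : HSInstance d) (unsat : Unsatisfiable (ΦHS x)) where
  open Clauses x

  -- The assignment that chooses f j at position j satisfies the first two groups of clauses, so
  -- unsatisfiability must show up at a set missed by f.
  unhit : (f : Fin (k x) → Fin (n x)) → ∃[ A ] A ∈ 𝒜 x × (∀ j → f j ∉ˢ A)
  unhit f with Any.any? (λ A → Fin.all? (λ j → ¬? (f j ∈? A))) (𝒜 x)
  ... | yes a = find a
  ... | no ¬a = ⊥-elim (unsat α (All.tabulate (λ C∈ → satisfied (view C∈))))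
    where
    α : HSVar x → Bool
    α (i , j) = does (f j Fin.≟ i)
    satisfied : ∀ {C} → View C → Any (Holds α) C
    satisfied (is-some j) = lose (∈-map⁺ (λ i → pos (i , j)) (∈-allFin (f j))) (dec-true (f j Fin.≟ f j) refl)
    satisfied (is-both j {i} {i′} i≢i′) with f j Fin.≟ i in eq
    ... | no  _    = here (cong does eq)
    ... | yes refl = there (here (dec-false (f j Fin.≟ i′) i≢i′))
    satisfied (is-hits {A} A∈) =
      let (j , h) = Fin.¬∀⟶∃¬ (k x) (λ j → f j ∉ˢ A) (λ j → ¬? (f j ∈? A)) (λ all → ¬a (lose A∈ all))
          fj∈A = decidable-stable (f j ∈? A) h
      in lose (∈-map⁺ pos (∈-pairs⁺ j fj∈A)) (dec-true (f j Fin.≟ f j) refl)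

  -- `js` lists the undecided positions; for every other position `Γ` contains a chosen variable.
  -- Branching on the clause of a position decides it.
  refute : ∀ js {Γ} → (∀ {φ} → φ ∈ clauseForms (ΦHS x) → φ ∈ Γ) →
           (∀ j → j ∈ js ⊎ ∃[ i ] var (i , j) ∈ Γ) → Proves Γ (`⊥ ∷ []) (⟦ bruteForceCost (k x) (length js) ⟧ (n x))
  refute [] {Γ} inc chosen = ⋁-elim {m = n x * k x}
    (≤-trans (≤-reflexive (length-map var (pairs A))) (length-pairs A)) (assume (inc (hits∈ A∈))) contra
    where
    pickElement : (j : Fin (k x)) → ∃[ i ] var (i , j) ∈ Γ
    pickElement j with chosen j
    ... | inj₂ c = c
    A : Subset (n x)
    A = proj₁ (unhit (proj₁ ∘ pickElement))
    A∈ : A ∈ 𝒜 x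
    A∈ = proj₁ (proj₂ (unhit (proj₁ ∘ pickElement)))
    A-unhit : ∀ j → proj₁ (pickElement j) ∉ˢ A
    A-unhit = proj₂ (proj₂ (unhit (proj₁ ∘ pickElement)))
    contra : ∀ {φ} → φ ∈ map var (pairs A) → Proves (φ ∷ Γ) (`⊥ ∷ []) 145
    contra φ∈ with ∈-map⁻ var φ∈
    -- The clause offers an element of `A` at position j, whereas the element chosen there lies
    -- outside `A`; two different elements at one position are excluded.
    ... | (i , j) , p∈ , refl = contradictory (there ∘ inc)
      (λ i≡ → A-unhit j (transport (_∈ˢ A) i≡ (∈-pairs⁻ p∈))) (here refl) (there (proj₂ (pickElement j)))
  refute (j ∷ js) {Γ} inc chosen = ⋁-elim {m = n x}
    (≤-reflexive (trans (length-map (λ i → var (i , j)) (allFin (n x))) (length-tabulate {n = n x} id))) (assume (inc (some∈ j))) branch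
    where
    branch : ∀ {φ} → φ ∈ map (λ i → var (i , j)) (allFin (n x)) → Proves (φ ∷ Γ) (`⊥ ∷ []) (⟦ bruteForceCost (k x) (length js) ⟧ (n x))
    branch φ∈ with ∈-map⁻ (λ i → var (i , j)) φ∈
    ... | i , _ , refl = refute js (there ∘ inc) choose
      where
      choose : ∀ l → l ∈ js ⊎ ∃[ i′ ] var (i′ , l) ∈ (var (i , j) ∷ Γ)
      choose l with chosen l
      ... | inj₁ (here refl) = inj₂ (i , here refl)
      ... | inj₁ (there l∈)  = inj₁ l∈
      ... | inj₂ (i′ , v∈)   = inj₂ (i′ , there v∈)

  refutation : Proves (clauseForms (ΦHS x)) (`⊥ ∷ []) (⟦ bruteForceCost (k x) (k x) ⟧ (n x))
  refutation = transport (λ m → Proves (clauseForms (ΦHS x)) (`⊥ ∷ []) (⟦ bruteForceCost (k x) m ⟧ (n x))) (length-tabulate {n = k x} id)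
    (refute (allFin (k x)) id (inj₁ ∘ ∈-allFin))

-- Plain refutations as extended refutations

subst-axiom : {V W : Set} (σ : V → Form W) {φ : Form V} → Axiom φ → Axiom (subst σ φ)
subst-axiom σ (ax-K φ ψ)    = ax-K _ _
subst-axiom σ (ax-S φ ψ χ)  = ax-S _ _ _
subst-axiom σ (ax-∧ᵢ φ ψ)   = ax-∧ᵢ _ _
subst-axiom σ (ax-∧ₑ₁ φ ψ)  = ax-∧ₑ₁ _ _
subst-axiom σ (ax-∧ₑ₂ φ ψ)  = ax-∧ₑ₂ _ _
subst-axiom σ (ax-∨ᵢ₁ φ ψ)  = ax-∨ᵢ₁ _ _
subst-axiom σ (ax-∨ᵢ₂ φ ψ)  = ax-∨ᵢ₂ _ _
subst-axiom σ (ax-∨ₑ φ ψ χ) = ax-∨ₑ _ _ _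
subst-axiom σ (ax-⊥ₑ φ)     = ax-⊥ₑ _
subst-axiom σ (ax-¬¬ₑ φ)    = ax-¬¬ₑ _

frege⇒extended : {V : Set} {Γ π : List (Form V)} → Frege Γ π → ExtFrege Γ (map (subst (var ∘ inj₁)) π)
frege⇒extended []             = []
frege⇒extended (p ▷ hyp φ∈)   = frege⇒extended p ▷ hyp (∈-map⁺ (subst (var ∘ inj₁)) φ∈)
frege⇒extended (p ▷ ax a)     = frege⇒extended p ▷ ax (subst-axiom (var ∘ inj₁) a)
frege⇒extended (p ▷ mp φ∈ ψ∈) = frege⇒extended p ▷ mp (∈-map⁺ (subst (var ∘ inj₁)) φ∈) (∈-map⁺ (subst (var ∘ inj₁)) ψ∈)

hittingSet-refutable : (d κ : ℕ) → ∃[ p ] ((x : HSInstance d) → k x ≡ κ → Unsatisfiable (ΦHS x) →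
                       ∃[ s ] (ExtFregeRefutation (ΦHS x) s × s ≤ eval p (length (ΦHS x))))
hittingSet-refutable d κ = toPoly (bruteForceCost κ κ) , refuted
  where
  open ≤-Reasoning
  refuted : (x : HSInstance d) → k x ≡ κ → Unsatisfiable (ΦHS x) →
            ∃[ s ] (ExtFregeRefutation (ΦHS x) s × s ≤ eval (toPoly (bruteForceCost κ κ)) (length (ΦHS x)))
  refuted x refl unsat =
    _ , (_ , frege⇒extended proof , ∈-map⁺ (subst (var ∘ inj₁)) (complete (here refl)) , refl) , (begin
      length (map (subst (var ∘ inj₁)) lines)   ≡⟨ length-map (subst (var ∘ inj₁)) lines ⟩
      length lines                              ≤⟨ short ⟩
      ⟦ bruteForceCost (k x) (k x) ⟧ (n x)      ≤⟨ grow (k x) refl ⟩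
      ⟦ bruteForceCost (k x) (k x) ⟧ (length (ΦHS x))  ≡⟨ eval-toPoly (bruteForceCost (k x) (k x)) (length (ΦHS x)) ⟨
      eval (toPoly (bruteForceCost (k x) (k x))) (length (ΦHS x)) ∎)
    where
    open Proves (BruteForce.refutation x unsat)
    grow : ∀ m → m ≡ k x → ⟦ bruteForceCost m m ⟧ (n x) ≤ ⟦ bruteForceCost m m ⟧ (length (ΦHS x))
    -- For k = 0 the clauses do not bound n, but the factor k removes n from the cost; 728 is 3 + 5
    -- · 145.
    grow zero    _  = ≤-reflexive (cong (λ z → 2 + (z * 728 + 1)) (trans (*-zeroʳ (n x)) (sym (*-zeroʳ (length (ΦHS x))))))
    grow (suc m) eq = ⟦⟧-mono (bruteForceCost (suc m) (suc m)) (Clauses.n≤length-Φ x (≤-trans (s≤s z≤n) (≤-reflexive eq)))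

-- Soundness of the reduction step

-- No case distinction is made: the only case is the trivial formula ⊥ ⇒ ⊥, whose disjunction takes
-- three lines, and Φ itself is the isomorphic copy.
singleCase : ∀ {d} {y z : HSInstance d} {s} (σ : HSVar z → Form (HSVar y)) →
             Proves (clauseForms (ΦHS y)) (map (subst σ) (clauseForms (ΦHS z))) s →
             StepWitness (HittingSet d) 1 (3 + s) y z
singleCase {y = y} {z} {s} σ p = record
  { r = 1 ; r≤R = ≤-refl ; Ξ = λ _ → `⊥ ⇒ `⊥ ; η = λ _ → ΦHS z
  ; η≅Φ = λ _ → ↔-id _ , trans (map-cong (λ C → trans (map-cong rename-id C) (map-id C)) (ΦHS z)) (map-id (ΦHS z))
  ; s₀ = length (Proves.lines valid)
  ; tautology = _ , Proves.proof valid , Proves.complete valid (here refl) ∷ [] , refl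
  ; sₜ = λ _ → length (Proves.lines step)
  ; implies = λ _ → σ , _ , Proves.proof step , All.tabulate (Proves.complete step) , refl
  ; total = +-mono-≤ (Proves.short valid) (≤-trans (≤-reflexive (+-identityʳ _)) (Proves.short step))
  }
  where
  rename-id : ∀ l → renameLiteral id l ≡ l
  rename-id (pos v) = refl
  rename-id (neg v) = refl
  valid : Proves [] (((`⊥ ⇒ `⊥) `∨ `⊥) ∷ []) 3
  valid = ∨-introˡ (axiom (ax-⊥ₑ `⊥))
  step : Proves ((`⊥ ⇒ `⊥) ∷ clauseForms (ΦHS y)) (map (subst σ) (clauseForms (ΦHS z))) s
  step = mono there p

-- With m clauses before the step, the next formula has at most m of the first kind, m · m² of the
-- second and m + 1 of the third; the extra 1 admits the single set of `unsolvable`.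
countClauses : PolyExpr
countClauses = K 1 :+ (X :+ (X :* (X :* X) :+ X))

module SingleStep {d : ℕ} (x z : HSInstance d) {L : ℕ} (few : length (ΦHS z) ≤ L) where

  byClauses : ∀ {s} (σ : HSVar z → Form (HSVar x)) →
              (∀ {C} → C ∈ ΦHS z → Proves (clauseForms (ΦHS x)) (subst σ (⋁ (map literalForm C)) ∷ []) s) →
              StepWitness (HittingSet d) 1 (3 + L * s) x z
  byClauses {s} σ prove = singleCase σ (weaken (*-monoˡ-≤ s (≤-trans (≤-reflexive same-length) few)) (each prove′))
    where
    same-length : length (map (subst σ) (clauseForms (ΦHS z))) ≡ length (ΦHS z)
    same-length = trans (length-map (subst σ) (clauseForms (ΦHS z))) (length-map (⋁ ∘ map literalForm) (ΦHS z))
    prove′ : ∀ {φ} → φ ∈ map (subst σ) (clauseForms (ΦHS z)) → Proves (clauseForms (ΦHS x)) (φ ∷ []) s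
    prove′ φ∈ with ∈-map⁻ (subst σ) φ∈
    ... | ψ , ψ∈ , refl with ∈-map⁻ (⋁ ∘ map literalForm) ψ∈
    ...   | C , C∈ , refl = prove C∈

  byContradiction : ∀ {s} → Proves (clauseForms (ΦHS x)) (`⊥ ∷ []) s →
                    StepWitness (HittingSet d) 1 (3 + L * (2 + s)) x z
  byContradiction absurd = byClauses (λ _ → `⊥) (λ _ → explode absurd)

collapseCost : PolyExpr
collapseCost = K 2 :+ (X :* (K 3 :+ K 5 :* K 145) :+ K 1)

exclusionCost : PolyExpr
exclusionCost = K 2 :+ (X :* (K 3 :+ K 5 :* collapseCost) :+ K 1)

-- Per clause, `stepCost` adds the prices of all three kinds of witness: exploding an assumed `⊥` in
-- 3 lines, the retraction, and exploding the pigeonhole refutation. One polynomial then serves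
-- every step.
someCost bothCost hitsCost retractionCost hitCost separationCost disjointCost stepCost : PolyExpr
someCost = K 2 :+ (X :* (K 3 :+ K 5 :* (X :* K 2 :+ (X :* K 2 :+ K 1))) :+ K 1)
bothCost = K 2 :+ K 5 :* (K 4 :+ K 5 :* (K 6 :+ K 5 :* exclusionCost))
hitsCost = K 2 :+ (X :* X :* (K 3 :+ K 5 :* (X :* X :* K 2 :+ (X :* K 2 :+ K 1))) :+ K 1)
retractionCost = someCost :+ bothCost :+ hitsCost
hitCost = K 2 :+ (X :* X :* (K 3 :+ K 5 :* (X :* K 2 :+ (X :* K 2 :+ K 1))) :+ K 1)
separationCost = K 5 :* (K 5 :* exclusionCost)
disjointCost = countHypotheses :* (hitCost :+ separationCost) :+ pigeonholeCost
stepCost = K 3 :+ countClauses :* (K 3 :+ (retractionCost :+ (K 2 :+ disjointCost)))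

-- Merging elements along g : each element of the new universe stands for the
-- disjunction of the old ones mapped to it.
module Retraction {d : ℕ} (x z : HSInstance d) (k≡ : k z ≡ k x) (g : Fin (n x) → Fin (n z))
                  (covered : ∀ {B} → B ∈ 𝒜 z → ∃[ A ] A ∈ 𝒜 x × (∀ {i} → i ∈ˢ A → g i ∈ˢ B))
                  (m : ℕ) (n≤ : n x ≤ m) (nz≤ : n z ≤ m) (k≤ : k x ≤ m) where
  open Clauses

  old : Fin (k z) → Fin (k x)
  old = cast k≡

  fibre : Fin (n z) → List (Fin (n x))
  fibre i′ = filter (λ i → g i Fin.≟ i′) (allFin (n x))

  σ : HSVar z → Form (HSVar x)
  σ (i′ , j) = ⋁ (map (λ i → var (i , old j)) (fibre i′))

  Γ : List (Form (HSVar x))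
  Γ = clauseForms (ΦHS x)

  length-fibre : ∀ {i′} {f : Fin (n x) → Form (HSVar x)} → length (map f (fibre i′)) ≤ m
  length-fibre {i′} {f} = ≤-trans (≤-reflexive (length-map f (fibre i′)))
    (≤-trans (length-filter (λ i → g i Fin.≟ i′) (allFin (n x))) (≤-trans (≤-reflexive (length-tabulate {n = n x} id)) n≤))

  σ-intro : ∀ {Δ} i j → var (i , old j) ∈ Δ → Proves Δ (σ (g i , j) ∷ []) (m * 2 + 1)
  σ-intro i j v∈ = ⋁-intro length-fibre
    (∈-map⁺ (λ i → var (i , old j)) (∈-filter⁺ (λ l → g l Fin.≟ g i) (∈-allFin i) refl)) (assume v∈)

  length-vars : (y : HSInstance d) → n y ≤ m → {f : Fin (n y) → Form (HSVar x)} → length (map f (allFin (n y))) ≤ m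
  length-vars y ny≤ {f} = ≤-trans (≤-reflexive (trans (length-map f (allFin (n y))) (length-tabulate {n = n y} id))) ny≤

  length-hits : (y : HSInstance d) → n y ≤ m → k y ≤ m → ∀ A {f : HSVar y → Form (HSVar x)} → length (map f (pairs y A)) ≤ m * m
  length-hits y ny≤ ky≤ A {f} = ≤-trans (≤-reflexive (length-map f (pairs y A)))
    (≤-trans (length-pairs y A) (*-mono-≤ ny≤ ky≤))

  some-derived : ∀ j → Proves Γ (⋁ (map (λ i′ → σ (i′ , j)) (allFin (n z))) ∷ []) (⟦ someCost ⟧ m)
  some-derived j = ⋁-elim (length-vars x n≤) (assume (some∈ x (old j))) send
    where
    send : ∀ {φ} → φ ∈ map (λ i → var (i , old j)) (allFin (n x)) →
           Proves (φ ∷ Γ) (⋁ (map (λ i′ → σ (i′ , j)) (allFin (n z))) ∷ []) (m * 2 + (m * 2 + 1))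
    send φ∈ with ∈-map⁻ (λ i → var (i , old j)) φ∈
    ... | i , _ , refl = ⋁-intro (length-vars z nz≤) (∈-map⁺ (λ i′ → σ (i′ , j)) (∈-allFin (g i))) (σ-intro i j (here refl))

  -- Different elements have disjoint fibres under `g`, so any two variables taken from them name
  -- different old elements at the same position.
  both-derived : ∀ j {i i′} → i ≢ i′ → Proves Γ ((`¬ σ (i , j) `∨ `¬ σ (i′ , j) `∨ `⊥) ∷ []) (⟦ bothCost ⟧ m)
  both-derived j {i} {i′} i≢i′ = nor-intro (⋁-elim length-fibre (assume (there (here refl))) first) within ≤-refl
    where
    first : ∀ {φ} → φ ∈ map (λ l → var (l , old j)) (fibre i) → Proves (φ ∷ _) (`⊥ ∷ []) (⟦ collapseCost ⟧ m)
    first φ∈ with ∈-map⁻ (λ l → var (l , old j)) φ∈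
    ... | l , l∈ , refl = ⋁-elim length-fibre (assume (there (here refl))) second
      where
      second : ∀ {ψ} → ψ ∈ map (λ l → var (l , old j)) (fibre i′) → Proves (ψ ∷ _) (`⊥ ∷ []) 145
      second ψ∈ with ∈-map⁻ (λ l → var (l , old j)) ψ∈
      ... | l′ , l′∈ , refl = contradictory x (λ φ∈ → there (there (there (there (there φ∈))))) l≢l′ (there (here refl)) (here refl)
        where
        l≢l′ : l ≢ l′
        l≢l′ refl = i≢i′ (trans (sym (proj₂ (∈-filter⁻ (λ l → g l Fin.≟ i) {xs = allFin (n x)} l∈)))
                                (proj₂ (∈-filter⁻ (λ l → g l Fin.≟ i′) {xs = allFin (n x)} l′∈)))

  hits-derived : ∀ {B} → B ∈ 𝒜 z → Proves Γ (⋁ (map σ (pairs z B)) ∷ []) (⟦ hitsCost ⟧ m)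
  hits-derived {B} B∈ with covered B∈
  ... | A , A∈ , A→B = ⋁-elim (length-hits x n≤ k≤ A) (assume (hits∈ x A∈)) send
    where
    send : ∀ {φ} → φ ∈ map var (pairs x A) → Proves (φ ∷ Γ) (⋁ (map σ (pairs z B)) ∷ []) (m * m * 2 + (m * 2 + 1))
    send φ∈ with ∈-map⁻ var φ∈
    ... | (i , j) , p∈ , refl =
      ⋁-intro (length-hits z nz≤ (≤-trans (≤-reflexive k≡) k≤) B)
        (∈-map⁺ σ (∈-pairs⁺ z (cast (sym k≡) j) (A→B (∈-pairs⁻ x p∈))))
        (σ-intro i _ (here (cong (λ j′ → var (i , j′)) (Fin.cast-involutive k≡ (sym k≡) j))))

  witness : ∀ {L} → length (ΦHS z) ≤ L → StepWitness (HittingSet d) 1 (3 + L * ⟦ retractionCost ⟧ m) x z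
  witness few = SingleStep.byClauses x z few σ (λ C∈ → derived (view z C∈))
    where
    derived : ∀ {C} → View z C → Proves Γ (subst σ (⋁ (map literalForm C)) ∷ []) (⟦ retractionCost ⟧ m)
    derived (is-some j) = transport (λ φ → Proves Γ (φ ∷ []) (⟦ retractionCost ⟧ m))
      (sym (subst-positive σ (_, j) (allFin (n z))))
      (weaken (≤-trans (m≤m+n (⟦ someCost ⟧ m) (⟦ bothCost ⟧ m)) (m≤m+n _ (⟦ hitsCost ⟧ m))) (some-derived j))
    derived (is-both j i≢i′) = weaken (≤-trans (m≤n+m (⟦ bothCost ⟧ m) (⟦ someCost ⟧ m)) (m≤m+n _ (⟦ hitsCost ⟧ m))) (both-derived j i≢i′)
    derived (is-hits {B} B∈) = transport (λ φ → Proves Γ (φ ∷ []) (⟦ retractionCost ⟧ m))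
      (sym (subst-positive σ id (pairs z B)))
      (weaken (m≤n+m (⟦ hitsCost ⟧ m) (⟦ someCost ⟧ m + ⟦ bothCost ⟧ m)) (hits-derived B∈))

lookup-injective : {A : Set} {xs : List A} → Unique xs → ∀ i j → lookup xs i ≡ lookup xs j → i ≡ j
lookup-injective (x∉ ∷ u) zero    zero    eq = refl
lookup-injective (x∉ ∷ u) zero    (suc j) eq = ⊥-elim (All.lookup x∉ (∈-lookup j) eq)
lookup-injective (x∉ ∷ u) (suc i) zero    eq = ⊥-elim (All.lookup x∉ (∈-lookup i) (sym eq))
lookup-injective (x∉ ∷ u) (suc i) (suc j) eq = cong suc (lookup-injective u i j eq)

-- With d = 1 the sets are pairwise disjoint, so k + 1 of them are refuted by
-- the pigeonhole principle: the j-th chosen element hits at most one of them.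
module Disjoint {d : ℕ} (x : HSInstance d) (disjoint : ∀ {A B i} → A ∈ 𝒜 x → B ∈ 𝒜 x → i ∈ˢ A → i ∈ˢ B → A ≡ B)
                (many : k x < length (𝒜 x)) (m : ℕ) (n≤ : n x ≤ m) (k≤ : k x ≤ m) where
  open Clauses x
  open Pigeons using (hypotheses; derive)

  Γ : List (Form (HSVar x))
  Γ = clauseForms (ΦHS x)

  index : Fin (suc (k x)) → Fin (length (𝒜 x))
  index a = inject≤ a many

  set : Fin (suc (k x)) → Subset (n x)
  set a = lookup (𝒜 x) (index a)

  set∈ : ∀ a → set a ∈ 𝒜 x
  set∈ a = ∈-lookup (index a)

  set-injective : ∀ {a b} → set a ≡ set b → a ≡ b
  set-injective eq = Fin.inject≤-injective many many _ _ (lookup-injective (distinct x) _ _ eq)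

  members : Subset (n x) → List (Fin (n x))
  members A = filter (_∈? A) (allFin (n x))

  -- The pigeons are k + 1 of the sets, the holes are the positions: a set sits at j if the j-th
  -- chosen element belongs to it.
  hitBy : Fin (suc (k x)) → Fin (k x) → Form (HSVar x)
  hitBy a j = ⋁ (map (λ i → var (i , j)) (members (set a)))

  length-members : ∀ {A} {f : Fin (n x) → Form (HSVar x)} → length (map f (members A)) ≤ m
  length-members {A} {f} = ≤-trans (≤-reflexive (length-map f (members A)))
    (≤-trans (length-filter (_∈? A) (allFin (n x))) (≤-trans (≤-reflexive (length-tabulate {n = n x} id)) n≤))

  hit : ∀ a → Proves Γ (⋁ (tabulate (hitBy a)) ∷ []) (⟦ hitCost ⟧ m)
  hit a = ⋁-elim (≤-trans (≤-reflexive (length-map var (pairs (set a)))) (≤-trans (length-pairs (set a)) (*-mono-≤ n≤ k≤)))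
    (assume (hits∈ (set∈ a))) send
    where
    send : ∀ {φ} → φ ∈ map var (pairs (set a)) → Proves (φ ∷ Γ) (⋁ (tabulate (hitBy a)) ∷ []) (m * 2 + (m * 2 + 1))
    send φ∈ with ∈-map⁻ var φ∈
    ... | (i , j) , p∈ , refl = ⋁-intro (≤-trans (≤-reflexive (length-tabulate (hitBy a))) k≤) (∈-tabulate⁺ j)
      (⋁-intro length-members (∈-map⁺ (λ i → var (i , j)) (∈-filter⁺ (_∈? set a) (∈-allFin i) (∈-pairs⁻ p∈))) (assume (here refl)))

  -- A common element would make the two sets equal, so the elements hitting them at position j
  -- differ.
  separation : ∀ {a a′} j → a ≢ a′ → Proves Γ ((hitBy a j ⇒ hitBy a′ j ⇒ `⊥) ∷ []) (⟦ separationCost ⟧ m)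
  separation {a} {a′} j a≢a′ = deduce (deduce (⋁-elim length-members (assume (there (here refl))) first)) within ≤-refl
    where
    first : ∀ {φ} → φ ∈ map (λ i → var (i , j)) (members (set a)) → Proves (φ ∷ _) (`⊥ ∷ []) (⟦ collapseCost ⟧ m)
    first φ∈ with ∈-map⁻ (λ i → var (i , j)) φ∈
    ... | i , i∈ , refl = ⋁-elim length-members (assume (there (here refl))) second
      where
      second : ∀ {ψ} → ψ ∈ map (λ i → var (i , j)) (members (set a′)) → Proves (ψ ∷ _) (`⊥ ∷ []) 145
      second ψ∈ with ∈-map⁻ (λ i → var (i , j)) ψ∈
      ... | i′ , i′∈ , refl = contradictory (λ φ∈ → there (there (there (there φ∈)))) i≢i′ (there (here refl)) (here refl)
        where
        i≢i′ : i ≢ i′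
        i≢i′ refl = a≢a′ (set-injective (disjoint (set∈ a) (set∈ a′)
          (proj₂ (∈-filter⁻ (_∈? set a) {xs = allFin (n x)} i∈)) (proj₂ (∈-filter⁻ (_∈? set a′) {xs = allFin (n x)} i′∈))))

  refutation : Proves Γ (`⊥ ∷ []) (⟦ disjointCost ⟧ m)
  refutation = weaken (+-mono-≤ (*-monoˡ-≤ (⟦ hitCost ⟧ m + ⟦ separationCost ⟧ m) (⟦⟧-mono countHypotheses k≤))
                                (⟦⟧-mono pigeonholeCost k≤))
    (cut (derive hitBy {s = ⟦ hitCost ⟧ m + ⟦ separationCost ⟧ m}
           (λ a → weaken (m≤m+n (⟦ hitCost ⟧ m) (⟦ separationCost ⟧ m)) (hit a))
           (λ j a≢a′ → weaken (m≤n+m (⟦ separationCost ⟧ m) (⟦ hitCost ⟧ m)) (separation j a≢a′)))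
         (pigeonhole (k x) hitBy))

-- Choosing a witness for each kind of step

card≤1⇒≡ : ∀ {n} (A B : Subset n) {i} → card A ≤ 1 → card B ≤ 1 → i ∈ˢ A → i ∈ˢ B → A ≡ B
card≤1⇒≡ A B {i} A≤1 B≤1 i∈A i∈B = trans (single A A≤1 i∈A) (sym (single B B≤1 i∈B))
  where
  single : ∀ A → card A ≤ 1 → i ∈ˢ A → A ≡ ⁅ i ⁆
  single A A≤1 i∈A = ⊆ᵇ-card-≡ ⁅ i ⁆ A
    (⊆ᵇ-complete ⁅ i ⁆ A (λ l∈ → transport (_∈ˢ A) (sym (x∈⁅y⁆⇒x≡y i l∈)) i∈A))
    (≤-trans A≤1 (≤-reflexive (sym (∣⁅x⁆∣≡1 i))))

relax : ∀ {L R s t y z} → s ≤ t → StepWitness L R s y z → StepWitness L R t y z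
relax s≤t w = record { StepWitness w ; total = ≤-trans (StepWitness.total w) s≤t }

-- Abstract because with-abstraction would otherwise unfold the polynomial.
abstract
  budget : ℕ → ℕ
  budget = ⟦ stepCost ⟧

  budgetPoly : Poly
  budgetPoly = toPoly stepCost

  budget-eval : ∀ m → budget m ≡ eval budgetPoly m
  budget-eval m = sym (eval-toPoly stepCost m)

  absurd-budget : ∀ m → 3 + ⟦ countClauses ⟧ m * 3 ≤ budget m
  absurd-budget m = +-monoʳ-≤ 3 (*-monoʳ-≤ (⟦ countClauses ⟧ m) (m≤m+n 3 (⟦ retractionCost ⟧ m + (2 + ⟦ disjointCost ⟧ m))))

  retraction-budget : ∀ m → 3 + ⟦ countClauses ⟧ m * ⟦ retractionCost ⟧ m ≤ budget m
  retraction-budget m = +-monoʳ-≤ 3 (*-monoʳ-≤ (⟦ countClauses ⟧ m)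
    (≤-trans (m≤m+n (⟦ retractionCost ⟧ m) (2 + ⟦ disjointCost ⟧ m)) (m≤n+m (⟦ retractionCost ⟧ m + (2 + ⟦ disjointCost ⟧ m)) 3)))

  disjoint-budget : ∀ m → 3 + ⟦ countClauses ⟧ m * (2 + ⟦ disjointCost ⟧ m) ≤ budget m
  disjoint-budget m = +-monoʳ-≤ 3 (*-monoʳ-≤ (⟦ countClauses ⟧ m)
    (≤-trans (m≤n+m (2 + ⟦ disjointCost ⟧ m) (⟦ retractionCost ⟧ m)) (m≤n+m (⟦ retractionCost ⟧ m + (2 + ⟦ disjointCost ⟧ m)) 3)))

Affordable : ∀ {d} → HSInstance d → HSInstance d → Set
Affordable {d} x z = StepWitness (HittingSet d) 1 (budget (length (ΦHS x))) x z

absurd-witness : ∀ {d} (x z : HSInstance d) → length (ΦHS z) ≤ ⟦ countClauses ⟧ (length (ΦHS x)) →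
                 `⊥ ∈ clauseForms (ΦHS x) → Affordable x z
absurd-witness x z few ⊥∈ = relax (absurd-budget (length (ΦHS x)))
  (SingleStep.byContradiction x z {L = ⟦ countClauses ⟧ (length (ΦHS x))} few (assume ⊥∈))

retraction-witness : ∀ {d} (x z : HSInstance d) → k z ≡ k x → 1 ≤ k x → n z ≤ n x →
                     length (ΦHS z) ≤ ⟦ countClauses ⟧ (length (ΦHS x)) → (g : Fin (n x) → Fin (n z)) →
                     (∀ {B} → B ∈ 𝒜 z → ∃[ A ] A ∈ 𝒜 x × (∀ {i} → i ∈ˢ A → g i ∈ˢ B)) → Affordable x z
retraction-witness x z k≡ 1≤k n≤ few g covered = relax (retraction-budget (length (ΦHS x)))
  (Retraction.witness x z k≡ g covered (length (ΦHS x)) (Clauses.n≤length-Φ x 1≤k)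
    (≤-trans n≤ (Clauses.n≤length-Φ x 1≤k)) (Clauses.k≤length-Φ x) few)

disjoint-witness : ∀ {d} (x z : HSInstance d) → 1 ≤ k x → length (ΦHS z) ≤ ⟦ countClauses ⟧ (length (ΦHS x)) →
                   (∀ {A B i} → A ∈ 𝒜 x → B ∈ 𝒜 x → i ∈ˢ A → i ∈ˢ B → A ≡ B) → k x < length (𝒜 x) → Affordable x z
disjoint-witness x z 1≤k few disjoint many = relax (disjoint-budget (length (ΦHS x)))
  (SingleStep.byContradiction x z few (Disjoint.refutation x disjoint many
    (length (ΦHS x)) (Clauses.n≤length-Φ x 1≤k) (Clauses.k≤length-Φ x)))

module Soundness (d′ : ℕ) where
  open HittingSetKernel d′
  open ParamProblem L using (Yes)
  open Clauses

  few-clauses : ∀ (x z : HSInstance d) → k z ≡ k x → n z ≤ n x → length (𝒜 z) ≤ suc (length (𝒜 x)) →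
                length (ΦHS z) ≤ ⟦ countClauses ⟧ (length (ΦHS x))
  few-clauses x z k≡ n≤ 𝒜≤ = begin
    length (ΦHS z)
      ≡⟨ length-Φ z ⟩
    k z + (k z * length (offDiagonal (n z)) + length (𝒜 z))
      ≤⟨ +-mono-≤ k≤ (+-mono-≤ (≤-trans (*-monoʳ-≤ (k z) (length-offDiagonal-≤ (n z))) (product (k x) refl))
                               (≤-trans 𝒜≤ (s≤s (length-𝒜≤length-Φ x)))) ⟩
    m + (m * (m * m) + suc m)
      ≡⟨ cong (m +_) (+-suc _ _) ⟩
    m + suc (m * (m * m) + m)
      ≡⟨ +-suc m _ ⟩
    ⟦ countClauses ⟧ m ∎
    where
    open ≤-Reasoning
    m : ℕ
    m = length (ΦHS x)
    k≤ : k z ≤ m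
    k≤ = ≤-trans (≤-reflexive k≡) (k≤length-Φ x)
    product : ∀ κ → κ ≡ k x → k z * (n z * n z) ≤ m * (m * m)
    -- For k = 0 the number of clauses says nothing about n, but the product vanishes.
    product zero    eq = ≤-trans (≤-reflexive (cong (_* (n z * n z)) (trans k≡ (sym eq)))) z≤n
    product (suc κ) eq = *-mono-≤ k≤ (*-mono-≤ nz≤ nz≤)
      where
      nz≤ : n z ≤ m
      nz≤ = ≤-trans n≤ (n≤length-Φ x (≤-trans (s≤s z≤n) (≤-reflexive eq)))

  nonempty-family : ∀ x → ¬ Yes x → ∃[ A ] A ∈ 𝒜 x
  nonempty-family x ¬yes with 𝒜 x
  ... | A ∷ _ = A , here refl
  ... | []    = ⊥-elim (¬yes (∅ , ≤-trans (≤-reflexive (∣⊥∣≡0 (n x))) z≤n , []))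

  -- Without positions there are no variables, so the clause of any set is empty; a negative
  -- instance has at least one set.
  absurd-if-k≡0 : ∀ x → ¬ Yes x → k x ≡ 0 → `⊥ ∈ clauseForms (ΦHS x)
  absurd-if-k≡0 x ¬yes k≡0 with nonempty-family x ¬yes
  ... | A , A∈ = no-pairs x A∈ λ { {i , j} _ → Fin.¬Fin0 (transport Fin k≡0 j) }

  few-trim : ∀ x → length (ΦHS (trim x)) ≤ ⟦ countClauses ⟧ (length (ΦHS x))
  few-trim x = few-clauses x (trim x) refl (∣p∣≤n (used (family x)))
    (m≤n⇒m≤1+n (≤-trans (≤-reflexive (length-map _ (family x))) (family-length x)))

  trim-witness : ∀ x → ¬ Yes x → 1 ≤ k x → Affordable x (trim x)
  trim-witness x ¬yes 1≤k with card (used (family x)) in eq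
  -- No element is used, so there is nothing to retract onto. Some set was nevertheless kept, since
  -- otherwise the empty set would be a solution; that set is empty and its clause is `⊥`.
  ... | zero = absurd-witness x (trim x) (few-trim x) (no-pairs x (family-⊆ x (proj₂ A)) λ { {i , j} p∈ →
          Fin.¬Fin0 (transport Fin eq (rank (∈-used (proj₂ A) (∈-pairs⁻ x p∈)))) })
    where
    nonempty : ∀ G → family x ≡ G → ∃[ A ] A ∈ family x
    nonempty (A ∷ G) F≡ = A , transport (A ∈_) (sym F≡) (here refl)
    nonempty []      F≡ = ⊥-elim (¬yes (∅ , ∅≤k , All.tabulate (family-hits x ∅ ∅≤k
      (λ {B} B∈ → ⊥-elim (∉[] (transport (B ∈_) F≡ B∈))))))
      where
      ∅≤k : card {n x} ∅ ≤ k x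
      ∅≤k = ≤-trans (≤-reflexive (∣⊥∣≡0 (n x))) z≤n
    A : ∃[ A ] A ∈ family x
    A = nonempty (family x) refl
  ... | suc c = retraction-witness x (trim x) refl 1≤k (∣p∣≤n (used (family x))) (few-trim x) g covered
    where
    g : Fin (n x) → Fin (n (trim x))
    g i with i ∈? used (family x)
    ... | yes i∈ = rank i∈
    -- An arbitrary target: deleted elements lie in no kept set, so only the clauses demanding some
    -- element at each position are concerned.
    ... | no  _  = transport Fin (sym eq) zero
    covered : ∀ {B} → B ∈ 𝒜 (trim x) → ∃[ A ] A ∈ 𝒜 x × (∀ {i} → i ∈ˢ A → g i ∈ˢ B)
    covered B∈ with ∈-map⁻ (restrict (used (family x))) B∈
    ... | A , A∈ , refl = A , family-⊆ x A∈ , inside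
      where
      inside : ∀ {i} → i ∈ˢ A → g i ∈ˢ restrict (used (family x)) A
      inside {i} i∈A with i ∈? used (family x)
      ... | yes i∈ = rank-∈ i∈ i∈A
      ... | no  i∉ = ⊥-elim (i∉ (∈-used A∈ i∈A))

  length-family : ∀ x → length (family x) ≤ threshold (k x) d
  length-family x = ≤-trans (≤-reflexive (sym (degree-∅ (family x))))
    (≤-trans (family-capped x ∅ (≤-trans (≤-reflexive (∣⊥∣≡0 (n x))) z≤n))
             (≤-reflexive (cong (λ m → threshold (k x) (d ∸ m)) (∣⊥∣≡0 (n x)))))

open HittingSetKernel using (family; fewSets; trim; unsolvable; kernelHS)

-- Only for d = 1 can the family be too large: for d ≥ 2 the cap on the degree
-- of ∅ already lies below the capacity.
unsolvable-witness : ∀ d′ (x : HSInstance (suc d′)) → ¬ HasHittingSet x → 1 ≤ k x →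
                     capacity (suc d′) (k x) < length (family d′ x) → Affordable x (unsolvable d′ (k x))
unsolvable-witness zero x ¬yes 1≤k many = disjoint-witness x (unsolvable 0 (k x)) 1≤k
  (few-clauses x (unsolvable 0 (k x)) refl z≤n (s≤s z≤n))
  (λ {A} {B} A∈ B∈ → card≤1⇒≡ A B (All.lookup (card≤d x) A∈) (All.lookup (card≤d x) B∈))
  (<-≤-trans (≤-<-trans k≤capacity many) (HittingSetKernel.family-length 0 x))
  where
  open Soundness 0
  open Clauses
  k≤capacity : k x ≤ capacity 1 (k x)
  k≤capacity = ≤-trans (HittingSetKernel.m^1+e≥m 0 (k x) 0) (HittingSetKernel.m^d≤capacity 0 (k x))
unsolvable-witness (suc d″) x ¬yes 1≤k many =
  ⊥-elim (<⇒≱ many (≤-trans (Soundness.length-family (suc d″) x) (threshold≤capacity d″ (k x))))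

zero-or-positive : ∀ m → m ≡ 0 ⊎ 1 ≤ m
zero-or-positive zero    = inj₁ refl
zero-or-positive (suc m) = inj₂ (s≤s z≤n)

step-witness : ∀ d′ (x : HSInstance (suc d′)) → ¬ HasHittingSet x → kernelHS d′ x ≢ x →
               Affordable x (kernelHS d′ x)
step-witness d′ x ¬yes moves with withinBounds (suc d′) (matrix x)
... | true  = ⊥-elim (moves refl)
... | false with fewSets d′ x in eq | zero-or-positive (k x)
...   | true  | inj₁ k≡0 = absurd-witness x (trim d′ x) (few-trim x) (absurd-if-k≡0 x ¬yes k≡0)
  where open Soundness d′
...   | true  | inj₂ 1≤k = Soundness.trim-witness d′ x ¬yes 1≤k
...   | false | inj₁ k≡0 = absurd-witness x (unsolvable d′ (k x)) (few-clauses x (unsolvable d′ (k x)) refl z≤n (s≤s z≤n)) (absurd-if-k≡0 x ¬yes k≡0)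
  where open Soundness d′
...   | false | inj₂ 1≤k = unsolvable-witness d′ x ¬yes 1≤k
  (≰⇒> (λ few → true≢false (trans (sym (HittingSetKernel.fewSets-complete d′ x few)) eq)))
  where
  true≢false : true ≢ false
  true≢false ()

chain-step-witness : ∀ d′ (x : HSInstance (suc d′)) → ¬ HasHittingSet x → ∀ {ℓ y z} →
                     Chain (HittingSet (suc d′)) (HittingSetKernel.rule d′ ∷ []) x ℓ y →
                     Step (HittingSet (suc d′)) (HittingSetKernel.rule d′ ∷ []) y z →
                     StepWitness (HittingSet (suc d′)) 1 (budget (length (ΦHS x))) y z
chain-step-witness d′ x ¬yes c (r , here refl , refl , moves) with HittingSetKernel.chain-shape d′ c
... | inj₂ (_ , refl , _) = ⊥-elim (moves (HittingSetKernel.kernel-idem d′ x))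
... | inj₁ (_ , refl)     = step-witness d′ x ¬yes moves

frege-sound : ∀ d′ → PolyFregeSound (HittingSet (suc d′)) (HittingSetKernel.rule d′ ∷ [])
frege-sound d′ = 1 , budgetPoly , s≤s z≤n , λ x ¬yes c step →
  relax (≤-reflexive (budget-eval (length (ΦHS x)))) (chain-step-witness d′ x ¬yes c step)

theorem5 : ((d : ℕ) → 1 ≤ d →
    Σ (Kernelization (HittingSet d)) λ K →
    ((x : HSInstance d) → 1 ≤ k x →
    length (𝒜 (kernel K x)) ≤ d * d ! * k x ^ d
    × n (kernel K x) ≤ d ^ 2 * d ! * k x ^ d)
    × (∃[ C ] ((x : HSInstance d) → 1 ≤ k x →
    ∀ {ℓ y} → Chain (HittingSet d) (rules K) x ℓ y →
    ℓ * k x ≤ C * n x ^ d))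
    × PolyFregeSound (HittingSet d) (rules K))
    × ((d κ : ℕ) → ∃[ p ] ((x : HSInstance d) → k x ≡ κ →
    Unsatisfiable (ΦHS x) →
    ∃[ s ] (ExtFregeRefutation (ΦHS x) s × s ≤ eval p (length (ΦHS x)))))
theorem5 = kernelize , hittingSet-refutable
  where
  kernelize : (d : ℕ) → 1 ≤ d → Σ (Kernelization (HittingSet d)) λ K → _
  kernelize (suc d′) _ =
    kernelization , (λ x 1≤k → kernel-sets x 1≤k , kernel-elements x 1≤k) ,
    (1 , λ x _ {ℓ} {y} c → chain-length x {ℓ} {y} c) , frege-sound d′
    where open HittingSetKernel d′
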